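{- For every $r$-partial $d$-Dyck path $\pi\in\mathbb D_r(d)$ and every marking $\Sigma$ of $\pi$, $$\mathcal G^{\pm,\mathrm{row}}_r(\pi,\Sigma)=\chi^{\mathsf P}_r(\pi,\Sigma)\quad\text{in }\mathcal P(r).$$
   Context: $\mathbb F=\mathbb Q(q,t)$; $\mathcal P(r)=\mathbb F[x_1,\dots,x_r]\otimes\Lambda_{\mathbb F}(x_{r+1},\dots)$ inside $\mathbb F[[x_1,x_2,\dots]]$, $\mathcal P(r)\subseteq\mathcal P(r+1)$. Box $(c,r)$ is the unit square with northeast corner $(c,r)$. $\mathbb D_r(d)$ is the set of paths of unit north/east steps from $(0,r)$ to $(d,d)$ weakly above the line from $(0,0)$ to $(d,d)$; for such $\pi$, $\mathrm{Area}(\pi)$ is the set of full boxes below $\pi$ and above that diagonal, where $\pi$ is extended by $r$ north steps from $(0,0)$. A corner is a box above $\pi$ whose south and east neighbouring boxes are below $\pi$; a marking is a set of corners. Alphabet $\mathcal A$: $1<\bar1<2<\bar2<\cdots$ with positive letters $v$ and negative letters $\bar v$, $|v|=|\bar v|=v$. For $a,b\in\mathcal A$, $ab$ is row-increasing if $a<b$ or $a=b$ is positive. A flagged $(\pi,\Sigma)$-row super word is a map $T:[d]\to\mathcal A$ with $T(j)T(i)$ row-increasing for every $(i,j)\in\Sigma$ and $T(i)\le i$ for $i=1,\dots,r$. $\mathrm{inv}(T)$ is the number of $(i,j)\in\mathrm{Area}(\pi)$ with $T(j)T(i)$ row-increasing; $m(T)$ is the number of negative letters; $\mathbf x^{|T|}=\prod_{i\in[d]}x_{|T(i)|}$.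 Then $\mathcal G^{\pm,\mathrm{row}}_r(\pi,\Sigma)=\sum_T t^{\mathrm{inv}(T)}(-t)^{m(T)}\mathbf x^{|T|}$ over all such $T$. Operators: $T_if=s_if+(1-t)x_i\frac{f-s_if}{x_i-x_{i+1}}$. Plethystic notation as usual, $\Omega[A]=\exp\sum_kp_k[A]/k$, $\mathcal B_nf(Z)=\langle u^0\rangle u^nf[Z-u]\Omega[(1-t)u^{ -1}Z]$. $d_-^{\mathsf P}:\mathcal P(s)\to\mathcal P(s-1)$: $x_1^{\eta_1}\cdots x_s^{\eta_s}g(x_{s+1},\dots)\mapsto x_1^{\eta_1}\cdots x_{s-1}^{\eta_{s-1}}\mathcal B_{\eta_s}(g[Z])$, $Z=x_s+x_{s+1}+\cdots$, $g$ symmetric. $d_+^{\mathsf P}:\mathcal P(s)\to\mathcal P(s+1)$: $f\mapsto -T_1\cdots T_s(x_{s+1}f)$. $\chi^{\mathsf P}_r(\pi,\Sigma)$ is obtained from $1\in\mathcal P(0)$ by traversing $\pi$ backwards from $(d,d)$ to $(0,r)$ and applying successively: for each east step not part of a marked corner, $-d_+^{\mathsf P}$; for each north step not part of a marked corner, $d_-^{\mathsf P}$; for each marked corner (the north step on its east side together with the east step on its south side), in place of those two steps the operator $\frac{1}{t-1}\big(d_-^{\mathsf P}\circ(-d_+^{\mathsf P})-(-d_+^{\mathsf P})\circ d_-^{\mathsf P}\big)$. -}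

module Defs where

open import Data.Nat as ℕ using (ℕ; zero; suc; _≤_; _<_)
open import Data.Integer as ℤ using (ℤ)
open import Data.Rational as ℚ using (ℚ)
open import Data.Bool using (Bool; true; false; if_then_else_; _∧_; _∨_; not)
open import Data.List as L using (List; []; _∷_; _++_; length; map; concatMap; foldr; upTo; filter)
open import Data.List.Relation.Unary.All using (All)
open import Data.Bool.ListAction using (any; all)
open import Data.Nat.ListAction using (sum)
open import Data.Vec as V using (Vec; _∷ʳ_)
open import Data.Product using (_×_; _,_; Σ; proj₁; proj₂)
open import Relation.Binary.PropositionalEquality using (_≡_; refl)
open import Relation.Nullary.Decidable using (⌊_⌋; yes; no)

-- Part 1.  The coefficient field.
-- Only q-free scalars occur, so everything lives in ℚ(t) ⊆ 𝔽 = ℚ(q,t).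
-- ℚ[t] : coefficient lists (constant term first); equality = equal coefficients.

QPoly : Set
QPoly = List ℚ

coeffQ : QPoly → ℕ → ℚ
coeffQ []       _       = ℚ.0ℚ
coeffQ (a ∷ _)  zero    = a
coeffQ (_ ∷ as) (suc n) = coeffQ as n

_≈Q_ : QPoly → QPoly → Set
p ≈Q q = ∀ n → coeffQ p n ≡ coeffQ q n

addQ : QPoly → QPoly → QPoly
addQ []       q        = q
addQ p        []       = p
addQ (a ∷ p)  (b ∷ q)  = (a ℚ.+ b) ∷ addQ p q

scaleQ : ℚ → QPoly → QPoly
scaleQ c = map (c ℚ.*_)

mulQ : QPoly → QPoly → QPoly
mulQ []      q = []
mulQ (a ∷ p) q = addQ (scaleQ a q) (ℚ.0ℚ ∷ mulQ p q)

-- ℚ(t): fractions num/den (denominators built below are products of 1 and t-1,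
-- hence nonzero); equality by cross multiplication.
record K : Set where
  constructor _⁄_
  field num den : QPoly
open K public

infix 4 _≈_
_≈_ : K → K → Set
x ≈ y = mulQ (num x) (den y) ≈Q mulQ (num y) (den x)

constK : ℚ → K
constK a = (a ∷ []) ⁄ (ℚ.1ℚ ∷ [])

0K 1K : K
0K = constK ℚ.0ℚ
1K = constK ℚ.1ℚ

_+K_ _*K_ : K → K → K
(a ⁄ b) +K (c ⁄ d) = addQ (mulQ a d) (mulQ c b) ⁄ mulQ b d
(a ⁄ b) *K (c ⁄ d) = mulQ a c ⁄ mulQ b d

-K_ : K → K
-K (a ⁄ b) = scaleQ (ℚ.- ℚ.1ℚ) a ⁄ b

ℕtoK : ℕ → K
ℕtoK n = constK (ℤ.+ n ℚ./ 1)

inv-suc : ℕ → K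
inv-suc k = constK (ℤ.+ 1 ℚ./ suc k)

inv-fact : ℕ → K
inv-fact i = (ℚ.1ℚ ∷ []) ⁄ ((ℤ.+ (i ℕ.!) ℚ./ 1) ∷ [])

tK : K
tK = (ℚ.0ℚ ∷ ℚ.1ℚ ∷ []) ⁄ (ℚ.1ℚ ∷ [])

_^K_ : K → ℕ → K
x ^K zero  = 1K
x ^K suc n = x *K (x ^K n)

one-minus-t : K
one-minus-t = 1K +K (-K tK)

inv-t-1 : K
inv-t-1 = (ℚ.1ℚ ∷ []) ⁄ ((ℚ.- ℚ.1ℚ) ∷ ℚ.1ℚ ∷ [])

sumK : List K → K
sumK = foldr _+K_ 0K

-- Part 2.  Λ and 𝒫(s).
-- A power-sum index list λ : List ℕ, where an entry k stands for p_(k+1),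
-- denotes p_λ = ∏ p_(k+1).  Over ℚ(t) the p_λ span Λ.

PIdx : Set
PIdx = List ℕ

-- Λ-expressions: finite linear combinations of p_λ.
LExp : Set
LExp = List (K × PIdx)

mulL : LExp → LExp → LExp
mulL f g = concatMap (λ { (c , λ₁) → map (λ { (c' , λ₂) → (c *K c' , λ₁ ++ λ₂) }) g }) f

scaleL : K → LExp → LExp
scaleL c = map (λ { (c' , λ₁) → (c *K c' , λ₁) })

oneL : LExp
oneL = (1K , []) ∷ []

-- An element of 𝒫(s) = 𝔽[x₁..x_s] ⊗ Λ(x_{s+1},…): finite sum of terms
-- c · x₁^η₁ ⋯ x_s^η_s · p_λ(x_{s+1}, x_{s+2}, …).
Poly : ℕ → Set
Poly s = List (K × Vec ℕ s × PIdx)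

scaleP : ∀ {s} → K → Poly s → Poly s
scaleP c = map (λ { (c' , η , λ₁) → (c *K c' , η , λ₁) })

negP : ∀ {s} → Poly s → Poly s
negP = scaleP (-K 1K)

_+P_ : ∀ {s} → Poly s → Poly s → Poly s
_+P_ = _++_

-- all sub-multisets S ⊆ λ, returned as (Σ_{k∈S} |p_k| , |S| , λ∖S)
splits : PIdx → List (ℕ × ℕ × PIdx)
splits []      = (0 , 0 , []) ∷ []
splits (k ∷ λ₁) = concatMap (λ { (w , m , rest) →
                     (suc k ℕ.+ w , suc m , rest) ∷ (w , m , k ∷ rest) ∷ [] }) (splits λ₁)

getV : ∀ {n} → Vec ℕ n → ℕ → ℕ
getV V.[]       _       = 0
getV (a V.∷ _)  zero    = a
getV (_ V.∷ as) (suc i) = getV as i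

setV : ∀ {n} → Vec ℕ n → ℕ → ℕ → Vec ℕ n
setV V.[]       _       _ = V.[]
setV (_ V.∷ as) zero    b = b V.∷ as
setV (a V.∷ as) (suc i) b = a V.∷ setV as i b

-- Demazure–Lusztig operator T_i (i ≥ 1), acting on x_i, x_{i+1}:
--   T_i f = s_i f + (1-t) x_i (f - s_i f)/(x_i - x_{i+1}),
-- the divided difference being computed exactly on each monomial.
Tterm : ∀ {n} → ℕ → K × Vec ℕ n × PIdx → Poly n
Tterm {n} i (c , η , λ₁) = (c , sw , λ₁) ∷ dd
  where
  p = ℕ.pred i       -- position of x_i
  a = getV η p
  b = getV η (suc p)
  with2 : ℕ → ℕ → Vec ℕ n
  with2 e₁ e₂ = setV (setV η p e₁) (suc p) e₂
  sw = with2 b a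
  c' = c *K one-minus-t
  dd : Poly n
  dd with b ℕ.<? a
  ... | yes _ = map (λ j → (c' , with2 (b ℕ.+ suc j) (a ℕ.∸ suc j) , λ₁)) (upTo (a ℕ.∸ b))
  ... | no _ with a ℕ.<? b
  ...   | yes _ = map (λ j → (-K c' , with2 (a ℕ.+ suc j) (b ℕ.∸ suc j) , λ₁)) (upTo (b ℕ.∸ a))
  ...   | no _  = []

T : ∀ {n} → ℕ → Poly n → Poly n
T i = concatMap (Tterm i)

-- multiplication by x_{s+1}, viewed in 𝒫(s+1):
-- p_k(x_{s+1},x_{s+2},…) = x_{s+1}^k + p_k(x_{s+2},…)
mulx : ∀ {s} → Poly s → Poly (suc s)
mulx = concatMap (λ { (c , η , λ₁) →
         map (λ { (w , _ , rest) → (c , η ∷ʳ suc w , rest) }) (splits λ₁) })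

Tchain : ∀ {n} → ℕ → Poly n → Poly n
Tchain zero    f = f
Tchain (suc k) f = Tchain k (T (suc k) f)

d₊ : ∀ {s} → Poly s → Poly (suc s)
d₊ {s} f = negP (Tchain s (mulx f))

-- Ω[(1-t) u⁻¹ Z] = exp Σ_{k≥1} p_k[(1-t)u⁻¹Z]/k , with
-- p_k[(1-t)u⁻¹Z] = (1-t^k) u^{-k} p_k[Z].  Writing w = u⁻¹, the series
-- A(w) = Σ_k (1-t^k)/k p_k w^k has no constant term, so the w^m coefficient of
-- exp A = Σ_i A^i / i! only involves i ≤ m.
Acoeff : ℕ → LExp
Acoeff zero    = []
Acoeff (suc k) = ((1K +K (-K (tK ^K suc k))) *K inv-suc k , k ∷ []) ∷ []

Apow : ℕ → ℕ → LExp
Apow zero    zero    = oneL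
Apow zero    (suc m) = []
Apow (suc i) m       = concatMap (λ j → mulL (Acoeff j) (Apow i (m ℕ.∸ j))) (upTo (suc m))

Ωcoeff : ℕ → LExp
Ωcoeff m = concatMap (λ i → scaleL (inv-fact i) (Apow i m)) (upTo (suc m))

-- 𝓑_n(p_λ) = ⟨u⁰⟩ uⁿ p_λ[Z-u] Ω[(1-t)u⁻¹Z], with
-- uⁿ p_λ[Z-u] = Σ_{S⊆λ} (-1)^{|S|} u^{n+|S|wt} p_{λ∖S}.
𝓑 : ℕ → PIdx → LExp
𝓑 n λ₁ = concatMap (λ { (w , m , rest) →
            scaleL ((-K 1K) ^K m) (mulL ((1K , rest) ∷ []) (Ωcoeff (n ℕ.+ w))) })
          (splits λ₁)

-- d₋ : 𝒫(s) → 𝒫(s-1):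
-- x₁^η₁⋯x_s^η_s g(x_{s+1},…) ↦ x₁^η₁⋯x_{s-1}^η_{s-1} 𝓑_{η_s}(g[Z]),  Z = x_s + x_{s+1} + ⋯
-- (the output p_μ are power sums of the new tail x_s, x_{s+1}, …).
d₋ : ∀ {s} → Poly (suc s) → Poly s
d₋ = concatMap (λ { (c , η , λ₁) →
        map (λ { (c' , μ) → (c *K c' , V.init η , μ) }) (𝓑 (V.last η) λ₁) })

-- Part 3.  Coefficients of elements of 𝒫(r) ⊆ 𝔽[[x₁,x₂,…]].
-- A monomial is a finite exponent list α = (α₁, α₂, …) (trailing zeros implicit).

Mon : Set
Mon = List ℕ

takePad : (n : ℕ) → Mon → Vec ℕ n
takePad zero    _       = V.[]
takePad (suc n) []      = 0 V.∷ takePad n []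
takePad (suc n) (a ∷ α) = a V.∷ takePad n α

allZero : Mon → Bool
allZero []      = true
allZero (a ∷ α) = ⌊ a ℕ.≟ 0 ⌋ ∧ allZero α

subAt : Mon → ℕ → ℕ → Mon
subAt []      _       _ = []
subAt (a ∷ α) zero    k = (a ℕ.∸ k) ∷ α
subAt (a ∷ α) (suc j) k = a ∷ subAt α j k

-- coefficient of y^γ in p_λ(y₁,y₂,…): the number of ways to assign each part
-- of λ to a variable so that the exponents add up to γ.
pcoeff : PIdx → Mon → ℕ
pcoeff []       γ = if allZero γ then 1 else 0
pcoeff (k ∷ λ₁) γ = sum (map (λ j → if ⌊ suc k ℕ.≤? getL γ j ⌋
                                        then pcoeff λ₁ (subAt γ j (suc k)) else 0)
                               (upTo (length γ)))
  where
  getL : Mon → ℕ → ℕ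
  getL []      _       = 0
  getL (a ∷ _) zero    = a
  getL (_ ∷ α) (suc i) = getL α i

eqVec : ∀ {n} → Vec ℕ n → Vec ℕ n → Bool
eqVec V.[]       V.[]       = true
eqVec (a V.∷ as) (b V.∷ bs) = ⌊ a ℕ.≟ b ⌋ ∧ eqVec as bs

coeffP : (r : ℕ) → Poly r → Mon → K
coeffP r f α = sumK (map (λ { (c , η , λ₁) →
                   if eqVec η (takePad r α) then c *K ℕtoK (pcoeff λ₁ (L.drop r α)) else 0K }) f)

data Step : Set where
  N E : Step

data DyckFrom (d : ℕ) : ℕ → ℕ → List Step → Set where
  done  : DyckFrom d d d []
  north : ∀ {x y π} → DyckFrom d x (suc y) π → DyckFrom d x y (N ∷ π)
  east  : ∀ {x y π} → suc x ≤ y → DyckFrom d (suc x) y π → DyckFrom d x y (E ∷ π)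

IsDyck : ℕ → ℕ → List Step → Set
IsDyck r d π = DyckFrom d 0 r π

-- height y₀ π a : the height of the a-th east step (a ≥ 1) of π started at height y₀
height : ℕ → List Step → ℕ → ℕ
height y []      _             = 0
height y (N ∷ π) a             = height (suc y) π a
height y (E ∷ π) zero          = 0
height y (E ∷ π) (suc zero)    = y
height y (E ∷ π) (suc (suc a)) = height y π (suc a)

-- Box (a,b) = unit square with north-east corner (a,b).
-- For π ∈ 𝔻_r(d) (extended by r north steps from (0,0)), box (a,b) lies below π
-- iff 1 ≤ a ≤ d and b ≤ height of π over column a; above π iff 1 ≤ a ≤ d and b > that height.
BelowPath : ℕ → ℕ → List Step → ℕ × ℕ → Set
BelowPath r d π (a , b) = 1 ≤ a × a ≤ d × b ≤ height r π a

AbovePath : ℕ → ℕ → List Step → ℕ × ℕ → Set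
AbovePath r d π (a , b) = 1 ≤ a × a ≤ d × height r π a < b

InArea : ℕ → ℕ → List Step → ℕ × ℕ → Set
InArea r d π (a , b) = BelowPath r d π (a , b) × a < b

IsCorner : ℕ → ℕ → List Step → ℕ × ℕ → Set
IsCorner r d π (a , b) =
  AbovePath r d π (a , b) × Σ ℕ (λ b' → b ≡ suc b' × BelowPath r d π (a , b'))
                          × BelowPath r d π (suc a , b)

-- a marking: a (finite) set of corners, given by a list of its elements
IsMarking : ℕ → ℕ → List Step → List (ℕ × ℕ) → Set
IsMarking r d π Σm = All (IsCorner r d π) Σm

-- letter (v , false) is the positive letter v+1, (v , true) the negative one.
Letter : Set
Letter = ℕ × Bool

∣_∣ : Letter → ℕ
∣ (v , _) ∣ = suc v

rank : Letter → ℕ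
rank (v , false) = 2 ℕ.* v
rank (v , true)  = suc (2 ℕ.* v)

isNeg : Letter → Bool
isNeg (_ , n) = n

rowInc : Letter → Letter → Bool
rowInc a b = ⌊ rank a ℕ.<? rank b ⌋ ∨ (⌊ rank a ℕ.≟ rank b ⌋ ∧ not (isNeg a))

-- a word T : [d] → 𝒜 is a list of length d, T(i) = i-th entry (1-based)
at : List Letter → ℕ → Letter
at []      _             = (0 , false)
at (a ∷ _) (suc zero)    = a
at (_ ∷ w) (suc (suc i)) = at w (suc i)
at (a ∷ _) zero          = a

-- Area(π) as a list: pairs (i,j), 1 ≤ i < j ≤ d, with box (i,j) below π
-- (j ≤ height of π over column i); this is exactly {(i,j) | InArea r d π (i , j)}.
pairs : ℕ → List (ℕ × ℕ)
pairs d = concatMap (λ i → map (λ j → (suc i , suc j)) (filter (λ j → i ℕ.<? j) (upTo d))) (upTo d)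

areaList : ℕ → ℕ → List Step → List (ℕ × ℕ)
areaList r d π = filter (λ { (i , j) → j ℕ.≤? height r π i }) (pairs d)

eqPair : ℕ × ℕ → ℕ × ℕ → Bool
eqPair (a , b) (c , e) = ⌊ a ℕ.≟ c ⌋ ∧ ⌊ b ℕ.≟ e ⌋

memPair : ℕ × ℕ → List (ℕ × ℕ) → Bool
memPair p = any (eqPair p)

allB : {A : Set} → (A → Bool) → List A → Bool
allB = all

countB : {A : Set} → (A → Bool) → List A → ℕ
countB P xs = length (L.filter (λ x → Relation.Nullary.Decidable.Core.T? (P x)) xs)
  where import Relation.Nullary.Decidable.Core

lettersUpTo : ℕ → List Letter
lettersUpTo n = concatMap (λ v → (v , false) ∷ (v , true) ∷ []) (upTo n)

words : ℕ → ℕ → List (List Letter)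
words zero    n = [] ∷ []
words (suc d) n = concatMap (λ a → map (a ∷_) (words d n)) (lettersUpTo n)

isFlaggedRowSuperWord : ℕ → List (ℕ × ℕ) → List Letter → Bool
isFlaggedRowSuperWord r Σm w =
  allB (λ { (i , j) → rowInc (at w j) (at w i) }) Σm
  ∧ allB (λ i → ⌊ rank (at w (suc i)) ℕ.≤? rank (i , false) ⌋) (upTo r)

inv : ℕ → ℕ → List Step → List Letter → ℕ
inv r d π w = countB (λ { (i , j) → rowInc (at w j) (at w i) }) (areaList r d π)

m : List Letter → ℕ
m w = countB isNeg w

-- x^{|T|} = x^α  iff  #{i : |T(i)| = v} = α_v for all v
hasContent : List Letter → Mon → Bool
hasContent w α = allB (λ v → ⌊ countB (λ a → ⌊ ∣ a ∣ ℕ.≟ suc v ⌋) w ℕ.≟ getM α v ⌋)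
                      (upTo (length α))
               ∧ ⌊ length w ℕ.≟ sum α ⌋
  where
  getM : Mon → ℕ → ℕ
  getM []      _       = 0
  getM (a ∷ _) zero    = a
  getM (_ ∷ α) (suc i) = getM α i

-- coefficient of x^α in 𝒢^{±,row}_r(π,Σ) = Σ_T t^{inv T} (-t)^{m T} x^{|T|}
-- (only words with all |T(i)| ≤ length α can contribute)
𝒢coeff : ℕ → ℕ → List Step → List (ℕ × ℕ) → Mon → K
𝒢coeff r d π Σm α =
  sumK (map (λ w → if isFlaggedRowSuperWord r Σm w ∧ hasContent w α
                     then (tK ^K inv r d π w) *K ((-K tK) ^K m w) else 0K)
            (words d (length α)))

data Move : Set where
  mE mN mC : Move   -- unmarked east step, unmarked north step, marked corner

-- forward reading of π (started at (0,r)); an east step (column c, height y)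
-- immediately followed by a north step forms the corner box (c, y+1).
moves : List (ℕ × ℕ) → ℕ → ℕ → List Step → List Move
moves Σm c y []                    = []
moves Σm c y (N ∷ π)               = mN ∷ moves Σm c (suc y) π
moves Σm c y (E ∷ π@(N ∷ π'))      =
  if memPair (suc c , suc y) Σm then mC ∷ moves Σm (suc c) (suc y) π'
                                else mE ∷ moves Σm (suc c) y π
moves Σm c y (E ∷ π@(E ∷ _))       = mE ∷ moves Σm (suc c) y π
moves Σm c y (E ∷ [])              = mE ∷ []

md₊ : ∀ {s} → Poly s → Poly (suc s)
md₊ f = negP (d₊ f)

State : Set
State = Σ ℕ Poly

applyMove : Move → State → State
applyMove mE (s , f)     = (suc s , md₊ f)
applyMove mN (zero , f)  = (zero , [])            -- never reached for π ∈ 𝔻_r(d)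
applyMove mN (suc s , f) = (s , d₋ f)
applyMove mC (zero , f)  = (zero , [])            -- never reached for π ∈ 𝔻_r(d)
applyMove mC (suc s , f) =
  (suc s , scaleP inv-t-1 (d₋ (md₊ f) +P negP (md₊ (d₋ f))))

-- traverse π backwards from (d,d), starting with 1 ∈ 𝒫(0)
-- (foldr applies the operator of the last step first)
χstate : ℕ → List Step → List (ℕ × ℕ) → State
χstate r π Σm = foldr applyMove (0 , (1K , V.[] , []) ∷ []) (moves Σm 0 r π)

χ : (r : ℕ) → List Step → List (ℕ × ℕ) → Poly r
χ r π Σm with χstate r π Σm
... | (s , f) with s ℕ.≟ r
...   | yes refl = f
...   | no _     = []             -- never reached for π ∈ 𝔻_r(d)

{-# OPTIONS --safe #-}
module Submission where

-- A signed word is read from left to right into a queue: a north step pushes the next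
-- letter, an east step pops the oldest one, so the queue holds the open columns and every
-- inversion (i , j) can be charged when j is pushed on a queue containing i.  The two
-- signs of a letter of absolute value v then contribute x_v t^#{c > v} (t^#{c = v} − t),
-- where c runs through the absolute values in the queue.  The factor vanishes when v
-- occurs once, so the queues that contribute have distinct entries, and the flag
-- condition forces the first r letters to be 1, …, r.  A marked corner is
-- (NE − EN)/(t − 1) on both sides.
--
-- For the resulting sum Y(cs) over continuations of a queue cs, exchanging the colours
-- k and k+1 is governed by T_k: if cs contains k but not k+1, replacing k by k+1 gives
-- T_k Y(cs).  This relation propagates along pushes and pops.  It gives
-- T_1 ⋯ T_s (x_1 ⋯ x_{s+1} Y(1,…,s)) = x_1 ⋯ x_{s+1} Y(2,…,s+1), which is the rule for d₊.
-- For d₋, in N variables, d₋ f = (T_N ⋯ T_s f)|_{x_{N+1} = 0}: on monomials this is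
-- T_{s+n-1} ⋯ T_s x_s^e = Σ_j Q_j(x_s,…,x_{s+n-1}) x_{s+n}^{e-j} with
-- Σ_j Q_j w^j = Π (1 − t w x_i)/(1 − w x_i) = Ω[(1−t) w Z], which follows by comparing
-- logarithmic derivatives in w.
--
-- Elements of 𝒫(s) are evaluated at points of commutative ℚ[[t]]-algebras whose
-- coordinates and their differences are nonzerodivisors, so that T_k is determined by its
-- formula multiplied by x_k − x_{k+1}; a fresh coordinate lives in the power series ring
-- over the algebra, and coefficients are read off at the generic point.

open import Defs hiding (m) renaming (N to North; E to East)
import Defs
open import Level using (0ℓ)
open import Algebra.Bundles using (CommutativeRing; RawRing)
import Algebra.Properties.AbelianGroup as AbelianGroupProps
import Algebra.Properties.Ring as RingProps
import Algebra.Solver.Ring as RingSolver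
open import Algebra.Solver.Ring.AlmostCommutativeRing
  using (AlmostCommutativeRing; fromCommutativeRing; _-Raw-AlmostCommutative⟶_; Induced-equivalence)
open import Data.Bool using (Bool; true; false; if_then_else_; _∧_; not)
import Data.Bool.Properties as Bₚ
open import Data.Empty using (⊥-elim)
open import Data.Integer as ℤ using (ℤ)
import Data.Integer.Properties as ℤₚ
open import Data.List using (List; []; _∷_; _++_; map; concatMap; foldr; filter; upTo; applyUpTo; length; drop; replicate)
import Data.List.Properties as Lₚ
open import Data.List.Relation.Unary.All using (All; []; _∷_)
import Data.List.Relation.Unary.All.Properties as Allₚ
open import Data.Maybe using (just; nothing)
open import Data.Nat as ℕ using (ℕ; zero; suc; z≤n; s≤s; _≤_; _<_)
open import Data.Nat.ListAction using (sum)
import Data.Nat.Properties as ℕₚ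
open import Data.Product using (_×_; _,_; Σ; proj₁; proj₂)
open import Data.Rational as ℚ using (ℚ)
import Data.Rational.Properties as ℚₚ
open import Data.Rational.Unnormalised as ℚᵘ using (mkℚᵘ; *≡*)
import Data.Rational.Unnormalised.Properties as ℚᵘₚ
open import Data.Sum using (_⊎_; inj₁; inj₂)
open import Data.Vec as V using (Vec)
open import Relation.Binary.Definitions using (WeaklyDecidable; Tri; tri<; tri≈; tri>)
open import Relation.Binary.PropositionalEquality
  using (_≡_; _≢_; refl; sym; trans; cong; cong₂; subst; subst₂)
import Relation.Binary.Reasoning.Setoid as SetoidReasoning
open import Relation.Nullary using (Dec; yes; no; ¬_; does)
open import Relation.Nullary.Decidable using (⌊_⌋)

-- The only denominators that occur are positive integers and t - 1, units of ℚ[[t]]; this is why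
-- scalars are expanded in powers of t, and equality in `K` follows from a common expansion. The
-- obstacle is d₋: it is given by plethysm, whereas a queue sum knows only pushes. Both can be
-- written as chains of T's, but such a chain needs one variable beyond those in use, which is set
-- to 0 afterwards, where it is no longer regular. A statement about d₋ over A with N variables
-- therefore rests on the preceding statement over A[[z]] with N + 1 variables. Hence values are
-- families over all algebras and all N, the induction along the path carries equalities at every
-- regular point, and queue sums must be compatible with z = 0. On the side of the words, a colour
-- larger than everything in the queue has push weight 1 - t, the same 1 - t as in the commutation
-- of T with x_k; this coincidence lets a chain of T's produce a whole push.

Ring : Set₁
Ring = CommutativeRing 0ℓ 0ℓ

-- Commutative rings and a solver with integer coefficients.

-- The ring solver needs decidable coefficients: formal differences of naturals.
module IntegerCoefficients (B : Ring) where
  open CommutativeRing B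
    renaming (_≈_ to _≋_; refl to ≋-refl; sym to ≋-sym; trans to ≋-trans; reflexive to ≋-reflexive)
    hiding (zero)
  open RingProps ring using (-‿distribˡ-*; -‿distribʳ-*; -0#≈0#; -‿involutive)
  open AbelianGroupProps +-abelianGroup using () renaming (⁻¹-∙-comm to -‿+-comm)
  private
    module ≋-R = SetoidReasoning setoid

  -- The separate clause for one makes `nat 1` compute to `1#`, so that the solver constant one
  -- denotes `1#` itself and not `1# + 0#`.
  nat : ℕ → Carrier
  nat zero = 0#
  nat (suc zero) = 1#
  nat (suc (suc m)) = 1# + nat (suc m)

  nat-suc : ∀ m → nat (suc m) ≋ 1# + nat m
  nat-suc zero = ≋-sym (+-identityʳ 1#)
  nat-suc (suc m) = ≋-refl

  nat-+ : ∀ m n → nat (m ℕ.+ n) ≋ nat m + nat n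
  nat-+ zero n = ≋-sym (+-identityˡ _)
  nat-+ (suc m) n = begin
    nat (suc (m ℕ.+ n))    ≈⟨ nat-suc (m ℕ.+ n) ⟩
    1# + nat (m ℕ.+ n)     ≈⟨ +-congˡ (nat-+ m n) ⟩
    1# + (nat m + nat n)   ≈⟨ +-assoc _ _ _ ⟨
    (1# + nat m) + nat n   ≈⟨ +-congʳ (nat-suc m) ⟨
    nat (suc m) + nat n    ∎ where open ≋-R

  nat-* : ∀ m n → nat (m ℕ.* n) ≋ nat m * nat n
  nat-* zero n = ≋-sym (zeroˡ _)
  nat-* (suc m) n = begin
    nat (n ℕ.+ m ℕ.* n)          ≈⟨ nat-+ n (m ℕ.* n) ⟩
    nat n + nat (m ℕ.* n)        ≈⟨ +-cong (≋-sym (*-identityˡ _)) (nat-* m n) ⟩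
    1# * nat n + nat m * nat n   ≈⟨ distribʳ _ _ _ ⟨
    (1# + nat m) * nat n         ≈⟨ *-congʳ (nat-suc m) ⟨
    nat (suc m) * nat n          ∎ where open ≋-R

  private
    -- Truncated subtraction in both directions cancels the common part, so one component is always
    -- zero: the normal form of a difference of naturals.
    norm : ℕ → ℕ → ℕ × ℕ
    norm a b = a ℕ.∸ b , b ℕ.∸ a

    norm-balance : ∀ a b → (a ℕ.∸ b) ℕ.+ b ≡ a ℕ.+ (b ℕ.∸ a)
    norm-balance zero zero = refl
    norm-balance zero (suc b) = refl
    norm-balance (suc a) zero = refl
    norm-balance (suc a) (suc b) = trans (ℕₚ.+-suc (a ℕ.∸ b) b) (cong suc (norm-balance a b))

    Coeff : RawRing 0ℓ 0ℓ
    Coeff = record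
      { Carrier = ℕ × ℕ
      ; _≈_ = _≡_
      ; _+_ = λ { (a , b) (c , d) → norm (a ℕ.+ c) (b ℕ.+ d) }
      ; _*_ = λ { (a , b) (c , d) → norm (a ℕ.* c ℕ.+ b ℕ.* d) (a ℕ.* d ℕ.+ b ℕ.* c) }
      ; -_ = λ { (a , b) → b , a }
      ; 0# = 0 , 0
      ; 1# = 1 , 0
      }

    ACR : AlmostCommutativeRing 0ℓ 0ℓ
    ACR = fromCommutativeRing B

    ⟦_⟧ : ℕ × ℕ → Carrier
    ⟦ a , zero ⟧ = nat a
    ⟦ a , suc b ⟧ = nat a - nat (suc b)

    ⟦⟧-def : ∀ a b → ⟦ a , b ⟧ ≋ nat a - nat b
    ⟦⟧-def a zero = ≋-sym (≋-trans (+-congˡ -0#≈0#) (+-identityʳ _))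
    ⟦⟧-def a (suc b) = ≋-refl

    shuffle : ∀ a b c d → (a + b) + (c + d) ≋ (a + c) + (b + d)
    shuffle a b c d = begin
      (a + b) + (c + d)  ≈⟨ +-assoc _ _ _ ⟩
      a + (b + (c + d))  ≈⟨ +-congˡ (≋-trans (≋-sym (+-assoc _ _ _)) (≋-trans (+-congʳ (+-comm b c)) (+-assoc _ _ _))) ⟩
      a + (c + (b + d))  ≈⟨ +-assoc _ _ _ ⟨
      (a + c) + (b + d)  ∎ where open ≋-R

    cancel : ∀ a b c d → a ℕ.+ d ≡ c ℕ.+ b → nat a - nat b ≋ nat c - nat d
    cancel a b c d eq = begin
      nat a - nat b                          ≈⟨ +-identityʳ _ ⟨
      (nat a - nat b) + 0#                   ≈⟨ +-congˡ (-‿inverseʳ _) ⟨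
      (nat a - nat b) + (nat d - nat d)      ≈⟨ shuffle _ _ _ _ ⟩
      (nat a + nat d) + (- nat b - nat d)    ≈⟨ +-cong (≋-trans (≋-sym (nat-+ a d)) (≋-trans (≋-reflexive (cong nat eq)) (nat-+ c b))) (+-comm _ _) ⟩
      (nat c + nat b) + (- nat d - nat b)    ≈⟨ shuffle _ _ _ _ ⟩
      (nat c - nat d) + (nat b - nat b)      ≈⟨ +-congˡ (-‿inverseʳ _) ⟩
      (nat c - nat d) + 0#                   ≈⟨ +-identityʳ _ ⟩
      nat c - nat d                          ∎ where open ≋-R

    ⟦norm⟧ : ∀ a b → ⟦ norm a b ⟧ ≋ nat a - nat b
    ⟦norm⟧ a b = ≋-trans (⟦⟧-def (a ℕ.∸ b) (b ℕ.∸ a)) (cancel (a ℕ.∸ b) (b ℕ.∸ a) a b (norm-balance a b))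

    homo-+ : ∀ p q → ⟦ RawRing._+_ Coeff p q ⟧ ≋ ⟦ p ⟧ + ⟦ q ⟧
    homo-+ (a , b) (c , d) = begin
      ⟦ norm (a ℕ.+ c) (b ℕ.+ d) ⟧             ≈⟨ ⟦norm⟧ (a ℕ.+ c) (b ℕ.+ d) ⟩
      nat (a ℕ.+ c) - nat (b ℕ.+ d)            ≈⟨ +-cong (nat-+ a c) (-‿cong (nat-+ b d)) ⟩
      (nat a + nat c) - (nat b + nat d)        ≈⟨ +-congˡ (-‿+-comm _ _) ⟨
      (nat a + nat c) + (- nat b + - nat d)    ≈⟨ shuffle _ _ _ _ ⟩
      (nat a - nat b) + (nat c - nat d)        ≈⟨ +-cong (⟦⟧-def a b) (⟦⟧-def c d) ⟨
      ⟦ a , b ⟧ + ⟦ c , d ⟧                    ∎ where open ≋-R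

    neg*neg : ∀ x y → (- x) * (- y) ≋ x * y
    neg*neg x y = ≋-trans (≋-sym (-‿distribˡ-* x (- y)))
      (≋-trans (-‿cong (≋-sym (-‿distribʳ-* x y))) (-‿involutive _))

    homo-* : ∀ p q → ⟦ RawRing._*_ Coeff p q ⟧ ≋ ⟦ p ⟧ * ⟦ q ⟧
    homo-* (a , b) (c , d) = begin
      ⟦ norm (a ℕ.* c ℕ.+ b ℕ.* d) (a ℕ.* d ℕ.+ b ℕ.* c) ⟧
        ≈⟨ ⟦norm⟧ (a ℕ.* c ℕ.+ b ℕ.* d) (a ℕ.* d ℕ.+ b ℕ.* c) ⟩
      nat (a ℕ.* c ℕ.+ b ℕ.* d) - nat (a ℕ.* d ℕ.+ b ℕ.* c)
        ≈⟨ +-cong (≋-trans (nat-+ (a ℕ.* c) _) (+-cong (nat-* a c) (nat-* b d)))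
                  (-‿cong (≋-trans (nat-+ (a ℕ.* d) _) (+-cong (nat-* a d) (nat-* b c)))) ⟩
      (A * C + b' * D) - (A * D + b' * C)
        ≈⟨ +-cong (+-congˡ (≋-sym (neg*neg b' D))) (≋-sym (-‿+-comm _ _)) ⟩
      (A * C + (- b') * (- D)) + (- (A * D) + - (b' * C))
        ≈⟨ +-congˡ (+-comm _ _) ⟩
      (A * C + (- b') * (- D)) + (- (b' * C) + - (A * D))
        ≈⟨ shuffle _ _ _ _ ⟩
      (A * C + - (b' * C)) + ((- b') * (- D) + - (A * D))
        ≈⟨ +-cong (+-congˡ (-‿distribˡ-* b' C)) (≋-trans (+-comm _ _) (+-congʳ (-‿distribʳ-* A D))) ⟩
      (A * C + (- b') * C) + (A * (- D) + (- b') * (- D))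
        ≈⟨ +-cong (distribʳ _ _ _) (distribʳ _ _ _) ⟨
      (A - b') * C + (A - b') * (- D)
        ≈⟨ distribˡ _ _ _ ⟨
      (A - b') * (C - D)
        ≈⟨ *-cong (⟦⟧-def a b) (⟦⟧-def c d) ⟨
      ⟦ a , b ⟧ * ⟦ c , d ⟧ ∎
      where
      open ≋-R
      A = nat a
      b' = nat b
      C = nat c
      D = nat d

    homo-neg : ∀ p → ⟦ RawRing.-_ Coeff p ⟧ ≋ - ⟦ p ⟧
    homo-neg (a , b) = begin
      ⟦ b , a ⟧            ≈⟨ ⟦⟧-def b a ⟩
      nat b - nat a        ≈⟨ +-comm _ _ ⟩
      - nat a + nat b      ≈⟨ +-congˡ (-‿involutive _) ⟨
      - nat a + - - nat b  ≈⟨ -‿+-comm _ _ ⟩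
      - (nat a - nat b)    ≈⟨ -‿cong (⟦⟧-def a b) ⟨
      - ⟦ a , b ⟧          ∎ where open ≋-R

    morphism : Coeff -Raw-AlmostCommutative⟶ ACR
    morphism = record
      { ⟦_⟧ = ⟦_⟧ ; +-homo = homo-+ ; *-homo = homo-* ; -‿homo = homo-neg
      ; 0-homo = ≋-refl ; 1-homo = ≋-refl }

    decide : WeaklyDecidable (Induced-equivalence morphism)
    decide (a , b) (c , d) with a ℕ.+ d ℕ.≟ c ℕ.+ b
    ... | yes eq = just (≋-trans (⟦⟧-def a b) (≋-trans (cancel a b c d eq) (≋-sym (⟦⟧-def c d))))
    ... | no _ = nothing

  open RingSolver Coeff ACR morphism decide public using (Polynomial; solve; _:+_; _:*_; _:-_)
  private
    open module Solver = RingSolver Coeff ACR morphism decide using (con; :-_)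

  constant : ∀ {n} → ℕ × ℕ → Polynomial n
  constant c = con c

  negate : ∀ {n} → Polynomial n → Polynomial n
  negate p = :- p

module Kit (B : Ring) where
  open CommutativeRing B public
    using (Carrier; _+_; _*_; -_; _-_; 0#; 1#; setoid; +-cong; +-congˡ; +-congʳ; *-cong; *-congˡ; *-congʳ; -‿cong;
           +-assoc; +-comm; +-identityˡ; +-identityʳ; *-assoc; *-comm; *-identityˡ; *-identityʳ; distribˡ; distribʳ;
           zeroˡ; zeroʳ; -‿inverseˡ; -‿inverseʳ)
    renaming (_≈_ to _≋_; refl to ≋-refl; sym to ≋-sym; trans to ≋-trans; reflexive to ≋-reflexive)
  module ≋-R = SetoidReasoning setoid
  private
    module IC = IntegerCoefficients

  -‿distribˡ-* : ∀ x y → - (x * y) ≋ - x * y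
  -‿distribˡ-* = RingProps.-‿distribˡ-* (CommutativeRing.ring B)

  -‿distribʳ-* : ∀ x y → - (x * y) ≋ x * - y
  -‿distribʳ-* = RingProps.-‿distribʳ-* (CommutativeRing.ring B)

  -0#≈0# : - 0# ≋ 0#
  -0#≈0# = RingProps.-0#≈0# (CommutativeRing.ring B)

  -‿involutive : ∀ x → - - x ≋ x
  -‿involutive = RingProps.-‿involutive (CommutativeRing.ring B)

  -‿+-comm : ∀ x y → - x + - y ≋ - (x + y)
  -‿+-comm = AbelianGroupProps.⁻¹-∙-comm (CommutativeRing.+-abelianGroup B)

  nat : ℕ → Carrier
  nat = IC.nat B

  nat-suc : ∀ m → nat (suc m) ≋ 1# + nat m
  nat-suc = IC.nat-suc B

  nat-+ : ∀ m n → nat (m ℕ.+ n) ≋ nat m + nat n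
  nat-+ = IC.nat-+ B

  nat-* : ∀ m n → nat (m ℕ.* n) ≋ nat m * nat n
  nat-* = IC.nat-* B

  infix 9 :-_
  infixl 8 _:*_
  infixl 7 _:+_ _:-_
  infix 4 _:=_

  Expr : ℕ → Set
  Expr = IC.Polynomial B

  con : ∀ {n} → ℕ × ℕ → Expr n
  con = IC.constant B

  :1 : ∀ {n} → Expr n
  :1 = con (1 , 0)

  :-_ : ∀ {n} → Expr n → Expr n
  :-_ = IC.negate B

  _:+_ _:*_ _:-_ : ∀ {n} → Expr n → Expr n → Expr n
  _:+_ = IC._:+_ B
  _:*_ = IC._:*_ B
  _:-_ = IC._:-_ B

  _:=_ : ∀ {n} → Expr n → Expr n → Expr n × Expr n
  _:=_ = _,_

  solve = IC.solve B

  infixr 9 _^_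
  _^_ : Carrier → ℕ → Carrier
  x ^ zero = 1#
  x ^ suc n = x * x ^ n

  Regular : Carrier → Set
  Regular a = ∀ b → a * b ≋ 0# → b ≋ 0#

  ^-cong : ∀ {x y} n → x ≋ y → x ^ n ≋ y ^ n
  ^-cong zero e = ≋-refl
  ^-cong (suc n) e = *-cong e (^-cong n e)

  ^-+ : ∀ x m n → x ^ (m ℕ.+ n) ≋ x ^ m * x ^ n
  ^-+ x zero n = ≋-sym (*-identityˡ _)
  ^-+ x (suc m) n = ≋-trans (*-congˡ (^-+ x m n)) (≋-sym (*-assoc _ _ _))

  1^ : ∀ n → 1# ^ n ≋ 1#
  1^ zero = ≋-refl
  1^ (suc n) = ≋-trans (*-identityˡ _) (1^ n)

  x-y≋0 : ∀ {x y} → x ≋ y → x - y ≋ 0#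
  x-y≋0 {x} {y} e = ≋-trans (+-congʳ e) (-‿inverseʳ y)

  x-y≋0⁻¹ : ∀ {x y} → x - y ≋ 0# → x ≋ y
  x-y≋0⁻¹ {x} {y} e = begin
    x            ≈⟨ solve 2 (λ x y → x := (x :- y) :+ y) ≋-refl x y ⟩
    (x - y) + y  ≈⟨ +-congʳ e ⟩
    0# + y       ≈⟨ +-identityˡ y ⟩
    y            ∎ where open ≋-R

  Regular-cancel : ∀ {a x y} → Regular a → a * x ≋ a * y → x ≋ y
  Regular-cancel {a} {x} {y} ra e = x-y≋0⁻¹ (ra (x - y)
    (≋-trans (solve 3 (λ a x y → a :* (x :- y) := a :* x :- a :* y) ≋-refl a x y) (x-y≋0 e)))

  Regular-resp : ∀ {a b} → a ≋ b → Regular a → Regular b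
  Regular-resp e ra x bx = ra x (≋-trans (*-congʳ e) bx)

  Regular-neg : ∀ {a b} → Regular (a - b) → Regular (b - a)
  Regular-neg {a} {b} r x bx = r x (begin
    (a - b) * x     ≈⟨ solve 3 (λ a b x → (a :- b) :* x := :- ((b :- a) :* x)) ≋-refl a b x ⟩
    - ((b - a) * x) ≈⟨ -‿cong bx ⟩
    - 0#            ≈⟨ -0#≈0# ⟩
    0#              ∎) where open ≋-R

  ∑ : ℕ → (ℕ → Carrier) → Carrier
  ∑ zero f = 0#
  ∑ (suc n) f = f 0 + ∑ n (λ i → f (suc i))

  ∑-cong : ∀ n {f g} → (∀ i → i ℕ.< n → f i ≋ g i) → ∑ n f ≋ ∑ n g
  ∑-cong zero e = ≋-refl
  ∑-cong (suc n) e = +-cong (e 0 (ℕ.s≤s ℕ.z≤n)) (∑-cong n (λ i i<n → e (suc i) (ℕ.s≤s i<n)))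

  ∑-0 : ∀ n {f} → (∀ i → i ℕ.< n → f i ≋ 0#) → ∑ n f ≋ 0#
  ∑-0 zero e = ≋-refl
  ∑-0 (suc n) e = ≋-trans (+-cong (e 0 (ℕ.s≤s ℕ.z≤n)) (∑-0 n (λ i i<n → e (suc i) (ℕ.s≤s i<n)))) (+-identityˡ _)

  ∑-+ : ∀ n f g → ∑ n (λ i → f i + g i) ≋ ∑ n f + ∑ n g
  ∑-+ zero f g = ≋-sym (+-identityˡ _)
  ∑-+ (suc n) f g = ≋-trans (+-congˡ (∑-+ n _ _))
    (solve 4 (λ a b c d → (a :+ b) :+ (c :+ d) := (a :+ c) :+ (b :+ d)) ≋-refl _ _ _ _)

  ∑-*ˡ : ∀ n c f → ∑ n (λ i → c * f i) ≋ c * ∑ n f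
  ∑-*ˡ zero c f = ≋-sym (zeroʳ _)
  ∑-*ˡ (suc n) c f = ≋-trans (+-congˡ (∑-*ˡ n c _)) (≋-sym (distribˡ _ _ _))

  ∑-last : ∀ n f → ∑ (suc n) f ≋ ∑ n f + f n
  ∑-last zero f = +-comm _ _
  ∑-last (suc n) f = ≋-trans (+-congˡ (∑-last n (λ i → f (suc i)))) (≋-sym (+-assoc _ _ _))

-- Power series over a commutative ring.

module Series (B : Ring) where
  open Kit B

  infixl 7 _⊛_
  -- The Cauchy product through f = f₀ + w f', giving f g = f₀ g + w (f' g). This recursion on the
  -- left factor is the one of `mulQ`, and the constant coefficient of a product computes to the
  -- product of constant coefficients.
  _⊛_ : (ℕ → Carrier) → (ℕ → Carrier) → ℕ → Carrier
  (f ⊛ g) zero = f 0 * g 0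
  (f ⊛ g) (suc m) = f 0 * g (suc m) + ((λ i → f (suc i)) ⊛ g) m

  infix 4 _≗_
  _≗_ : (ℕ → Carrier) → (ℕ → Carrier) → Set
  f ≗ g = ∀ m → f m ≋ g m

  const : Carrier → ℕ → Carrier
  const a zero = a
  const a (suc _) = 0#

  var : ℕ → Carrier
  var zero = 0#
  var (suc m) = const 1# m

  -- Coefficient m of a product sees only coefficients up to m. This truncated congruence is what
  -- allows an exponential to be cut off at level m.
  ⊛-congˡ≤ : ∀ {f f' g g'} m → (∀ i → i ℕ.≤ m → f i ≋ f' i) → (∀ i → i ℕ.≤ m → g i ≋ g' i) → (f ⊛ g) m ≋ (f' ⊛ g') m
  ⊛-congˡ≤ zero e e' = *-cong (e 0 z≤n) (e' 0 z≤n)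
  ⊛-congˡ≤ (suc m) e e' = +-cong (*-cong (e 0 z≤n) (e' (suc m) ℕₚ.≤-refl))
    (⊛-congˡ≤ m (λ i i≤m → e (suc i) (s≤s i≤m)) (λ i i≤m → e' i (ℕₚ.m≤n⇒m≤1+n i≤m)))

  ⊛-cong : ∀ {f f' g g'} → f ≗ f' → g ≗ g' → f ⊛ g ≗ f' ⊛ g'
  ⊛-cong e e' m = ⊛-congˡ≤ m (λ i _ → e i) (λ i _ → e' i)

  ⊛-suc : ∀ f g m → (f ⊛ g) (suc m) ≋ (f ⊛ (λ i → g (suc i))) m + f (suc m) * g 0
  ⊛-suc f g zero = ≋-refl
  ⊛-suc f g (suc m) = ≋-trans (+-congˡ (⊛-suc (λ i → f (suc i)) g m)) (≋-sym (+-assoc _ _ _))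

  ⊛-comm : ∀ f g → f ⊛ g ≗ g ⊛ f
  ⊛-comm f g zero = *-comm _ _
  ⊛-comm f g (suc m) = begin
    f 0 * g (suc m) + ((λ i → f (suc i)) ⊛ g) m   ≈⟨ +-cong (*-comm _ _) (⊛-comm _ g m) ⟩
    g (suc m) * f 0 + (g ⊛ (λ i → f (suc i))) m   ≈⟨ +-comm _ _ ⟩
    (g ⊛ (λ i → f (suc i))) m + g (suc m) * f 0   ≈⟨ ⊛-suc g f m ⟨
    (g ⊛ f) (suc m) ∎ where open ≋-R

  ⊛-distribʳ : ∀ h f g → (λ m → f m + g m) ⊛ h ≗ (λ m → (f ⊛ h) m + (g ⊛ h) m)
  ⊛-distribʳ h f g zero = distribʳ _ _ _
  ⊛-distribʳ h f g (suc m) = ≋-trans (+-cong (distribʳ _ _ _) (⊛-distribʳ h _ _ m))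
    (solve 4 (λ a b c d → (a :+ b) :+ (c :+ d) := (a :+ c) :+ (b :+ d)) ≋-refl _ _ _ _)

  ⊛-distribˡ : ∀ h f g → h ⊛ (λ m → f m + g m) ≗ (λ m → (h ⊛ f) m + (h ⊛ g) m)
  ⊛-distribˡ h f g m = ≋-trans (⊛-comm h _ m)
    (≋-trans (⊛-distribʳ h f g m) (+-cong (⊛-comm f h m) (⊛-comm g h m)))

  ⊛-*ˡ : ∀ a f g → (λ m → a * f m) ⊛ g ≗ (λ m → a * (f ⊛ g) m)
  ⊛-*ˡ a f g zero = *-assoc _ _ _
  ⊛-*ˡ a f g (suc m) = ≋-trans (+-cong (*-assoc _ _ _) (⊛-*ˡ a _ g m)) (≋-sym (distribˡ _ _ _))

  ⊛-0ˡ : ∀ {f} g → (∀ m → f m ≋ 0#) → ∀ m → (f ⊛ g) m ≋ 0#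
  ⊛-0ˡ g e zero = ≋-trans (*-congʳ (e 0)) (zeroˡ _)
  ⊛-0ˡ g e (suc m) = ≋-trans (+-cong (≋-trans (*-congʳ (e 0)) (zeroˡ _)) (⊛-0ˡ g (λ i → e (suc i)) m)) (+-identityˡ _)

  const-⊛ : ∀ a g → const a ⊛ g ≗ (λ m → a * g m)
  const-⊛ a g zero = ≋-refl
  const-⊛ a g (suc m) = ≋-trans (+-congˡ (⊛-0ˡ g (λ _ → ≋-refl) m)) (+-identityʳ _)

  var-⊛-0 : ∀ g → (var ⊛ g) 0 ≋ 0#
  var-⊛-0 g = zeroˡ _

  var-⊛-suc : ∀ g m → (var ⊛ g) (suc m) ≋ g m
  var-⊛-suc g m = ≋-trans (+-cong (zeroˡ _) (const-⊛ 1# g m)) (≋-trans (+-identityˡ _) (*-identityˡ _))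

  ⊛-assoc : ∀ f g h → (f ⊛ g) ⊛ h ≗ f ⊛ (g ⊛ h)
  ⊛-assoc f g h zero = *-assoc _ _ _
  ⊛-assoc f g h (suc m) = begin
    (f 0 * g 0) * h (suc m) + ((λ i → f 0 * g (suc i) + (f' ⊛ g) i) ⊛ h) m
      ≈⟨ +-cong (*-assoc _ _ _) (≋-trans (⊛-distribʳ h _ _ m) (+-cong (⊛-*ˡ (f 0) g' h m) (⊛-assoc f' g h m))) ⟩
    f 0 * (g 0 * h (suc m)) + (f 0 * (g' ⊛ h) m + (f' ⊛ (g ⊛ h)) m)
      ≈⟨ solve 4 (λ a b c d → a :* b :+ (a :* c :+ d) := a :* (b :+ c) :+ d) ≋-refl _ _ _ _ ⟩
    f 0 * (g 0 * h (suc m) + (g' ⊛ h) m) + (f' ⊛ (g ⊛ h)) m ∎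
    where
    open ≋-R
    f' = λ i → f (suc i)
    g' = λ i → g (suc i)

  seriesRing : Ring
  seriesRing = record
    { Carrier = ℕ → Carrier
    ; _≈_ = _≗_
    ; _+_ = λ f g m → f m + g m
    ; _*_ = _⊛_
    ; -_ = λ f m → - f m
    ; 0# = λ _ → 0#
    ; 1# = const 1#
    ; isCommutativeRing = record
      { isRing = record
        { +-isAbelianGroup = record
          { isGroup = record
            { isMonoid = record
              { isSemigroup = record
                { isMagma = record
                  { isEquivalence = record
                    { refl = λ _ → ≋-refl ; sym = λ e m → ≋-sym (e m) ; trans = λ e e' m → ≋-trans (e m) (e' m) }
                  ; ∙-cong = λ e e' m → +-cong (e m) (e' m) }
                ; assoc = λ f g h m → +-assoc _ _ _ }
              ; identity = (λ f m → +-identityˡ _) , (λ f m → +-identityʳ _) }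
            ; inverse = (λ f m → -‿inverseˡ _) , (λ f m → -‿inverseʳ _)
            ; ⁻¹-cong = λ e m → -‿cong (e m) }
          ; comm = λ f g m → +-comm _ _ }
        ; *-cong = ⊛-cong
        ; *-assoc = ⊛-assoc
        ; *-identity = one-⊛ , λ g m → ≋-trans (⊛-comm g (const 1#) m) (one-⊛ g m)
        ; distrib = ⊛-distribˡ , ⊛-distribʳ
        }
      ; *-comm = ⊛-comm } }
    where
    one-⊛ : ∀ g → const 1# ⊛ g ≗ g
    one-⊛ g m = ≋-trans (const-⊛ 1# g m) (*-identityˡ _)

  ⊛-∑ : ∀ f g m → (f ⊛ g) m ≋ ∑ (suc m) (λ j → f j * g (m ℕ.∸ j))
  ⊛-∑ f g zero = ≋-sym (+-identityʳ _)
  ⊛-∑ f g (suc m) = +-congˡ (⊛-∑ (λ i → f (suc i)) g m)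

  -- The Euler derivation w d/dw. It keeps the index in place, so logarithmic derivatives are
  -- compared coefficient by coefficient.
  θ : (ℕ → Carrier) → ℕ → Carrier
  θ f m = nat m * f m

  θ-⊛ : ∀ f g m → θ (f ⊛ g) m ≋ (θ f ⊛ g) m + (f ⊛ θ g) m
  θ-⊛ f g zero = solve 2 (λ a b → con (0 , 0) :* (a :* b) := (con (0 , 0) :* a) :* b :+ a :* (con (0 , 0) :* b)) ≋-refl _ _
  θ-⊛ f g (suc m) = begin
    nat (suc m) * (f 0 * g (suc m) + (f' ⊛ g) m)
      ≈⟨ distribˡ _ _ _ ⟩
    nat (suc m) * (f 0 * g (suc m)) + nat (suc m) * (f' ⊛ g) m
      ≈⟨ +-congˡ (≋-trans (*-congʳ (nat-suc m)) (distribʳ _ _ _)) ⟩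
    nat (suc m) * (f 0 * g (suc m)) + (1# * (f' ⊛ g) m + nat m * (f' ⊛ g) m)
      ≈⟨ +-congˡ (+-congˡ (θ-⊛ f' g m)) ⟩
    nat (suc m) * (f 0 * g (suc m)) + (1# * (f' ⊛ g) m + ((θ f' ⊛ g) m + (f' ⊛ θ g) m))
      ≈⟨ solve 6 (λ n a b c d e → n :* (a :* b) :+ (:1 :* c :+ (d :+ e)) :=
           ((con (0 , 0) :* a) :* b :+ (c :+ d)) :+ (a :* (n :* b) :+ e)) ≋-refl (nat (suc m)) (f 0) (g (suc m)) _ _ _ ⟩
    ((0# * f 0) * g (suc m) + ((f' ⊛ g) m + (θ f' ⊛ g) m)) + (f 0 * (nat (suc m) * g (suc m)) + (f' ⊛ θ g) m)
      ≈⟨ +-congʳ (+-congˡ (≋-trans (≋-sym (⊛-distribʳ g f' (θ f') m)) (⊛-cong lem (λ _ → ≋-refl) m))) ⟩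
    ((0# * f 0) * g (suc m) + ((λ i → nat (suc i) * f (suc i)) ⊛ g) m) + (f 0 * (nat (suc m) * g (suc m)) + (f' ⊛ θ g) m) ∎
    where
    open ≋-R
    f' = λ i → f (suc i)
    -- The shift of `θ f` is f' + θ f', because index i + 1 contributes one extra copy of the
    -- coefficient; this copy absorbs the product left over from `nat (suc m)`.
    lem : (λ i → f' i + θ f' i) ≗ (λ i → nat (suc i) * f (suc i))
    lem i = ≋-trans (solve 2 (λ n a → a :+ n :* a := (:1 :+ n) :* a) ≋-refl (nat i) _) (*-congʳ (≋-sym (nat-suc i)))

  const-regular : ∀ {a} → Regular a → ∀ g → const a ⊛ g ≗ (λ _ → 0#) → g ≗ (λ _ → 0#)
  const-regular ra g e m = ra (g m) (≋-trans (≋-sym (const-⊛ _ g m)) (e m))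

  var-regular : ∀ g → var ⊛ g ≗ (λ _ → 0#) → g ≗ (λ _ → 0#)
  var-regular g e m = ≋-trans (≋-sym (var-⊛-suc g m)) (e (suc m))

  -- Comparing coefficients in (a − z) g = 0 gives a g₀ = 0 and a gₘ₊₁ = gₘ.
  const-var-regular : ∀ {a} → Regular a → ∀ g → (λ m → const a m - var m) ⊛ g ≗ (λ _ → 0#) → g ≗ (λ _ → 0#)
  const-var-regular {a} ra g e = go
    where
    split : ∀ m → a * g m - (var ⊛ g) m ≋ 0#
    split m = begin
      a * g m - (var ⊛ g) m                                  ≈⟨ +-cong (const-⊛ a g m) (neg m) ⟨
      (const a ⊛ g) m + ((λ i → - var i) ⊛ g) m              ≈⟨ ⊛-distribʳ g (const a) (λ i → - var i) m ⟨
      ((λ i → const a i - var i) ⊛ g) m                      ≈⟨ e m ⟩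
      0#                                                     ∎
      where
      open ≋-R
      minus : ∀ x → - x ≋ (- 1#) * x
      minus x = solve 1 (λ x → :- x := (:- :1) :* x) ≋-refl x
      neg : ∀ m → ((λ i → - var i) ⊛ g) m ≋ - (var ⊛ g) m
      neg m = ≋-trans (⊛-cong (λ i → minus (var i)) (λ _ → ≋-refl) m)
        (≋-trans (⊛-*ˡ (- 1#) var g m) (≋-sym (minus _)))
    go : ∀ m → g m ≋ 0#
    go zero = ra _ (≋-trans (x-y≋0⁻¹ (split 0)) (var-⊛-0 g))
    go (suc m) = ra _ (≋-trans (x-y≋0⁻¹ (split (suc m))) (≋-trans (var-⊛-suc g m) (go m)))

-- The ring ℚ[[t]] and the expansion of scalars.

module Q = Kit ℚₚ.+-*-commutativeRing
module QS = Series ℚₚ.+-*-commutativeRing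

R₀ : Ring
R₀ = QS.seriesRing

module R = Kit R₀

open QS using () renaming (_⊛_ to _⊛₀_; _≗_ to _≗₀_)

fromℚᵘ-+ : ∀ p q → ℚ.fromℚᵘ p ℚ.+ ℚ.fromℚᵘ q ≡ ℚ.fromℚᵘ (p ℚᵘ.+ q)
fromℚᵘ-+ p q = ℚₚ.toℚᵘ-injective (ℚᵘₚ.≃-trans (ℚₚ.toℚᵘ-homo-+ (ℚ.fromℚᵘ p) (ℚ.fromℚᵘ q))
  (ℚᵘₚ.≃-trans (ℚᵘₚ.+-cong (ℚₚ.toℚᵘ-fromℚᵘ p) (ℚₚ.toℚᵘ-fromℚᵘ q)) (ℚᵘₚ.≃-sym (ℚₚ.toℚᵘ-fromℚᵘ (p ℚᵘ.+ q)))))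

fromℚᵘ-* : ∀ p q → ℚ.fromℚᵘ p ℚ.* ℚ.fromℚᵘ q ≡ ℚ.fromℚᵘ (p ℚᵘ.* q)
fromℚᵘ-* p q = ℚₚ.toℚᵘ-injective (ℚᵘₚ.≃-trans (ℚₚ.toℚᵘ-homo-* (ℚ.fromℚᵘ p) (ℚ.fromℚᵘ q))
  (ℚᵘₚ.≃-trans (ℚᵘₚ.*-cong (ℚₚ.toℚᵘ-fromℚᵘ p) (ℚₚ.toℚᵘ-fromℚᵘ q)) (ℚᵘₚ.≃-sym (ℚₚ.toℚᵘ-fromℚᵘ (p ℚᵘ.* q)))))

ℕ/1 : ∀ n → ℤ.+ n ℚ./ 1 ≡ Q.nat n
ℕ/1 zero = refl
ℕ/1 (suc n) = trans
  (trans (ℚₚ.fromℚᵘ-cong {mkℚᵘ (ℤ.+ suc n) 0} {mkℚᵘ (ℤ.+ 1) 0 ℚᵘ.+ mkℚᵘ (ℤ.+ n) 0} (*≡* eq))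
           (sym (fromℚᵘ-+ (mkℚᵘ (ℤ.+ 1) 0) (mkℚᵘ (ℤ.+ n) 0))))
  (trans (cong (ℚ.1ℚ ℚ.+_) (ℕ/1 n)) (sym (Q.nat-suc n)))
  where
  eq : ℤ.+ suc n ℤ.* ℤ.+ 1 ≡ (ℤ.+ 1 ℤ.* ℤ.+ 1 ℤ.+ ℤ.+ n ℤ.* ℤ.+ 1) ℤ.* ℤ.+ 1
  eq = cong (λ z → z ℤ.* (ℤ.+ 1)) (cong (λ z → (ℤ.+ 1) ℤ.+ z) (sym (ℤₚ.*-identityʳ (ℤ.+ n))))

1/ : ℕ → ℚ
1/ k = ℤ.+ 1 ℚ./ suc k

suc*1/ : ∀ k → Q.nat (suc k) ℚ.* 1/ k ≡ ℚ.1ℚ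
suc*1/ k = trans (cong (ℚ._* 1/ k) (sym (ℕ/1 (suc k))))
  (trans (fromℚᵘ-* (mkℚᵘ (ℤ.+ suc k) 0) (mkℚᵘ (ℤ.+ 1) k))
    (ℚₚ.fromℚᵘ-cong {mkℚᵘ (ℤ.+ suc k) 0 ℚᵘ.* mkℚᵘ (ℤ.+ 1) k} {mkℚᵘ (ℤ.+ 1) 0}
      (*≡* eq)))
  where
  eq : (ℤ.+ suc k ℤ.* ℤ.+ 1) ℤ.* ℤ.+ 1 ≡ ℤ.+ 1 ℤ.* (ℤ.+ suc (k ℕ.+ 0))
  eq = trans (trans (ℤₚ.*-identityʳ _) (ℤₚ.*-identityʳ _))
    (sym (trans (ℤₚ.*-identityˡ _) (cong (λ z → ℤ.+ suc z) (ℕₚ.+-identityʳ k))))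

coeffQ-addQ : ∀ p q → coeffQ (addQ p q) ≗₀ (λ n → coeffQ p n ℚ.+ coeffQ q n)
coeffQ-addQ [] q n = sym (ℚₚ.+-identityˡ _)
coeffQ-addQ (a ∷ p) [] n = sym (ℚₚ.+-identityʳ _)
coeffQ-addQ (a ∷ p) (b ∷ q) zero = refl
coeffQ-addQ (a ∷ p) (b ∷ q) (suc n) = coeffQ-addQ p q n

coeffQ-scaleQ : ∀ c p → coeffQ (scaleQ c p) ≗₀ (λ n → c ℚ.* coeffQ p n)
coeffQ-scaleQ c [] n = sym (ℚₚ.*-zeroʳ c)
coeffQ-scaleQ c (a ∷ p) zero = refl
coeffQ-scaleQ c (a ∷ p) (suc n) = coeffQ-scaleQ c p n

coeffQ-mulQ : ∀ p q → coeffQ (mulQ p q) ≗₀ coeffQ p ⊛₀ coeffQ q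
coeffQ-mulQ [] q n = sym (QS.⊛-0ˡ (coeffQ q) (λ _ → refl) n)
coeffQ-mulQ (a ∷ p) q zero = trans (coeffQ-addQ (scaleQ a q) _ 0)
  (trans (ℚₚ.+-identityʳ _) (coeffQ-scaleQ a q 0))
coeffQ-mulQ (a ∷ p) q (suc n) = trans (coeffQ-addQ (scaleQ a q) _ (suc n))
  (cong₂ ℚ._+_ (coeffQ-scaleQ a q (suc n)) (coeffQ-mulQ p q n))

coeffQ-const : ∀ a → coeffQ (a ∷ []) ≗₀ QS.const a
coeffQ-const a zero = refl
coeffQ-const a (suc n) = refl

module Fractions (B : Ring) where
  open Kit B

  -- The equation `a ≋ v * b` expresses that a/b has the value v without inverting b.
  frac-+ : ∀ {a b c d v w} → a ≋ v * b → c ≋ w * d → a * d + c * b ≋ (v + w) * (b * d)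
  frac-+ {a} {b} {c} {d} {v} {w} e e' = ≋-trans (+-cong (*-congʳ e) (*-congʳ e'))
    (solve 4 (λ b d v w → v :* b :* d :+ w :* d :* b := (v :+ w) :* (b :* d)) ≋-refl b d v w)

  frac-* : ∀ {a b c d v w} → a ≋ v * b → c ≋ w * d → a * c ≋ (v * w) * (b * d)
  frac-* {a} {b} {c} {d} {v} {w} e e' = ≋-trans (*-cong e e')
    (solve 4 (λ b d v w → (v :* b) :* (w :* d) := (v :* w) :* (b :* d)) ≋-refl b d v w)

  frac-eq : ∀ {a b c d v} → a ≋ v * b → c ≋ v * d → a * d ≋ c * b
  frac-eq {a} {b} {c} {d} {v} e e' = ≋-trans (*-congʳ e) (≋-trans
    (solve 3 (λ b d v → (v :* b) :* d := (v :* d) :* b) ≋-refl b d v) (*-congʳ (≋-sym e')))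

  interchange : ∀ a b c d → (a * b) * (c * d) ≋ (c * a) * (b * d)
  interchange = solve 4 (λ a b c d → (a :* b) :* (c :* d) := (c :* a) :* (b :* d)) ≋-refl

private module F = Fractions R₀

-- VAL x r : the fraction x expands to the power series r in t.
record VAL (x : K) (r : R.Carrier) : Set where
  constructor val
  field unVal : coeffQ (num x) ≗₀ r ⊛₀ coeffQ (den x)
open VAL

-- With numerators r b and r d over the denominators b and d, both cross products are r b d.
VAL-≈ : ∀ {x y r} → VAL x r → VAL y r → x ≈ y
VAL-≈ {x} {y} {r} (val e) (val e') n = trans (coeffQ-mulQ (num x) (den y) n)
  (trans (F.frac-eq {coeffQ (num x)} {coeffQ (den x)} {coeffQ (num y)} {coeffQ (den y)} {r} e e' n)
    (sym (coeffQ-mulQ (num y) (den x) n)))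

VAL-resp : ∀ {x r r'} → r R.≋ r' → VAL x r → VAL x r'
VAL-resp {x} e (val e') = val λ n → trans (e' n) (QS.⊛-cong e (λ _ → refl) n)

VAL-+ : ∀ {x y r r'} → VAL x r → VAL y r' → VAL (x +K y) (r R.+ r')
VAL-+ {a ⁄ b} {c ⁄ d} {r} {r'} (val e) (val e') = val λ n → trans (coeffQ-addQ (mulQ a d) (mulQ c b) n)
  (trans (cong₂ ℚ._+_ (coeffQ-mulQ a d n) (coeffQ-mulQ c b n))
  (trans (F.frac-+ {coeffQ a} {coeffQ b} {coeffQ c} {coeffQ d} {r} {r'} e e' n)
    (QS.⊛-cong {f = r R.+ r'} (λ _ → refl) (λ i → sym (coeffQ-mulQ b d i)) n)))

VAL-* : ∀ {x y r r'} → VAL x r → VAL y r' → VAL (x *K y) (r R.* r')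
VAL-* {a ⁄ b} {c ⁄ d} {r} {r'} (val e) (val e') = val λ n → trans (coeffQ-mulQ a c n)
  (trans (F.frac-* {coeffQ a} {coeffQ b} {coeffQ c} {coeffQ d} {r} {r'} e e' n)
    (QS.⊛-cong {f = r R.* r'} (λ _ → refl) (λ i → sym (coeffQ-mulQ b d i)) n))

VAL-neg : ∀ {x r} → VAL x r → VAL (-K x) (R.- r)
VAL-neg {a ⁄ b} {r} (val e) = val λ n → trans (coeffQ-scaleQ (ℚ.- ℚ.1ℚ) a n)
  (trans (Q.≋-sym (Q.-‿distribˡ-* ℚ.1ℚ (coeffQ a n))) (trans (cong ℚ.-_ (trans (ℚₚ.*-identityˡ (coeffQ a n)) (e n)))
    (R.-‿distribˡ-* r (coeffQ b) n)))

VAL-1den : ∀ {p r} → coeffQ p ≗₀ r → VAL (p ⁄ (ℚ.1ℚ ∷ [])) r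
VAL-1den {p} {r} e = val λ n → trans (e n) (sym (trans
  (QS.⊛-cong {f = r} (λ _ → refl) (coeffQ-const ℚ.1ℚ) n) (R.*-identityʳ r n)))

VAL-const : ∀ a → VAL (constK a) (QS.const a)
VAL-const a = VAL-1den {a ∷ []} (coeffQ-const a)

VAL-0 : VAL 0K R.0#
VAL-0 = VAL-resp {0K} lem (VAL-const ℚ.0ℚ)
  where
  lem : QS.const ℚ.0ℚ ≗₀ R.0#
  lem zero = refl
  lem (suc n) = refl

VAL-1 : VAL 1K R.1#
VAL-1 = VAL-const ℚ.1ℚ

tS : R.Carrier
tS = QS.var

VAL-t : VAL tK tS
VAL-t = VAL-1den {ℚ.0ℚ ∷ ℚ.1ℚ ∷ []} lem
  where
  lem : coeffQ (ℚ.0ℚ ∷ ℚ.1ℚ ∷ []) ≗₀ QS.var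
  lem zero = refl
  lem (suc zero) = refl
  lem (suc (suc n)) = refl

VAL-^ : ∀ {x r} n → VAL x r → VAL (x ^K n) (r R.^ n)
VAL-^ zero v = VAL-1
VAL-^ {x} {r} (suc n) v = VAL-* {x} {x ^K n} v (VAL-^ n v)

VAL-1-t : VAL one-minus-t (R.1# R.- tS)
VAL-1-t = VAL-+ {1K} { -K tK} VAL-1 (VAL-neg {tK} VAL-t)

constS-nat : ∀ n → QS.const (Q.nat n) ≗₀ R.nat n
constS-nat zero zero = refl
constS-nat zero (suc m) = refl
constS-nat (suc zero) m = refl
constS-nat (suc (suc n)) zero = cong (ℚ.1ℚ ℚ.+_) (constS-nat (suc n) zero)
constS-nat (suc (suc n)) (suc m) = trans (constS-nat (suc n) (suc m)) (sym (ℚₚ.+-identityˡ _))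

VAL-ℕ : ∀ n → VAL (ℕtoK n) (R.nat n)
VAL-ℕ n = VAL-resp {ℕtoK n} (λ m → trans (cong (λ a → QS.const a m) (ℕ/1 n)) (constS-nat n m)) (VAL-const _)

1/S : ℕ → R.Carrier
1/S k = QS.const (1/ k)

VAL-inv-suc : ∀ k → VAL (inv-suc k) (1/S k)
VAL-inv-suc k = VAL-const _

suc*1/S : ∀ k → R.nat (suc k) R.* 1/S k R.≋ R.1#
suc*1/S k m = trans (R.*-congʳ {1/S k} (λ i → sym (constS-nat (suc k) i)) m)
  (trans (QS.const-⊛ (Q.nat (suc k)) (1/S k) m) (lem m))
  where
  lem : ∀ m → Q.nat (suc k) ℚ.* 1/S k m ≡ QS.const ℚ.1ℚ m
  lem zero = suc*1/ k
  lem (suc m) = ℚₚ.*-zeroʳ (Q.nat (suc k))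

-- Built as a product of the reciprocals 1/(k + 1), so that (i + 1) · 1/(i + 1)! = 1/i! needs only
-- one cancellation when the exponential is differentiated.
1/!S : ℕ → R.Carrier
1/!S zero = R.1#
1/!S (suc i) = 1/S i R.* 1/!S i

!*1/!S : ∀ i → 1/!S i R.* R.nat (i ℕ.!) R.≋ R.1#
!*1/!S zero = R.*-identityˡ R.1#
!*1/!S (suc i) = begin
  (1/S i R.* 1/!S i) R.* R.nat (suc i ℕ.* (i ℕ.!))
    ≈⟨ R.*-congˡ {1/S i R.* 1/!S i} (R.nat-* (suc i) (i ℕ.!)) ⟩
  (1/S i R.* 1/!S i) R.* (R.nat (suc i) R.* R.nat (i ℕ.!))
    ≈⟨ F.interchange (1/S i) (1/!S i) (R.nat (suc i)) (R.nat (i ℕ.!)) ⟩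
  (R.nat (suc i) R.* 1/S i) R.* (1/!S i R.* R.nat (i ℕ.!))
    ≈⟨ R.*-cong (suc*1/S i) (!*1/!S i) ⟩
  R.1# R.* R.1#
    ≈⟨ R.*-identityˡ R.1# ⟩
  R.1# ∎ where open R.≋-R

VAL-inv-fact : ∀ i → VAL (inv-fact i) (1/!S i)
VAL-inv-fact i = val λ n → trans (coeffQ-const ℚ.1ℚ n) (sym (trans
  (R.*-congˡ {1/!S i} (λ m → trans (coeffQ-const _ m) (trans (cong (λ a → QS.const a m) (ℕ/1 (i ℕ.!))) (constS-nat (i ℕ.!) m))) n)
  (!*1/!S i n)))

t-1 : R.Carrier
t-1 = tS R.- R.1#

-- The geometric series 1/(t - 1) = -(1 + t + t² + ⋯), whose coefficients are all -1.
1/t-1 : R.Carrier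
1/t-1 _ = ℚ.- ℚ.1ℚ

private
  den-t-1 : coeffQ ((ℚ.- ℚ.1ℚ) ∷ ℚ.1ℚ ∷ []) ≗₀ t-1
  den-t-1 zero = refl
  den-t-1 (suc zero) = refl
  den-t-1 (suc (suc n)) = refl

  t-1*1/t-1 : t-1 R.* 1/t-1 R.≋ R.1#
  t-1*1/t-1 zero = refl
  t-1*1/t-1 (suc m) = trans (cong ((ℚ.- ℚ.1ℚ ℚ.* (ℚ.- ℚ.1ℚ)) ℚ.+_)
    (trans (QS.⊛-cong {g = 1/t-1} lem (λ _ → refl) m) (R.*-identityˡ 1/t-1 m))) refl
    where
    lem : (λ i → t-1 (suc i)) ≗₀ R.1#
    lem zero = refl
    lem (suc i) = refl

1/t-1*t-1 : 1/t-1 R.* t-1 R.≋ R.1#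
1/t-1*t-1 = R.≋-trans (R.*-comm 1/t-1 t-1) t-1*1/t-1

VAL-inv-t-1 : VAL inv-t-1 1/t-1
VAL-inv-t-1 = val λ n → trans (coeffQ-const ℚ.1ℚ n) (sym (trans
  (R.*-congˡ {1/t-1} den-t-1 n) (1/t-1*t-1 n)))

-- Algebras over ℚ[[t]].

record Alg : Set₁ where
  field base : Ring
  open Kit base public
  field
    ι : R.Carrier → Carrier
    ι-cong : ∀ {a b} → a R.≋ b → ι a ≋ ι b
    ι-+ : ∀ a b → ι (a R.+ b) ≋ ι a + ι b
    ι-* : ∀ a b → ι (a R.* b) ≋ ι a * ι b
    ι-neg : ∀ a → ι (R.- a) ≋ - ι a
    ι-0 : ι R.0# ≋ 0#
    ι-1 : ι R.1# ≋ 1#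

  t : Carrier
  t = ι tS

  ι-^ : ∀ a n → ι (a R.^ n) ≋ ι a ^ n
  ι-^ a zero = ι-1
  ι-^ a (suc n) = ≋-trans (ι-* a (a R.^ n)) (*-congˡ (ι-^ a n))

  ι-nat : ∀ n → ι (R.nat n) ≋ nat n
  ι-nat zero = ι-0
  ι-nat (suc zero) = ι-1
  ι-nat (suc (suc n)) = ≋-trans (ι-+ R.1# (R.nat (suc n))) (+-cong ι-1 (ι-nat (suc n)))

  ι-1-t : ι (R.1# R.- tS) ≋ 1# - t
  ι-1-t = ≋-trans (ι-+ R.1# (R.- tS)) (+-cong ι-1 (ι-neg tS))

  ι-1/t-1 : ι 1/t-1 * (t - 1#) ≋ 1#
  ι-1/t-1 = ≋-trans (*-congˡ (≋-sym (≋-trans (ι-+ tS (R.- R.1#)) (+-congˡ (≋-trans (ι-neg R.1#) (-‿cong ι-1))))))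
    (≋-trans (≋-sym (ι-* 1/t-1 t-1)) (≋-trans (ι-cong 1/t-1*t-1) ι-1))

  ι-1/S : ∀ k → nat (suc k) * ι (1/S k) ≋ 1#
  ι-1/S k = ≋-trans (*-congʳ (≋-sym (ι-nat (suc k)))) (≋-trans (≋-sym (ι-* (R.nat (suc k)) (1/S k)))
    (≋-trans (ι-cong (suc*1/S k)) ι-1))

  -- The image under `ι` of the rational inverse cancels k + 1. Characteristic zero enters in this
  -- way when a logarithmic derivative is integrated.
  nat-regular : ∀ k → Regular (nat (suc k))
  nat-regular k b e = begin
    b                                    ≈⟨ *-identityˡ b ⟨
    1# * b                               ≈⟨ *-congʳ (ι-1/S k) ⟨
    (nat (suc k) * ι (1/S k)) * b        ≈⟨ solve 3 (λ n i b → (n :* i) :* b := i :* (n :* b)) ≋-refl _ _ b ⟩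
    ι (1/S k) * (nat (suc k) * b)        ≈⟨ *-congˡ e ⟩
    ι (1/S k) * 0#                       ≈⟨ zeroʳ _ ⟩
    0#                                   ∎ where open ≋-R

open Alg using (base) public

PSAlg : Alg → Alg
PSAlg A = record
  { base = seriesRing
  ; ι = λ a → const (ι a)
  ; ι-cong = λ { e zero → ι-cong e ; e (suc m) → ≋-refl }
  ; ι-+ = λ { a b zero → ι-+ a b ; a b (suc m) → ≋-sym (+-identityˡ _) }
  ; ι-* = λ { a b zero → ι-* a b ; a b (suc m) → ≋-sym (≋-trans (const-⊛ (ι a) (const (ι b)) (suc m)) (zeroʳ _)) }
  ; ι-neg = λ { a zero → ι-neg a ; a (suc m) → ≋-sym -0#≈0# }
  ; ι-0 = λ { zero → ι-0 ; (suc m) → ≋-refl }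
  ; ι-1 = λ { zero → ι-1 ; (suc m) → ≋-refl }
  }
  where
  open Alg A
  open Series (base A)

R₀Alg : Alg
R₀Alg = record
  { base = R₀ ; ι = λ a → a ; ι-cong = λ e → e
  ; ι-+ = λ a b → R.≋-refl {a R.+ b} ; ι-* = λ a b → R.≋-refl {a R.* b} ; ι-neg = λ a → R.≋-refl {R.- a}
  ; ι-0 = R.≋-refl {R.0#} ; ι-1 = R.≋-refl {R.1#} }

-- Points, transpositions and the relational form of T.

-- transposition of k and k + 1
σ : ℕ → ℕ → ℕ
σ zero zero = 1
σ zero (suc zero) = 0
σ zero (suc (suc i)) = suc (suc i)
σ (suc k) zero = zero
σ (suc k) (suc i) = suc (σ k i)

σ-involutive : ∀ k i → σ k (σ k i) ≡ i
σ-involutive zero zero = refl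
σ-involutive zero (suc zero) = refl
σ-involutive zero (suc (suc i)) = refl
σ-involutive (suc k) zero = refl
σ-involutive (suc k) (suc i) = cong suc (σ-involutive k i)

σ-< : ∀ k i {n} → suc k < n → i < n → σ k i < n
σ-< zero zero p q = p
σ-< zero (suc zero) p q = ℕₚ.<-trans (s≤s z≤n) q
σ-< zero (suc (suc i)) p q = q
σ-< (suc k) zero p q = q
σ-< (suc k) (suc i) (s≤s p) (s≤s q) = s≤s (σ-< k i p q)

σ-k : ∀ k → σ k k ≡ suc k
σ-k zero = refl
σ-k (suc k) = cong suc (σ-k k)

σ-suc : ∀ k → σ k (suc k) ≡ k
σ-suc zero = refl
σ-suc (suc k) = cong suc (σ-suc k)

σ-other : ∀ k i → i ≢ k → i ≢ suc k → σ k i ≡ i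
σ-other zero zero p q = ⊥-elim (p refl)
σ-other zero (suc zero) p q = ⊥-elim (q refl)
σ-other zero (suc (suc i)) p q = refl
σ-other (suc k) zero p q = refl
σ-other (suc k) (suc i) p q = cong suc (σ-other k i (λ e → p (cong suc e)) (λ e → q (cong suc e)))

module Points (A : Alg) where
  open Alg A public

  Pt : Set
  Pt = ℕ → Carrier

  -- The exchange is a relation between two points. It is symmetric, and since `σ (suc k)` restricts
  -- to `σ k` it passes to the shifted points used in recursions over exponent vectors.
  record Sw (k : ℕ) (x x' : Pt) : Set where
    constructor sw
    field at-σ : ∀ i → x' i ≋ x (σ k i)
  open Sw public

  Sw-sym : ∀ {k x x'} → Sw k x x' → Sw k x' x
  Sw-sym {k} {x} (sw s) = sw λ i → ≋-sym (≋-trans (s (σ k i)) (≋-reflexive (cong x (σ-involutive k i))))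

  Sw-k : ∀ {k x x'} → Sw k x x' → x' k ≋ x (suc k)
  Sw-k {k} {x} (sw s) = ≋-trans (s k) (≋-reflexive (cong x (σ-k k)))

  Sw-suc : ∀ {k x x'} → Sw k x x' → x' (suc k) ≋ x k
  Sw-suc {k} {x} (sw s) = ≋-trans (s (suc k)) (≋-reflexive (cong x (σ-suc k)))

  Sw-other : ∀ {k x x'} → Sw k x x' → ∀ i → i ≢ k → i ≢ suc k → x' i ≋ x i
  Sw-other {k} {x} (sw s) i p q = ≋-trans (s i) (≋-reflexive (cong x (σ-other k i p q)))

  record Reg (N : ℕ) (x : Pt) : Set where
    field
      var-reg : ∀ i → i < N → Regular (x i)
      diff-reg : ∀ i j → i < N → j < N → i ≢ j → Regular (x i - x j)
  open Reg public

  Reg-Sw : ∀ {N k x x'} → suc k < N → Sw k x x' → Reg N x → Reg N x'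
  Reg-Sw {k = k} k<N (sw s) reg = record
    { var-reg = λ i i<N → Regular-resp (≋-sym (s i)) (var-reg reg (σ k i) (σ-< k i k<N i<N))
    ; diff-reg = λ i j i<N j<N i≢j → Regular-resp (+-cong (≋-sym (s i)) (-‿cong (≋-sym (s j))))
        (diff-reg reg (σ k i) (σ k j) (σ-< k i k<N i<N) (σ-< k j k<N j<N)
          (λ e → i≢j (trans (sym (σ-involutive k i)) (trans (cong (σ k) e) (σ-involutive k j))))) }

  Reg-k : ∀ {N k x} → suc k < N → Reg N x → Regular (x k - x (suc k))
  Reg-k {k = k} k<N reg = diff-reg reg k (suc k) (ℕₚ.<-trans (ℕₚ.n<1+n k) k<N) k<N (λ e → ℕₚ.1+n≢n (sym e))

  -- Tr x y a a' c : c = T a, where a' is a with x and y exchanged; the relation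
  -- is the defining formula of T multiplied by x − y.
  record Tr (x y a a' c : Carrier) : Set where
    constructor tr
    field unTr : (x - y) * c ≋ (t * x - y) * a' + (1# - t) * x * a
  open Tr public

  Tr-resp : ∀ {x y a a' c b b' d} → a ≋ b → a' ≋ b' → c ≋ d → Tr x y a a' c → Tr x y b b' d
  Tr-resp e e' e'' (tr h) = tr (≋-trans (*-congˡ (≋-sym e'')) (≋-trans h (+-cong (*-congˡ e') (*-congˡ e))))

  Tr-respˣ : ∀ {x y x₁ y₁ a a' c} → x ≋ x₁ → y ≋ y₁ → Tr x y a a' c → Tr x₁ y₁ a a' c
  Tr-respˣ e e' (tr h) = tr (≋-trans (*-congʳ (+-cong (≋-sym e) (-‿cong (≋-sym e')))) (≋-trans h
    (+-cong (*-congʳ (+-cong (*-congˡ e) (-‿cong e'))) (*-congʳ (*-congˡ e)))))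

  Tr-uniq : ∀ {x y a a' c d} → Regular (x - y) → Tr x y a a' c → Tr x y a a' d → c ≋ d
  Tr-uniq r (tr h) (tr h') = Regular-cancel r (≋-trans h (≋-sym h'))

  Tr-+ : ∀ {x y a a' c b b' d} → Tr x y a a' c → Tr x y b b' d → Tr x y (a + b) (a' + b') (c + d)
  Tr-+ {x} {y} {a} {a'} {c} {b} {b'} {d} (tr h) (tr h') = tr (≋-trans (distribˡ _ _ _) (≋-trans (+-cong h h')
    (solve 7 (λ x y t a a' b b' → ((t :* x :- y) :* a' :+ (:1 :- t) :* x :* a) :+ ((t :* x :- y) :* b' :+ (:1 :- t) :* x :* b)
      := (t :* x :- y) :* (a' :+ b') :+ (:1 :- t) :* x :* (a :+ b)) ≋-refl x y t a a' b b')))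

  Tr-* : ∀ {x y a a' c} s → Tr x y a a' c → Tr x y (s * a) (s * a') (s * c)
  Tr-* {x} {y} {a} {a'} {c} s (tr h) = tr (begin
    (x - y) * (s * c)   ≈⟨ solve 3 (λ z s c → z :* (s :* c) := s :* (z :* c)) ≋-refl (x - y) s c ⟩
    s * ((x - y) * c)   ≈⟨ *-congˡ h ⟩
    s * ((t * x - y) * a' + (1# - t) * x * a)
      ≈⟨ solve 6 (λ x y t a a' s → s :* ((t :* x :- y) :* a' :+ (:1 :- t) :* x :* a)
           := (t :* x :- y) :* (s :* a') :+ (:1 :- t) :* x :* (s :* a)) ≋-refl x y t a a' s ⟩
    (t * x - y) * (s * a') + (1# - t) * x * (s * a) ∎) where open ≋-R

  -- T fixes whatever is symmetric in the two variables, because (t x - y) + (1 - t) x = x - y.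
  Tr-sym : ∀ {x y a a'} → a ≋ a' → Tr x y a a' a
  Tr-sym {x} {y} {a} {a'} e = tr (≋-trans (solve 4 (λ x y t a → (x :- y) :* a :=
    (t :* x :- y) :* a :+ (:1 :- t) :* x :* a) ≋-refl x y t a) (+-congʳ (*-congˡ e)))

  Tr-0 : ∀ {x y} → Tr x y 0# 0# 0#
  Tr-0 = Tr-sym ≋-refl

  Tr-∑ : ∀ {x y} n {f f' g} → (∀ i → i < n → Tr x y (f i) (f' i) (g i)) → Tr x y (∑ n f) (∑ n f') (∑ n g)
  Tr-∑ zero h = Tr-0
  Tr-∑ (suc n) h = Tr-+ (h 0 (s≤s z≤n)) (Tr-∑ n (λ i i<n → h (suc i) (s≤s i<n)))

  -- The telescoping behind the list of monomials in `Tterm`: the sum is x (xⁿ - yⁿ)/(x - y).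
  geometric : ∀ x y n → (x - y) * ∑ n (λ j → x ^ suc j * y ^ (n ℕ.∸ suc j)) ≋ x * (x ^ n - y ^ n)
  geometric x y zero = solve 2 (λ x y → (x :- y) :* con (0 , 0) := x :* (:1 :- :1)) ≋-refl x y
  geometric x y (suc n) = begin
    (x - y) * (x * 1# * y ^ n + ∑ n (λ j → x * (x * x ^ j) * y ^ (n ℕ.∸ suc j)))
      ≈⟨ *-congˡ (+-congˡ (≋-trans (∑-cong n (λ j _ → *-assoc _ _ _)) (∑-*ˡ n x _))) ⟩
    (x - y) * (x * 1# * y ^ n + x * S)
      ≈⟨ solve 4 (λ x y z S → (x :- y) :* (x :* :1 :* z :+ x :* S) := (x :- y) :* x :* z :+ x :* ((x :- y) :* S)) ≋-refl x y _ S ⟩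
    (x - y) * x * y ^ n + x * ((x - y) * S)
      ≈⟨ +-congˡ (*-congˡ (geometric x y n)) ⟩
    (x - y) * x * y ^ n + x * (x * (x ^ n - y ^ n))
      ≈⟨ solve 4 (λ x y p q → (x :- y) :* x :* q :+ x :* (x :* (p :- q)) := x :* (x :* p :- y :* q)) ≋-refl x y (x ^ n) (y ^ n) ⟩
    x * (x ^ suc n - y ^ suc n) ∎
    where
    open ≋-R
    S = ∑ n (λ j → x ^ suc j * y ^ (n ℕ.∸ suc j))

  -- This is (x y)^b times x (xⁿ - yⁿ)/(x - y), with the exponents distributed exactly as in
  -- `Tterm`.
  ladder : Carrier → Carrier → ℕ → ℕ → Carrier
  ladder x y b n = ∑ n (λ j → x ^ (b ℕ.+ suc j) * y ^ ((b ℕ.+ n) ℕ.∸ suc j))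

  ladder-≋ : ∀ x y b n → ladder x y b n ≋ (x ^ b * y ^ b) * ∑ n (λ j → x ^ suc j * y ^ (n ℕ.∸ suc j))
  ladder-≋ x y b n = ≋-trans (∑-cong n (λ j j<n → ≋-trans
      (*-cong (^-+ x b (suc j)) (≋-trans (≋-reflexive (cong (y ^_) (ℕₚ.+-∸-assoc b j<n))) (^-+ y b _)))
      (solve 4 (λ a b c d → (a :* b) :* (c :* d) := (a :* c) :* (b :* d)) ≋-refl _ _ _ _)))
    (∑-*ˡ n _ _)

  Tr-mono> : ∀ x y b n → Tr x y (x ^ (b ℕ.+ n) * y ^ b) (y ^ (b ℕ.+ n) * x ^ b)
    (x ^ b * y ^ (b ℕ.+ n) + (1# - t) * ladder x y b n)
  Tr-mono> x y b n = tr (begin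
    (x - y) * (x ^ b * y ^ (b ℕ.+ n) + (1# - t) * ladder x y b n)
      ≈⟨ *-congˡ (+-cong (*-congˡ (^-+ y b n)) (*-congˡ (ladder-≋ x y b n))) ⟩
    (x - y) * (X * (Y * Yn) + (1# - t) * ((X * Y) * S))
      ≈⟨ solve 7 (λ x y X Y Yn t S → (x :- y) :* (X :* (Y :* Yn) :+ (:1 :- t) :* ((X :* Y) :* S))
           := (x :- y) :* (X :* (Y :* Yn)) :+ (:1 :- t) :* ((X :* Y) :* ((x :- y) :* S))) ≋-refl x y X Y Yn t S ⟩
    (x - y) * (X * (Y * Yn)) + (1# - t) * ((X * Y) * ((x - y) * S))
      ≈⟨ +-congˡ (*-congˡ (*-congˡ (geometric x y n))) ⟩
    (x - y) * (X * (Y * Yn)) + (1# - t) * ((X * Y) * (x * (Xn - Yn)))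
      ≈⟨ solve 7 (λ x y X Y Xn Yn t → (x :- y) :* (X :* (Y :* Yn)) :+ (:1 :- t) :* ((X :* Y) :* (x :* (Xn :- Yn)))
           := (t :* x :- y) :* ((Y :* Yn) :* X) :+ (:1 :- t) :* x :* ((X :* Xn) :* Y)) ≋-refl x y X Y Xn Yn t ⟩
    (t * x - y) * ((Y * Yn) * X) + (1# - t) * x * ((X * Xn) * Y)
      ≈⟨ +-cong (*-congˡ (*-congʳ (^-+ y b n))) (*-congˡ (*-congʳ (^-+ x b n))) ⟨
    (t * x - y) * (y ^ (b ℕ.+ n) * x ^ b) + (1# - t) * x * (x ^ (b ℕ.+ n) * y ^ b) ∎)
    where
    open ≋-R
    X = x ^ b
    Y = y ^ b
    Xn = x ^ n
    Yn = y ^ n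
    S = ∑ n (λ j → x ^ suc j * y ^ (n ℕ.∸ suc j))

  Tr-mono< : ∀ x y a n → Tr x y (x ^ a * y ^ (a ℕ.+ n)) (y ^ a * x ^ (a ℕ.+ n))
    (x ^ (a ℕ.+ n) * y ^ a + - (1# - t) * ladder x y a n)
  Tr-mono< x y a n = tr (begin
    (x - y) * (x ^ (a ℕ.+ n) * y ^ a + - (1# - t) * ladder x y a n)
      ≈⟨ *-congˡ (+-cong (*-congʳ (^-+ x a n)) (*-congˡ (ladder-≋ x y a n))) ⟩
    (x - y) * ((X * Xn) * Y + - (1# - t) * ((X * Y) * S))
      ≈⟨ solve 7 (λ x y X Y Xn t S → (x :- y) :* ((X :* Xn) :* Y :+ (:- (:1 :- t)) :* ((X :* Y) :* S))
           := (x :- y) :* (X :* (Y :* Xn)) :- (:1 :- t) :* ((X :* Y) :* ((x :- y) :* S))) ≋-refl x y X Y Xn t S ⟩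
    (x - y) * (X * (Y * Xn)) - (1# - t) * ((X * Y) * ((x - y) * S))
      ≈⟨ +-congˡ (-‿cong (*-congˡ (*-congˡ (geometric x y n)))) ⟩
    (x - y) * (X * (Y * Xn)) - (1# - t) * ((X * Y) * (x * (Xn - Yn)))
      ≈⟨ solve 7 (λ x y X Y Xn Yn t → (x :- y) :* (X :* (Y :* Xn)) :- (:1 :- t) :* ((X :* Y) :* (x :* (Xn :- Yn)))
           := (t :* x :- y) :* (Y :* (X :* Xn)) :+ (:1 :- t) :* x :* (X :* (Y :* Yn))) ≋-refl x y X Y Xn Yn t ⟩
    (t * x - y) * (Y * (X * Xn)) + (1# - t) * x * (X * (Y * Yn))
      ≈⟨ +-cong (*-congˡ (*-congˡ (^-+ x a n))) (*-congˡ (*-congˡ (^-+ y a n))) ⟨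
    (t * x - y) * (y ^ a * x ^ (a ℕ.+ n)) + (1# - t) * x * (x ^ a * y ^ (a ℕ.+ n)) ∎)
    where
    open ≋-R
    X = x ^ a
    Y = y ^ a
    Xn = x ^ n
    Yn = y ^ n
    S = ∑ n (λ j → x ^ suc j * y ^ (n ℕ.∸ suc j))

  IsT : ℕ → ℕ → (Pt → Carrier) → (Pt → Carrier) → Set
  IsT N k f g = ∀ x x' → Reg N x → Sw k x x' → Tr (x k) (x (suc k)) (f x) (f x') (g x)

  ∑-σ : ∀ k m f → suc k < m → ∑ m (λ i → f (σ k i)) ≋ ∑ m f
  ∑-σ zero (suc (suc m)) f _ = solve 3 (λ a b c → b :+ (a :+ c) := a :+ (b :+ c)) ≋-refl _ _ _
  ∑-σ zero (suc zero) f (s≤s ())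
  ∑-σ (suc k) (suc m) f (s≤s p) = +-congˡ (∑-σ k m (λ i → f (suc i)) p)

  ∑-σ≥ : ∀ k m f → m ≤ k → ∑ m (λ i → f (σ k i)) ≋ ∑ m f
  ∑-σ≥ k m f m≤k = ∑-cong m (λ i i<m → ≋-reflexive (cong f (σ-other k i
    (ℕₚ.<⇒≢ (ℕₚ.<-≤-trans i<m m≤k)) (ℕₚ.<⇒≢ (ℕₚ.<-≤-trans i<m (ℕₚ.m≤n⇒m≤1+n m≤k))))))

  P : ℕ → ℕ → Pt → Carrier
  P n k x = ∑ n (λ i → x i ^ k)

  -- The tail power sum as a difference of two initial ones. Each of them is symmetric in its own
  -- variables, which settles exchanges in the head and in the tail, and passing from s to s + 1
  -- subtracts a single power of `x s`.
  psum : ℕ → ℕ → ℕ → Pt → Carrier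
  psum s N k x = P N k x - P s k x

  vmono : ∀ {s} → Pt → Vec ℕ s → Carrier
  vmono x V.[] = 1#
  vmono x (a V.∷ η) = x 0 ^ a * vmono (λ i → x (suc i)) η

  prodL : (ℕ → Carrier) → List ℕ → Carrier
  prodL h [] = 1#
  prodL h (k ∷ ks) = h k * prodL h ks

  prodL-cong : ∀ {h h'} → (∀ k → h k ≋ h' k) → ∀ ks → prodL h ks ≋ prodL h' ks
  prodL-cong e [] = ≋-refl
  prodL-cong e (k ∷ ks) = *-cong (e k) (prodL-cong e ks)

  prodL-++ : ∀ h ks ls → prodL h (ks ++ ls) ≋ prodL h ks * prodL h ls
  prodL-++ h [] ls = ≋-sym (*-identityˡ _)
  prodL-++ h (k ∷ ks) ls = ≋-trans (*-congˡ (prodL-++ h ks ls)) (≋-sym (*-assoc _ _ _))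

  pmono : ℕ → ℕ → Pt → PIdx → Carrier
  pmono s N x = prodL (λ k → psum s N (suc k) x)

  mono : ∀ {s} → ℕ → Pt → Vec ℕ s → PIdx → Carrier
  mono {s} N x η ks = vmono x η * pmono s N x ks

  P-Sw : ∀ {k x x'} m n → suc k < m → Sw k x x' → P m n x' ≋ P m n x
  P-Sw {k} {x} m n k<m (sw s) = ≋-trans (∑-cong m (λ i _ → ^-cong n (s i))) (∑-σ k m (λ i → x i ^ n) k<m)

  P-Sw≥ : ∀ {k x x'} m n → m ≤ k → Sw k x x' → P m n x' ≋ P m n x
  P-Sw≥ {k} {x} m n m≤k (sw s) = ≋-trans (∑-cong m (λ i _ → ^-cong n (s i))) (∑-σ≥ k m (λ i → x i ^ n) m≤k)

  vmono-cong : ∀ {n x x'} (η : Vec ℕ n) → (∀ i → i < n → x i ≋ x' i) → vmono x η ≋ vmono x' η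
  vmono-cong V.[] e = ≋-refl
  vmono-cong (a V.∷ η) e = *-cong (^-cong a (e 0 (s≤s z≤n))) (vmono-cong η (λ i i<n → e (suc i) (s≤s i<n)))

  vmono-setV : ∀ {n} (x : Pt) (η : Vec ℕ n) k e → k < n → vmono x (setV η k e) ≋ vmono x (setV η k 0) * x k ^ e
  vmono-setV x (a V.∷ η) zero e _ = solve 2 (λ a b → a :* b := (:1 :* b) :* a) ≋-refl _ _
  vmono-setV x (a V.∷ η) (suc k) e (s≤s p) = ≋-trans (*-congˡ (vmono-setV (λ i → x (suc i)) η k e p)) (≋-sym (*-assoc _ _ _))

  set₂ : ∀ {n} → Vec ℕ n → ℕ → ℕ → ℕ → Vec ℕ n
  set₂ η k e₁ e₂ = setV (setV η k e₁) (suc k) e₂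

  setV-comm : ∀ {n} (η : Vec ℕ n) k a b → setV (setV η k a) (suc k) b ≡ setV (setV η (suc k) b) k a
  setV-comm V.[] k a b = refl
  setV-comm (c V.∷ V.[]) zero a b = refl
  setV-comm (c V.∷ d V.∷ η) zero a b = refl
  setV-comm (c V.∷ η) (suc k) a b = cong (c V.∷_) (setV-comm η k a b)

  setV-getV : ∀ {n} (η : Vec ℕ n) k → setV η k (getV η k) ≡ η
  setV-getV V.[] k = refl
  setV-getV (a V.∷ η) zero = refl
  setV-getV (a V.∷ η) (suc k) = cong (a V.∷_) (setV-getV η k)

  set₂-get : ∀ {n} (η : Vec ℕ n) k → set₂ η k (getV η k) (getV η (suc k)) ≡ η
  set₂-get η k = trans (cong (λ z → setV z (suc k) (getV η (suc k))) (setV-getV η k)) (setV-getV η (suc k))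

  vmono-set₂ : ∀ {n} (x : Pt) (η : Vec ℕ n) k e₁ e₂ → suc k < n →
    vmono x (set₂ η k e₁ e₂) ≋ vmono x (set₂ η k 0 0) * (x k ^ e₁ * x (suc k) ^ e₂)
  vmono-set₂ x η k e₁ e₂ p = begin
    vmono x (set₂ η k e₁ e₂)                          ≈⟨ vmono-setV x (setV η k e₁) (suc k) e₂ p ⟩
    vmono x (set₂ η k e₁ 0) * Y                       ≡⟨ cong (λ z → vmono x z * Y) (setV-comm η k e₁ 0) ⟩
    vmono x (setV (setV η (suc k) 0) k e₁) * Y        ≈⟨ *-congʳ (vmono-setV x (setV η (suc k) 0) k e₁ (ℕₚ.<-trans (ℕₚ.n<1+n k) p)) ⟩
    (vmono x (setV (setV η (suc k) 0) k 0) * X) * Y   ≡⟨ cong (λ z → (vmono x z * X) * Y) (setV-comm η k 0 0) ⟨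
    (vmono x (set₂ η k 0 0) * X) * Y                  ≈⟨ *-assoc _ _ _ ⟩
    vmono x (set₂ η k 0 0) * (X * Y) ∎
    where
    open ≋-R
    X = x k ^ e₁
    Y = x (suc k) ^ e₂

  vmono-00-Sw : ∀ {n} k {x x'} (η : Vec ℕ n) → suc k < n → Sw k x x' → vmono x' (set₂ η k 0 0) ≋ vmono x (set₂ η k 0 0)
  vmono-00-Sw zero (a V.∷ b V.∷ η) p (sw s) = *-congˡ (*-congˡ (vmono-cong η (λ i _ → s (suc (suc i)))))
  vmono-00-Sw zero (a V.∷ V.[]) (s≤s ()) s
  vmono-00-Sw (suc k) (a V.∷ η) (s≤s p) (sw s) = *-cong (^-cong a (s 0)) (vmono-00-Sw k η p (sw λ i → s (suc i)))

  vmono-∷ʳ : ∀ {n} (x : Pt) (η : Vec ℕ n) e → vmono x (η V.∷ʳ e) ≋ vmono x η * x n ^ e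
  vmono-∷ʳ x V.[] e = *-comm _ _
  vmono-∷ʳ x (a V.∷ η) e = ≋-trans (*-congˡ (vmono-∷ʳ (λ i → x (suc i)) η e)) (≋-sym (*-assoc _ _ _))

  ∑L : {X : Set} → List X → (X → Carrier) → Carrier
  ∑L [] f = 0#
  ∑L (u ∷ L) f = f u + ∑L L f

  ∑L-cong : {X : Set} (L : List X) {f g : X → Carrier} → (∀ u → f u ≋ g u) → ∑L L f ≋ ∑L L g
  ∑L-cong [] e = ≋-refl
  ∑L-cong (u ∷ L) e = +-cong (e u) (∑L-cong L e)

  ∑L-*ˡ : {X : Set} (L : List X) (c : Carrier) (f : X → Carrier) → ∑L L (λ u → c * f u) ≋ c * ∑L L f
  ∑L-*ˡ [] c f = ≋-sym (zeroʳ _)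
  ∑L-*ˡ (u ∷ L) c f = ≋-trans (+-congˡ (∑L-*ˡ L c f)) (≋-sym (distribˡ _ _ _))

  ∑L-++ : {X : Set} (L M : List X) (f : X → Carrier) → ∑L (L ++ M) f ≋ ∑L L f + ∑L M f
  ∑L-++ [] M f = ≋-sym (+-identityˡ _)
  ∑L-++ (u ∷ L) M f = ≋-trans (+-congˡ (∑L-++ L M f)) (≋-sym (+-assoc _ _ _))

  ∑L-concatMap : {X Y : Set} (φ : X → List Y) (f : Y → Carrier) (L : List X) →
    ∑L (concatMap φ L) f ≋ ∑L L (λ u → ∑L (φ u) f)
  ∑L-concatMap φ f [] = ≋-refl
  ∑L-concatMap φ f (u ∷ L) = ≋-trans (∑L-++ (φ u) _ f) (+-congˡ (∑L-concatMap φ f L))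

  ∑L-map : {X Y : Set} (φ : X → Y) (f : Y → Carrier) (L : List X) → ∑L (map φ L) f ≋ ∑L L (λ u → f (φ u))
  ∑L-map φ f [] = ≋-refl
  ∑L-map φ f (u ∷ L) = +-congˡ (∑L-map φ f L)

  ∑L-applyUpTo : ∀ m (g : ℕ → ℕ) (f : ℕ → Carrier) → ∑L (applyUpTo g m) f ≋ ∑ m (λ i → f (g i))
  ∑L-applyUpTo zero g f = ≋-refl
  ∑L-applyUpTo (suc m) g f = +-congˡ (∑L-applyUpTo m (λ i → g (suc i)) f)

  splits-expand : ∀ e z h ks →
    ∑L (splits ks) (λ u → e ^ proj₁ (proj₂ u) * (z ^ proj₁ u * prodL h (proj₂ (proj₂ u))))
      ≋ prodL (λ k → h k + e * z ^ suc k) ks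
  splits-expand e z h [] = solve 0 (:1 :* (:1 :* :1) :+ con (0 , 0) := :1) ≋-refl
  splits-expand e z h (k ∷ ks) = ≋-trans (∑L-concatMap _ _ (splits ks))
    (≋-trans (≋-trans (∑L-cong (splits ks) (λ { (w , m , rest) →
        ≋-trans (+-congʳ (*-congˡ (*-congʳ (*-congˡ (^-+ z k w)))))
        (solve 7 (λ e z em zk zw H hk →
          (e :* em) :* ((z :* (zk :* zw)) :* H) :+ (em :* (zw :* (hk :* H)) :+ con (0 , 0)) := (hk :+ e :* (z :* zk)) :* (em :* (zw :* H)))
          ≋-refl e z (e ^ m) (z ^ k) (z ^ w) (prodL h rest) (h k)) }))
      (∑L-*ˡ (splits ks) (h k + e * z ^ suc k) _))
    (*-congˡ (splits-expand e z h ks)))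

-- Formal combinations and their values at points.

Fun : Set₁
Fun = (A : Alg) → ℕ → Points.Pt A → Alg.Carrier A

infix 4 _≐_
_≐_ : Fun → Fun → Set₁
F ≐ G = ∀ A N x → let open Points A in F A N x ≋ G A N x

0F : Fun
0F A N x = Points.0# A

infixl 6 _+F_
_+F_ : Fun → Fun → Fun
(F +F G) A N x = let open Points A in F A N x + G A N x

infixl 7 _*F_
_*F_ : Fun → Fun → Fun
(F *F G) A N x = let open Points A in F A N x * G A N x

infixr 7 _·F_
_·F_ : R.Carrier → Fun → Fun
(r ·F F) A N x = let open Points A in ι r * F A N x

∑LF : {X : Set} → List X → (X → Fun) → Fun
∑LF L G A N x = let open Points A in ∑L L (λ u → G u A N x)

∑F : ℕ → (ℕ → Fun) → Fun
∑F m G A N x = let open Points A in ∑ m (λ i → G i A N x)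

-- Ev μ f F : if each basis element u takes the value μ u A N x at the point x with
-- variables x₀,…,x_{N-1}, then the formal combination f takes the value F A N x.
data Ev {X : Set} (μ : X → Fun) : List (K × X) → Fun → Set₁ where
  nil : ∀ {F} → F ≐ 0F → Ev μ [] F
  cons : ∀ {c r u f F G} → VAL c r → Ev μ f F → G ≐ (r ·F μ u) +F F → Ev μ ((c , u) ∷ f) G

module _ {X : Set} {μ : X → Fun} where

  Ev-resp : ∀ {f F G} → F ≐ G → Ev μ f F → Ev μ f G
  Ev-resp e (nil z) = nil (λ A N x → let open Points A in ≋-trans (≋-sym (e A N x)) (z A N x))
  Ev-resp e (cons v h z) = cons v h (λ A N x → let open Points A in ≋-trans (≋-sym (e A N x)) (z A N x))

  Ev-++ : ∀ {f g F G} → Ev μ f F → Ev μ g G → Ev μ (f ++ g) (F +F G)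
  Ev-++ (nil z) h = Ev-resp (λ A N x → let open Points A in ≋-sym (≋-trans (+-congʳ (z A N x)) (+-identityˡ _))) h
  Ev-++ (cons v h z) h' = cons v (Ev-++ h h') (λ A N x → let open Points A in ≋-trans (+-congʳ (z A N x)) (+-assoc _ _ _))

  Ev-single : ∀ {c r u} → VAL c r → Ev μ ((c , u) ∷ []) (r ·F μ u)
  Ev-single v = cons v (nil (λ A N x → Points.≋-refl A)) (λ A N x → let open Points A in ≋-sym (+-identityʳ _))

  Ev-concatMap : {Y : Set} {φ : Y → List (K × X)} {G : Y → Fun} → (∀ y → Ev μ (φ y) (G y)) →
    ∀ L → Ev μ (concatMap φ L) (∑LF L G)
  Ev-concatMap h [] = nil (λ A N x → Points.≋-refl A)
  Ev-concatMap h (y ∷ L) = Ev-++ (h y) (Ev-concatMap h L)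

  Ev-map : {Y : Set} {φ : Y → K × X} {G : Y → Fun} → (∀ y → Ev μ (φ y ∷ []) (G y)) →
    ∀ L → Ev μ (map φ L) (∑LF L G)
  Ev-map h [] = nil (λ A N x → Points.≋-refl A)
  Ev-map h (y ∷ L) = Ev-++ (h y) (Ev-map h L)

polyμ : ∀ {s} → Vec ℕ s × PIdx → Fun
polyμ u A N x = Points.mono A N x (proj₁ u) (proj₂ u)

EvP : ∀ {s} → Poly s → Fun → Set₁
EvP = Ev polyμ

scale-step : ∀ {r r'} {F G H : Fun} → H ≐ (r' ·F F) +F G → (r ·F H) ≐ ((r R.* r') ·F F) +F (r ·F G)
scale-step {r} {r'} z A N x = let open Points A in ≋-trans (*-congˡ (z A N x)) (≋-trans (distribˡ _ _ _)
    (+-congʳ (≋-trans (≋-sym (*-assoc _ _ _)) (*-congʳ (≋-sym (ι-* r r'))))))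

EvP-scale : ∀ {s} {f : Poly s} {F c r} → VAL c r → EvP f F → EvP (scaleP c f) (r ·F F)
EvP-scale v (nil z) = nil (λ A N x → let open Points A in ≋-trans (*-congˡ (z A N x)) (zeroʳ _))
EvP-scale {c = c} {r} v (cons {c = c'} {r'} {u} {F = F} {G} v' h z) =
  cons (VAL-* {c} {c'} v v') (EvP-scale v h) (scale-step {r} {r'} {polyμ u} {F} {G} z)

EvP-neg : ∀ {s} {f : Poly s} {F} → EvP f F → EvP (negP f) (λ A N x → Points.-_ A (F A N x))
EvP-neg {f = f} {F} h = Ev-resp (λ A N x → let open Points A in
    ≋-trans (*-congʳ (≋-trans (ι-neg R.1#) (-‿cong ι-1)))
      (solve 1 (λ a → (:- :1) :* a := :- a) ≋-refl (F A N x)))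
  (EvP-scale (VAL-neg {1K} VAL-1) h)

module _ {n : ℕ} (η : Vec ℕ n) (ks : PIdx) (k : ℕ) (k<n : suc k < n) where

  -- The part of the monomial that the exchange leaves fixed. T is linear over it, so only the
  -- powers of `x k` and `x (suc k)` remain to be treated.
  rest : Fun
  rest A N x = let open Points A in vmono x (set₂ η k 0 0) * pmono n N x ks

  mono-set₂ : ∀ A N x e₁ e₂ → let open Points A in
    mono N x (set₂ η k e₁ e₂) ks ≋ rest A N x * (x k ^ e₁ * x (suc k) ^ e₂)
  mono-set₂ A N x e₁ e₂ = let open Points A in ≋-trans (*-congʳ (vmono-set₂ x η k e₁ e₂ k<n))
    (solve 3 (λ a b c → (a :* b) :* c := (a :* c) :* b) ≋-refl _ _ _)

  mono-get : ∀ A N x → let open Points A in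
    mono N x η ks ≋ rest A N x * (x k ^ getV η k * x (suc k) ^ getV η (suc k))
  mono-get A N x = let open Points A in ≋-trans
    (≋-reflexive (cong (λ z → mono N x z ks) (sym (set₂-get η k)))) (mono-set₂ A N x _ _)

  rest-Sw : ∀ A N → n ≤ N → ∀ x x' → Points.Sw A k x x' → let open Points A in rest A N x' ≋ rest A N x
  rest-Sw A N n≤N x x' s = let open Points A in *-cong (vmono-00-Sw k η k<n s)
    (prodL-cong (λ j → +-cong (P-Sw N (suc j) (ℕₚ.≤-trans k<n n≤N) s) (-‿cong (P-Sw n (suc j) k<n s))) ks)

  EvP-set₂ : ∀ {c r} → VAL c r → ∀ m (e₁ e₂ : ℕ → ℕ) →
    EvP (map (λ j → (c , Points.set₂ R₀Alg η k (e₁ j) (e₂ j) , ks)) (upTo m))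
        (λ A N x → let open Points A in (ι r * rest A N x) * ∑ m (λ j → x k ^ e₁ j * x (suc k) ^ e₂ j))
  EvP-set₂ {c} {r} v m e₁ e₂ = Ev-resp (λ A N x → let open Points A in
      ≋-trans (∑L-applyUpTo m (λ i → i) _) (≋-trans (∑-cong m (λ j _ →
        ≋-trans (*-congˡ (mono-set₂ A N x (e₁ j) (e₂ j))) (≋-sym (*-assoc _ _ _)))) (∑-*ˡ m _ _)))
    (Ev-map (λ j → Ev-single v) (upTo m))

  private
    a = getV η k
    b = getV η (suc k)

  IsT-term : ∀ {r} {G H : Fun} →
    (∀ A N x → let open Points A in G A N x ≋ (ι r * rest A N x) * H A N x) →
    (∀ A N x → let open Points A in Tr (x k) (x (suc k)) (x k ^ a * x (suc k) ^ b) (x (suc k) ^ a * x k ^ b) (H A N x)) →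
    ∀ A N → n ≤ N → Points.IsT A N k ((r ·F polyμ (η , ks)) A N) (G A N)
  IsT-term {r} {G} {H} e h A N n≤N x x' reg s = let open Points A in
    Tr-resp (≋-trans (*-assoc _ _ _) (*-congˡ (≋-sym (mono-get A N x))))
      (≋-trans (*-assoc _ _ _) (*-congˡ (≋-trans (*-cong (≋-sym (rest-Sw A N n≤N x x' s))
         (*-cong (^-cong a (≋-sym (Sw-k s))) (^-cong b (≋-sym (Sw-suc s))))) (≋-sym (mono-get A N x')))))
      (≋-sym (e A N x))
      (Tr-* (ι r * rest A N x) (h A N x))

  HasT : R.Carrier → Poly n → Set₁
  HasT r g = Σ Fun λ G → EvP g G × (∀ A N → n ≤ N → Points.IsT A N k ((r ·F polyμ (η , ks)) A N) (G A N))

  swapped-part : Fun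
  swapped-part A N x = let open Points A in x k ^ b * x (suc k) ^ a

  EvP-swapped : ∀ {c r} → VAL c r → EvP ((c , Points.set₂ R₀Alg η k b a , ks) ∷ [])
    (λ A N x → let open Points A in (ι r * rest A N x) * swapped-part A N x)
  EvP-swapped v = Ev-resp (λ A N x → let open Points A in
    ≋-trans (*-congˡ (mono-set₂ A N x b a)) (≋-sym (*-assoc _ _ _))) (Ev-single v)

  HasT-intro : ∀ {r g} (G H : Fun) → EvP g G →
    (∀ A N x → let open Points A in G A N x ≋ (ι r * rest A N x) * H A N x) →
    (∀ A N x → let open Points A in Tr (x k) (x (suc k)) (x k ^ a * x (suc k) ^ b) (x (suc k) ^ a * x k ^ b) (H A N x)) →
    HasT r g
  HasT-intro {r} G H hG e h = G , hG , IsT-term {r} {G} {H} e h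

  ladderF : R.Carrier → ℕ → (ℕ → ℕ) → (ℕ → ℕ) → Fun
  ladderF q m e₁ e₂ A N x = let open Points A in
    swapped-part A N x + ι q * ∑ m (λ j → x k ^ e₁ j * x (suc k) ^ e₂ j)

  ladder-split : ∀ r q m e₁ e₂ A N x → let open Points A in
    (ι r * rest A N x) * swapped-part A N x + (ι (r R.* q) * rest A N x) * ∑ m (λ j → x k ^ e₁ j * x (suc k) ^ e₂ j)
      ≋ (ι r * rest A N x) * ladderF q m e₁ e₂ A N x
  ladder-split r q m e₁ e₂ A N x = let open Points A in ≋-trans (+-congˡ (*-congʳ (*-congʳ (ι-* r q))))
    (solve 5 (λ r s p m q → (r :* s) :* p :+ ((r :* m) :* s) :* q := (r :* s) :* (p :+ m :* q)) ≋-refl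
      (ι r) (rest A N x) (swapped-part A N x) (ι q) (∑ m (λ j → x k ^ e₁ j * x (suc k) ^ e₂ j)))

  ladderE : R.Carrier → ℕ → (ℕ → ℕ) → (ℕ → ℕ) → R.Carrier → Fun
  ladderE q m e₁ e₂ r A N x = let open Points A in
    (ι r * rest A N x) * swapped-part A N x + (ι (r R.* q) * rest A N x) * ∑ m (λ j → x k ^ e₁ j * x (suc k) ^ e₂ j)

  private
    1-t -1+t : R.Carrier
    1-t = R.1# R.- tS
    -1+t = R.- 1-t

  HasT-term : ∀ {c r} → VAL c r → HasT r (Tterm (suc k) (c , η , ks))
  -- The case distinction repeats the one in `Tterm`, so that its list of divided-difference terms
  -- computes in each branch.
  HasT-term {c} {r} v with b ℕ.<? a
  ... | yes b<a = HasT-intro (ladderE 1-t m e₁ e₂ r) (ladderF 1-t m e₁ e₂)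
      (Ev-++ (EvP-swapped v) (EvP-set₂ (VAL-* {c} {one-minus-t} v VAL-1-t) m e₁ e₂))
      (ladder-split r 1-t m e₁ e₂)
      (λ A N x → let open Points A in Tr-resp ≋-refl ≋-refl (+-congˡ (*-congʳ (≋-sym ι-1-t)))
       -- The larger exponent a is rewritten as b + (a - b), the form required by `Tr-mono>`.
       (subst (λ z → Tr (x k) (x (suc k)) (x k ^ z * x (suc k) ^ b) (x (suc k) ^ z * x k ^ b) (x k ^ b * x (suc k) ^ z +
          (1# - t) * ∑ m (λ j → x k ^ e₁ j * x (suc k) ^ (z ℕ.∸ suc j))))
        (ℕₚ.m+[n∸m]≡n (ℕₚ.<⇒≤ b<a)) (Tr-mono> (x k) (x (suc k)) b m)))
    where
    m = a ℕ.∸ b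
    e₁ e₂ : ℕ → ℕ
    e₁ j = b ℕ.+ suc j
    e₂ j = a ℕ.∸ suc j
  ... | no b≮a with a ℕ.<? b
  ... | yes a<b = HasT-intro (ladderE -1+t m e₁ e₂ r) (ladderF -1+t m e₁ e₂)
      (Ev-resp (λ A N x → let open Points A in +-congˡ (*-congʳ (*-congʳ (ι-cong (R.-‿distribʳ-* r 1-t)))))
        (Ev-++ (EvP-swapped v) (EvP-set₂ (VAL-neg {c *K one-minus-t} (VAL-* {c} {one-minus-t} v VAL-1-t)) m e₁ e₂)))
      (ladder-split r -1+t m e₁ e₂)
      (λ A N x → let open Points A in Tr-resp ≋-refl ≋-refl (+-congˡ (*-congʳ (≋-sym (≋-trans (ι-neg 1-t) (-‿cong ι-1-t)))))
       (subst (λ z → Tr (x k) (x (suc k)) (x k ^ a * x (suc k) ^ z) (x (suc k) ^ a * x k ^ z) (x k ^ z * x (suc k) ^ a +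
          - (1# - t) * ∑ m (λ j → x k ^ e₁ j * x (suc k) ^ (z ℕ.∸ suc j))))
        (ℕₚ.m+[n∸m]≡n (ℕₚ.<⇒≤ a<b)) (Tr-mono< (x k) (x (suc k)) a m)))
    where
    m = b ℕ.∸ a
    e₁ e₂ : ℕ → ℕ
    e₁ j = a ℕ.+ suc j
    e₂ j = b ℕ.∸ suc j
  ... | no a≮b = HasT-intro (λ A N x → let open Points A in (ι r * rest A N x) * swapped-part A N x) swapped-part
      (EvP-swapped v) (λ A N x → Points.≋-refl A)
      (λ A N x → let open Points A in subst
        (λ z → Tr (x k) (x (suc k)) (x k ^ z * x (suc k) ^ b) (x (suc k) ^ z * x k ^ b) (x k ^ b * x (suc k) ^ z))
        (ℕₚ.≤-antisym (ℕₚ.≮⇒≥ a≮b) (ℕₚ.≮⇒≥ b≮a)) (Tr-sym (*-comm _ _)))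

EvP-T : ∀ {n} {f : Poly n} {F} k → suc k < n → EvP f F →
  Σ Fun λ G → EvP (T (suc k) f) G × (∀ A N → n ≤ N → Points.IsT A N k (F A N) (G A N))
EvP-T k k<n (nil z) = 0F , nil (λ A N x → Points.≋-refl A) , λ A N _ x x' _ _ →
  let open Points A in Tr-resp (≋-sym (z A N x)) (≋-sym (z A N x')) ≋-refl Tr-0
EvP-T k k<n (cons {c = c} {r} {u = η , ks} v h z) =
  let G , hG , tG = HasT-term η ks k k<n v
      H , hH , tH = EvP-T k k<n h
  in G +F H , Ev-++ hG hH , λ A N n≤N x x' reg s → let open Points A in
    Tr-resp (≋-sym (z A N x)) (≋-sym (z A N x')) ≋-refl (Tr-+ (tG A N n≤N x x' reg s) (tH A N n≤N x x' reg s))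

EvP-mulx : ∀ {s} {f : Poly s} {F} → EvP f F → EvP (mulx f) (λ A N x → let open Points A in x s * F A N x)
EvP-mulx (nil z) = nil (λ A N x → let open Points A in ≋-trans (*-congˡ (z A N x)) (zeroʳ _))
EvP-mulx {s} (cons {c = c} {r} {η , ks} {F = F'} {G} v h z) =
  Ev-resp (λ A N x → let open Points A in
    ≋-trans (+-congʳ (≋-trans (≋-trans (∑L-cong (splits ks) (λ { (w , m , rest) →
        ≋-trans (*-congˡ (*-congʳ (≋-trans (vmono-∷ʳ x η (suc w)) (*-congˡ (*-congˡ (≋-sym (*-identityˡ _)))))))
        -- A factor 1^m is inserted, since adding the variable `x s` back to the tail is the case e
        -- = 1 of `splits-expand`.
        (≋-trans (*-congˡ (*-congʳ (*-congˡ (*-congˡ (*-congʳ (≋-sym (1^ m)))))))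
        (solve 6 (λ r e X o z' p → r :* ((e :* (X :* (o :* z'))) :* p) := (r :* e :* X) :* (o :* (z' :* p))) ≋-refl
          (ι r) (vmono x η) (x s) (1# ^ m) (x s ^ w) (pmono (suc s) N x rest))) }))
      (∑L-*ˡ (splits ks) (ι r * vmono x η * x s) _))
      (*-congˡ (≋-trans (splits-expand 1# (x s) (λ j → psum (suc s) N (suc j) x) ks)
        (prodL-cong (λ j → ≋-trans (+-congʳ (+-congˡ (-‿cong (∑-last s (λ i → x i ^ suc j)))))
          (solve 3 (λ p q r → (p :- (q :+ r)) :+ :1 :* r := p :- q) ≋-refl _ _ _)) ks)))))
    (≋-trans (solve 5 (λ r e X p q → (r :* e :* X) :* p :+ X :* q := X :* (r :* (e :* p) :+ q)) ≋-refl
        (ι r) (vmono x η) (x s) (pmono s N x ks) (F' A N x))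
      (*-congˡ (≋-sym (z A N x)))))
  (Ev-++ (Ev-map {G = λ u A N x → let open Points A in ι r * mono N x (η V.∷ʳ suc (proj₁ u)) (proj₂ (proj₂ u))}
     (λ { (w , m , rest) → Ev-single v }) (splits ks)) (EvP-mulx h))

-- Logarithmic derivatives and the plethystic exponential.

module RingLemmas (B : Ring) where
  open Kit B

  -- By the Leibniz rule the left side is θ(q c) when θ q = b q and θ c = u c: logarithmic
  -- derivatives add.
  logDeriv-* : ∀ b q c u → (b * q) * c + q * (u * c) ≋ (b + u) * (q * c)
  logDeriv-* = solve 4 (λ b q c u → (b :* q) :* c :+ q :* (u :* c) := (b :+ u) :* (q :* c)) ≋-refl

module Plethysm (A : Alg) where
  open Points A
  open Series (base A)
  private
    module S = Kit seriesRing

  ⊛-*ʳ : ∀ a f g → f ⊛ (λ m → a * g m) ≗ (λ m → a * (f ⊛ g) m)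
  ⊛-*ʳ a f g m = ≋-trans (⊛-comm f _ m) (≋-trans (⊛-*ˡ a g f m) (*-congˡ (⊛-comm g f m)))

  ⊛-0ʳ : ∀ f {g} m → (∀ i → i ≤ m → g i ≋ 0#) → (f ⊛ g) m ≋ 0#
  ⊛-0ʳ f {g} m e = ≋-trans (⊛-congˡ≤ m (λ _ _ → ≋-refl) e) (≋-trans (⊛-comm f _ m) (⊛-0ˡ f (λ _ → ≋-refl) m))

  ⊛-∑ʳ : ∀ n f (g : ℕ → ℕ → Carrier) → f ⊛ (λ m → ∑ n (λ i → g i m)) ≗ (λ m → ∑ n (λ i → (f ⊛ g i) m))
  ⊛-∑ʳ zero f g m = ⊛-0ʳ f m (λ _ _ → ≋-refl)
  ⊛-∑ʳ (suc n) f g m = ≋-trans (⊛-distribˡ f (g 0) _ m) (+-congˡ (⊛-∑ʳ n f (λ i → g (suc i)) m))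

  powS : (ℕ → Carrier) → ℕ → ℕ → Carrier
  powS a zero = const 1#
  powS a (suc i) = a ⊛ powS a i

  powS-vanish : ∀ {a} → a 0 ≋ 0# → ∀ i m → m < i → powS a i m ≋ 0#
  powS-vanish a0 (suc i) zero _ = ≋-trans (*-congʳ a0) (zeroˡ _)
  powS-vanish {a} a0 (suc i) (suc m) (s≤s m<i) = ≋-trans (+-cong (≋-trans (*-congʳ a0) (zeroˡ _))
    (⊛-0ʳ _ m (λ j j≤m → powS-vanish a0 i j (ℕₚ.≤-<-trans j≤m m<i)))) (+-identityˡ _)

  θ-powS : ∀ a i → θ (powS a (suc i)) ≗ (λ m → nat (suc i) * (θ a ⊛ powS a i) m)
  θ-powS a i m = begin
    θ (a ⊛ powS a i) m                                    ≈⟨ θ-⊛ a (powS a i) m ⟩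
    (θ a ⊛ powS a i) m + (a ⊛ θ (powS a i)) m             ≈⟨ +-congˡ (lem i m) ⟩
    (θ a ⊛ powS a i) m + nat i * (θ a ⊛ powS a i) m       ≈⟨ solve 2 (λ n z → z :+ n :* z := (:1 :+ n) :* z) ≋-refl (nat i) _ ⟩
    (1# + nat i) * (θ a ⊛ powS a i) m                     ≈⟨ *-congʳ (nat-suc i) ⟨
    nat (suc i) * (θ a ⊛ powS a i) m ∎
    where
    open ≋-R
    θ-1 : ∀ m → θ (const 1#) m ≋ 0#
    θ-1 zero = zeroˡ _
    θ-1 (suc m) = zeroʳ _
    lem : ∀ i m → (a ⊛ θ (powS a i)) m ≋ nat i * (θ a ⊛ powS a i) m
    lem zero m = ≋-trans (⊛-0ʳ a m (λ j _ → θ-1 j)) (≋-sym (zeroˡ _))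
    lem (suc i) m = begin
      (a ⊛ θ (powS a (suc i))) m                              ≈⟨ ⊛-cong (λ _ → ≋-refl) (θ-powS a i) m ⟩
      (a ⊛ (λ m → nat (suc i) * (θ a ⊛ powS a i) m)) m        ≈⟨ ⊛-*ʳ _ a _ m ⟩
      nat (suc i) * (a ⊛ (θ a ⊛ powS a i)) m                  ≈⟨ *-congˡ (≋-trans (≋-sym (⊛-assoc a (θ a) (powS a i) m))
          (≋-trans (⊛-cong (⊛-comm a (θ a)) (λ _ → ≋-refl) m) (⊛-assoc (θ a) a (powS a i) m))) ⟩
      nat (suc i) * (θ a ⊛ powS a (suc i)) m ∎

  1/! : ℕ → Carrier
  1/! i = ι (1/!S i)

  nat*1/! : ∀ i → 1/! (suc i) * nat (suc i) ≋ 1/! i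
  nat*1/! i = begin
    ι (1/S i R.* 1/!S i) * nat (suc i)   ≈⟨ *-congʳ (ι-* (1/S i) (1/!S i)) ⟩
    (ι (1/S i) * 1/! i) * nat (suc i)    ≈⟨ solve 3 (λ a b c → (a :* b) :* c := (c :* a) :* b) ≋-refl _ _ _ ⟩
    (nat (suc i) * ι (1/S i)) * 1/! i    ≈⟨ *-congʳ (ι-1/S i) ⟩
    1# * 1/! i                           ≈⟨ *-identityˡ _ ⟩
    1/! i ∎ where open ≋-R

  -- The truncation level is kept apart from the coefficient index because differentiation lowers
  -- the level by one, as in `θ-expS≤`.
  expS≤ : (ℕ → Carrier) → ℕ → ℕ → Carrier
  expS≤ a L m = ∑ (suc L) (λ i → 1/! i * powS a i m)

  -- exp a, for a without constant term: only the powers aⁱ with i ≤ m reach the coefficient m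
  expS : (ℕ → Carrier) → ℕ → Carrier
  expS a m = expS≤ a m m

  expS≤-step : ∀ {a} → a 0 ≋ 0# → ∀ L m → m ≤ L → expS≤ a (suc L) m ≋ expS≤ a L m
  expS≤-step {a} a0 L m m≤L = ≋-trans (∑-last (suc L) (λ i → 1/! i * powS a i m))
    (≋-trans (+-congˡ (≋-trans (*-congˡ (powS-vanish a0 (suc L) m (s≤s m≤L))) (zeroʳ _))) (+-identityʳ _))

  expS≤-expS : ∀ {a} → a 0 ≋ 0# → ∀ d m → expS≤ a (d ℕ.+ m) m ≋ expS a m
  expS≤-expS a0 zero m = ≋-refl
  expS≤-expS a0 (suc d) m = ≋-trans (expS≤-step a0 (d ℕ.+ m) m (ℕₚ.m≤n+m m d)) (expS≤-expS a0 d m)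

  θ-expS≤ : ∀ a L m → θ (expS≤ a (suc L)) m ≋ (θ a ⊛ expS≤ a L) m
  θ-expS≤ a L m = begin
    nat m * (1/! 0 * const 1# m + ∑ (suc L) (λ i → 1/! (suc i) * powS a (suc i) m))
      ≈⟨ distribˡ _ _ _ ⟩
    nat m * (1/! 0 * const 1# m) + nat m * ∑ (suc L) (λ i → 1/! (suc i) * powS a (suc i) m)
      ≈⟨ +-cong (kill m) (≋-sym (∑-*ˡ (suc L) (nat m) (λ i → 1/! (suc i) * powS a (suc i) m))) ⟩
    0# + ∑ (suc L) (λ i → nat m * (1/! (suc i) * powS a (suc i) m))
      ≈⟨ +-identityˡ _ ⟩
    ∑ (suc L) (λ i → nat m * (1/! (suc i) * powS a (suc i) m))
      ≈⟨ ∑-cong (suc L) (λ i _ → step i) ⟩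
    ∑ (suc L) (λ i → (θ a ⊛ (λ m → 1/! i * powS a i m)) m)
      ≈⟨ ⊛-∑ʳ (suc L) (θ a) (λ i m → 1/! i * powS a i m) m ⟨
    (θ a ⊛ expS≤ a L) m ∎
    where
    open ≋-R
    kill : ∀ m → nat m * (1/! 0 * const 1# m) ≋ 0#
    kill zero = zeroˡ _
    kill (suc m) = ≋-trans (*-congˡ (zeroʳ _)) (zeroʳ _)
    step : ∀ i → nat m * (1/! (suc i) * powS a (suc i) m) ≋ (θ a ⊛ (λ m → 1/! i * powS a i m)) m
    step i = begin
      nat m * (1/! (suc i) * powS a (suc i) m)              ≈⟨ solve 3 (λ a b c → a :* (b :* c) := b :* (a :* c)) ≋-refl _ _ _ ⟩
      1/! (suc i) * θ (powS a (suc i)) m                    ≈⟨ *-congˡ (θ-powS a i m) ⟩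
      1/! (suc i) * (nat (suc i) * (θ a ⊛ powS a i) m)      ≈⟨ *-assoc _ _ _ ⟨
      (1/! (suc i) * nat (suc i)) * (θ a ⊛ powS a i) m      ≈⟨ *-congʳ (nat*1/! i) ⟩
      1/! i * (θ a ⊛ powS a i) m                            ≈⟨ ⊛-*ʳ (1/! i) (θ a) (powS a i) m ⟨
      (θ a ⊛ (λ m → 1/! i * powS a i m)) m ∎

  expS-0 : ∀ a → expS a 0 ≋ 1#
  expS-0 a = ≋-trans (+-identityʳ _) (≋-trans (*-identityʳ _) ι-1)

  θ-expS : ∀ {a} → a 0 ≋ 0# → θ (expS a) ≗ θ a ⊛ expS a
  θ-expS {a} a0 zero = solve 2 (λ x y → con (0 , 0) :* x := (con (0 , 0) :* y) :* x) ≋-refl _ _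
  -- Since `θ a` has no constant term, coefficient m + 1 of the product uses only coefficients j ≤ m
  -- of the exponential, and these are already exact at truncation level m.
  θ-expS {a} a0 (suc m) = ≋-trans (θ-expS≤ a m (suc m)) (+-cong
    (≋-trans (*-congʳ (zeroˡ _)) (≋-trans (zeroˡ _) (≋-sym (≋-trans (*-congʳ (zeroˡ _)) (zeroˡ _)))))
    (⊛-congˡ≤ m (λ _ _ → ≋-refl) (λ j j≤m → ≋-trans
      (≋-reflexive (cong (λ z → expS≤ a z j) (sym (ℕₚ.m∸n+n≡m j≤m)))) (expS≤-expS a0 (m ℕ.∸ j) j))))

  -- As b has no constant term, θ f = b f is a recursion expressing m · f m through earlier
  -- coefficients; m is regular for m > 0, so the constant term determines the solution.
  θ-unique : ∀ {b f g} → b 0 ≋ 0# → f 0 ≋ g 0 → θ f ≗ b ⊛ f → θ g ≗ b ⊛ g → f ≗ g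
  θ-unique {b} {f} {g} b0 f0 hf hg m = go m m ℕₚ.≤-refl
    where
    go : ∀ M m → m ≤ M → f m ≋ g m
    go M zero _ = f0
    go (suc M) (suc m) (s≤s m≤M) = Regular-cancel (nat-regular m) (≋-trans (hf (suc m))
      (≋-trans (+-cong (≋-trans (*-congʳ b0) (≋-trans (zeroˡ _) (≋-sym (≋-trans (*-congʳ b0) (zeroˡ _)))))
        (⊛-congˡ≤ m (λ _ _ → ≋-refl) (λ j j≤m → go M j (ℕₚ.≤-trans j≤m m≤M)))) (≋-sym (hg (suc m)))))

  geom : Carrier → ℕ → Carrier
  geom y m = y ^ m

  -- (1 − t w y)/(1 − w y) as a power series in w
  cser : Carrier → ℕ → Carrier
  cser y zero = 1#
  cser y (suc m) = (1# - t) * y ^ suc m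

  -- The logarithmic derivative of `cser y`, namely w y/(1 - w y) - t w y/(1 - t w y).
  user : Carrier → ℕ → Carrier
  user y m = (1# - t ^ m) * y ^ m

  private
    -- What is left of the convolution in `θ-cser` once the common power of y is taken out.
    ∑-1-t^ : ∀ M → ∑ M (λ j → (1# - t ^ j) * (1# - t)) ≋ nat M * (1# - t) - (1# - t ^ M)
    ∑-1-t^ zero = solve 1 (λ t → con (0 , 0) := con (0 , 0) :* (:1 :- t) :- (:1 :- :1)) ≋-refl t
    ∑-1-t^ (suc M) = ≋-trans (∑-last M _) (≋-trans (+-congʳ (∑-1-t^ M))
      (≋-trans (solve 3 (λ n t z → (n :* (:1 :- t) :- (:1 :- z)) :+ (:1 :- z) :* (:1 :- t) := (:1 :+ n) :* (:1 :- t) :- (:1 :- t :* z)) ≋-refl (nat M) t (t ^ M))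
        (+-congʳ (*-congʳ (≋-sym (nat-suc M))))))

  θ-cser : ∀ y → θ (cser y) ≗ user y ⊛ cser y
  θ-cser y zero = solve 0 (con (0 , 0) :* :1 := ((:1 :- :1) :* :1) :* :1) ≋-refl
  θ-cser y (suc m) = ≋-sym (begin
    (user y ⊛ cser y) (suc m)
      ≈⟨ ⊛-suc (user y) (cser y) m ⟩
    (user y ⊛ (λ i → cser y (suc i))) m + user y (suc m) * 1#
      ≈⟨ +-cong (⊛-∑ (user y) _ m) (*-identityʳ _) ⟩
    ∑ (suc m) (λ j → user y j * ((1# - t) * y ^ suc (m ℕ.∸ j))) + user y (suc m)
      ≈⟨ +-congʳ (∑-cong (suc m) (λ { j (s≤s j≤m) → ≋-trans
           (solve 4 (λ a b c d → (a :* b) :* (c :* d) := (b :* d) :* (a :* c)) ≋-refl (1# - t ^ j) (y ^ j) (1# - t) (y ^ suc (m ℕ.∸ j)))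
           (*-congʳ (≋-trans (≋-sym (^-+ y j (suc (m ℕ.∸ j)))) (≋-reflexive (cong (y ^_)
             (trans (ℕₚ.+-suc j _) (cong suc (ℕₚ.m+[n∸m]≡n j≤m))))))) })) ⟩
    ∑ (suc m) (λ j → y ^ suc m * ((1# - t ^ j) * (1# - t))) + user y (suc m)
      ≈⟨ +-congʳ (≋-trans (∑-*ˡ (suc m) (y ^ suc m) (λ j → (1# - t ^ j) * (1# - t))) (*-congˡ (∑-1-t^ (suc m)))) ⟩
    y ^ suc m * (nat (suc m) * (1# - t) - (1# - t ^ suc m)) + (1# - t ^ suc m) * y ^ suc m
      ≈⟨ solve 4 (λ Y n t z → Y :* (n :* (:1 :- t) :- (:1 :- z)) :+ (:1 :- z) :* Y := n :* ((:1 :- t) :* Y)) ≋-refl _ _ _ _ ⟩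
    nat (suc m) * ((1# - t) * y ^ suc m) ∎)
    where open ≋-R

  -- Ω[(1−t) w (x_s + … + x_{s+n-1})] as a power series in w
  Q : ℕ → ℕ → Pt → ℕ → Carrier
  Q s zero x = const 1#
  Q s (suc n) x = Q s n x ⊛ cser (x (s ℕ.+ n))

  Q-0 : ∀ s n x → Q s n x 0 ≋ 1#
  Q-0 s zero x = ≋-refl
  Q-0 s (suc n) x = ≋-trans (*-congʳ (Q-0 s n x)) (*-identityˡ _)

  powerSums : ℕ → ℕ → Pt → ℕ → Carrier
  powerSums s n x m = (1# - t ^ m) * ∑ n (λ i → x (s ℕ.+ i) ^ m)

  θ-Q : ∀ s n x → θ (Q s n x) ≗ powerSums s n x ⊛ Q s n x
  θ-Q s zero x m = ≋-trans (θ-1 m) (≋-sym (⊛-0ˡ (const 1#) (λ _ → zeroʳ _) m))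
    where
    θ-1 : ∀ m → θ (const 1#) m ≋ 0#
    θ-1 zero = zeroˡ _
    θ-1 (suc m) = zeroʳ _
  θ-Q s (suc n) x m = begin
    θ (Q s n x ⊛ c) m
      ≈⟨ θ-⊛ (Q s n x) c m ⟩
    (θ (Q s n x) ⊛ c) m + (Q s n x ⊛ θ c) m
      ≈⟨ +-cong (⊛-cong (θ-Q s n x) (λ _ → ≋-refl) m) (⊛-cong (λ _ → ≋-refl) (θ-cser y) m) ⟩
    ((powerSums s n x ⊛ Q s n x) ⊛ c) m + (Q s n x ⊛ (user y ⊛ c)) m
      ≈⟨ RingLemmas.logDeriv-* seriesRing (powerSums s n x) (Q s n x) c (user y) m ⟩
    ((λ i → powerSums s n x i + user y i) ⊛ (Q s n x ⊛ c)) m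
      ≈⟨ ⊛-cong (λ i → ≋-trans (≋-sym (distribˡ _ _ _)) (*-congˡ (≋-sym (∑-last n (λ j → x (s ℕ.+ j) ^ i))))) (λ _ → ≋-refl) m ⟩
    (powerSums s (suc n) x ⊛ (Q s n x ⊛ c)) m ∎
    where
    open ≋-R
    y = x (s ℕ.+ n)
    c = cser y

  psum-∑ : ∀ s n k x → psum s (s ℕ.+ n) k x ≋ ∑ n (λ i → x (s ℕ.+ i) ^ k)
  psum-∑ s zero k x = ≋-trans (+-congʳ (≋-reflexive (cong (λ z → P z k x) (ℕₚ.+-identityʳ s)))) (-‿inverseʳ _)
  psum-∑ s (suc n) k x = begin
    P (s ℕ.+ suc n) k x - P s k x          ≡⟨ cong (λ z → P z k x - P s k x) (ℕₚ.+-suc s n) ⟩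
    P (suc (s ℕ.+ n)) k x - P s k x        ≈⟨ +-congʳ (∑-last (s ℕ.+ n) (λ i → x i ^ k)) ⟩
    (P (s ℕ.+ n) k x + y) - P s k x        ≈⟨ solve 3 (λ a b c → (a :+ b) :- c := (a :- c) :+ b) ≋-refl _ _ _ ⟩
    psum s (s ℕ.+ n) k x + y               ≈⟨ +-congʳ (psum-∑ s n k x) ⟩
    ∑ n (λ i → x (s ℕ.+ i) ^ k) + y        ≈⟨ ∑-last n (λ i → x (s ℕ.+ i) ^ k) ⟨
    ∑ (suc n) (λ i → x (s ℕ.+ i) ^ k) ∎
    where
    open ≋-R
    y = x (s ℕ.+ n) ^ k

  -- The trailing `* 1#` is the empty remainder of the product over the index list `k ∷ []`; with
  -- it, `Aser` agrees by computation with the value of `Acoeff`.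
  Aser : ℕ → ℕ → Pt → ℕ → Carrier
  Aser s N x zero = 0#
  Aser s N x (suc k) = ι ((R.1# R.- tS R.^ suc k) R.* 1/S k) * (psum s N (suc k) x * 1#)

  θ-Aser : ∀ s n x → θ (Aser s (s ℕ.+ n) x) ≗ powerSums s n x
  θ-Aser s n x zero = ≋-trans (zeroʳ _) (≋-sym (≋-trans (*-congʳ (-‿inverseʳ _)) (zeroˡ _)))
  θ-Aser s n x (suc k) = begin
    nat (suc k) * (ι ((R.1# R.- tS R.^ suc k) R.* 1/S k) * (psum s (s ℕ.+ n) (suc k) x * 1#))
      ≈⟨ *-congˡ (*-cong (ι-* (R.1# R.- tS R.^ suc k) (1/S k)) (≋-trans (*-identityʳ _) (psum-∑ s n (suc k) x))) ⟩
    nat (suc k) * ((ι (R.1# R.- tS R.^ suc k) * ι (1/S k)) * p)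
      ≈⟨ solve 4 (λ n a b p → n :* ((a :* b) :* p) := (n :* b) :* (a :* p)) ≋-refl _ _ _ p ⟩
    (nat (suc k) * ι (1/S k)) * (ι (R.1# R.- tS R.^ suc k) * p)
      ≈⟨ *-cong (ι-1/S k) (*-congʳ (≋-trans (ι-+ R.1# (R.- tS R.^ suc k)) (+-cong ι-1 (≋-trans (ι-neg (tS R.^ suc k)) (-‿cong (ι-^ tS (suc k))))))) ⟩
    1# * ((1# - t ^ suc k) * p)
      ≈⟨ *-identityˡ _ ⟩
    (1# - t ^ suc k) * p ∎
    where
    open ≋-R
    p = ∑ n (λ i → x (s ℕ.+ i) ^ suc k)

  expS-Q : ∀ s n x → expS (Aser s (s ℕ.+ n) x) ≗ Q s n x
  expS-Q s n x = θ-unique {powerSums s n x} (≋-trans (*-congʳ (-‿inverseʳ _)) (zeroˡ _))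
    (≋-trans (expS-0 (Aser s (s ℕ.+ n) x)) (≋-sym (Q-0 s n x)))
    (λ m → ≋-trans (θ-expS ≋-refl m) (⊛-cong (θ-Aser s n x) (λ _ → ≋-refl) m)) (θ-Q s n x)

  Q-Sw : ∀ {k x x'} s n → s ℕ.+ n ≤ k → Sw k x x' → Q s n x' ≗ Q s n x
  Q-Sw s zero p w = λ _ → ≋-refl
  Q-Sw {k} {x} {x'} s (suc n) p w = ⊛-cong (Q-Sw s n (ℕₚ.<⇒≤ q) w) cser-x
    where
    q : s ℕ.+ n < k
    q = ℕₚ.≤-trans (ℕₚ.≤-reflexive (sym (ℕₚ.+-suc s n))) p
    e : x' (s ℕ.+ n) ≋ x (s ℕ.+ n)
    e = Sw-other w (s ℕ.+ n) (ℕₚ.<⇒≢ q) (ℕₚ.<⇒≢ (ℕₚ.m≤n⇒m≤1+n q))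
    cser-x : cser (x' (s ℕ.+ n)) ≗ cser (x (s ℕ.+ n))
    cser-x zero = ≋-refl
    cser-x (suc m) = *-congˡ (^-cong (suc m) e)

  -- T_{s+n-1} ⋯ T_s x_s^e
  H : ℕ → ℕ → ℕ → Pt → Carrier
  H s n e x = (Q s n x ⊛ geom (x (s ℕ.+ n))) e

  -- As generating functions in w: T sends 1/(1 - w X) to (1 - t w X)/((1 - w X)(1 - w Y)). Each
  -- operator of a chain thus contributes one factor of `Q` and moves the geometric series to the
  -- next variable.
  Tr-geom : ∀ X Y m → Tr X Y (geom X m) (geom Y m) ((cser X ⊛ geom Y) m)
  Tr-geom X Y m = Tr-resp (*-identityʳ _) (*-identityʳ _)
    (≋-sym (≋-trans (⊛-∑ (cser X) (geom Y) m) (+-congˡ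
      (≋-trans (∑-cong m (λ j _ → *-assoc _ _ _)) (∑-*ˡ m (1# - t) _)))))
    (Tr-mono> X Y 0 m)

  Tr-⊛ : ∀ {X Y q q'} {f f' g : ℕ → Carrier} → q' ≗ q → (∀ m → Tr X Y (f m) (f' m) (g m)) →
    ∀ e → Tr X Y ((q ⊛ f) e) ((q' ⊛ f') e) ((q ⊛ g) e)
  Tr-⊛ {q = q} {q'} {f} {f'} {g} eq h e = Tr-resp (≋-sym (⊛-∑ q f e))
    (≋-sym (≋-trans (⊛-∑ q' f' e) (∑-cong (suc e) (λ j _ → *-congʳ {f' (e ℕ.∸ j)} (eq j))))) (≋-sym (⊛-∑ q g e))
    (Tr-∑ (suc e) {λ j → q j * f (e ℕ.∸ j)} {λ j → q j * f' (e ℕ.∸ j)} {λ j → q j * g (e ℕ.∸ j)} (λ j _ → Tr-* (q j) (h (e ℕ.∸ j))))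

  Tr-H : ∀ {x x'} s n e → Sw (s ℕ.+ n) x x' → Tr (x (s ℕ.+ n)) (x (suc (s ℕ.+ n))) (H s n e x) (H s n e x') (H s (suc n) e x)
  Tr-H {x} {x'} s n e w = Tr-resp ≋-refl ≋-refl
    (≋-trans (≋-sym (⊛-assoc (Q s n x) (cser X) (geom Y) e))
      (⊛-cong (λ _ → ≋-refl) (λ m → ≋-reflexive (cong (λ z → x z ^ m) (sym (ℕₚ.+-suc s n)))) e))
    (Tr-⊛ (Q-Sw s n ℕₚ.≤-refl w) (λ m → Tr-resp ≋-refl (^-cong m (≋-sym (Sw-k w))) ≋-refl (Tr-geom X Y m)) e)
    where
    X = x (s ℕ.+ n)
    Y = x (suc (s ℕ.+ n))

-- Chains of T's applied to a single term, and the fresh variable.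

module TermSums (A : Alg) where
  open Points A
  open Plethysm A
  open Series (base A) using (_⊛_; const; const-⊛; ⊛-cong; ⊛-comm)

  dterm : ℕ → ℕ → PIdx → ℕ → Pt → Carrier
  dterm s N ks e x = ∑L (splits ks) (λ u →
    (- 1#) ^ proj₁ (proj₂ u) * (pmono s N x (proj₂ (proj₂ u)) * Q s (N ℕ.∸ s) x (e ℕ.+ proj₁ u)))

  hterm : ℕ → ℕ → ℕ → PIdx → ℕ → Pt → Carrier
  hterm s N n ks e x = ∑L (splits ks) (λ u →
    (- 1#) ^ proj₁ (proj₂ u) * (pmono s N x (proj₂ (proj₂ u)) * H s n (e ℕ.+ proj₁ u) x))

  H-start : ∀ s e x → H s 0 e x ≋ x s ^ e
  H-start s e x = ≋-trans (const-⊛ 1# (geom (x (s ℕ.+ 0))) e)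
    (≋-trans (*-identityˡ _) (≋-reflexive (cong (λ z → x z ^ e) (ℕₚ.+-identityʳ s))))

  -- This is where p_λ[Z - u] comes from: the tail beyond `x s` has power sums p_k[Z] - x_s^k, and
  -- p_k[Z] is symmetric in all variables moved by the chain. The powers of `x s` split off in this
  -- way join the exponent e, and only they are transformed.
  hterm-start : ∀ s N ks e x → hterm s N 0 ks e x ≋ x s ^ e * pmono (suc s) N x ks
  hterm-start s N ks e x = begin
    hterm s N 0 ks e x
      ≈⟨ ∑L-cong (splits ks) (λ { (w , m , rest) →
          ≋-trans (*-congˡ (*-congˡ (≋-trans (H-start s (e ℕ.+ w) x) (^-+ (x s) e w))))
            (solve 4 (λ a b c d → a :* (b :* (c :* d)) := c :* (a :* (d :* b))) ≋-refl ((- 1#) ^ m) (pmono s N x rest) (x s ^ e) (x s ^ w)) }) ⟩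
    ∑L (splits ks) (λ u → x s ^ e * ((- 1#) ^ proj₁ (proj₂ u) * (x s ^ proj₁ u * pmono s N x (proj₂ (proj₂ u)))))
      ≈⟨ ∑L-*ˡ (splits ks) (x s ^ e) _ ⟩
    x s ^ e * ∑L (splits ks) (λ u → (- 1#) ^ proj₁ (proj₂ u) * (x s ^ proj₁ u * pmono s N x (proj₂ (proj₂ u))))
      ≈⟨ *-congˡ (splits-expand (- 1#) (x s) (λ k → psum s N (suc k) x) ks) ⟩
    x s ^ e * prodL (λ k → psum s N (suc k) x + - 1# * x s ^ suc k) ks
      ≈⟨ *-congˡ (prodL-cong (λ k → ≋-trans
           (solve 3 (λ p q r → (p :- q) :+ (:- :1) :* r := p :- (q :+ r)) ≋-refl _ _ _)
           (+-congˡ (-‿cong (≋-sym (∑-last s (λ i → x i ^ suc k)))))) ks) ⟩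
    x s ^ e * pmono (suc s) N x ks ∎
    where open ≋-R

  Tr-∑L : ∀ {X : Set} {a b} (L : List X) {f f' g : X → Carrier} → (∀ u → Tr a b (f u) (f' u) (g u)) →
    Tr a b (∑L L f) (∑L L f') (∑L L g)
  Tr-∑L [] h = Tr-0
  Tr-∑L (u ∷ L) h = Tr-+ (h u) (Tr-∑L L h)

  hterm-step : ∀ s N n ks e x x' → suc (s ℕ.+ n) < N → Sw (s ℕ.+ n) x x' →
    Tr (x (s ℕ.+ n)) (x (suc (s ℕ.+ n))) (hterm s N n ks e x) (hterm s N n ks e x') (hterm s N (suc n) ks e x)
  hterm-step s N n ks e x x' p w = Tr-∑L (splits ks) (λ u →
    Tr-resp ≋-refl (*-congˡ (*-congʳ (prodL-cong (λ k → +-cong (≋-sym (P-Sw N (suc k) p w))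
        (-‿cong (≋-sym (P-Sw≥ s (suc k) (ℕₚ.m≤m+n s n) w)))) (proj₂ (proj₂ u))))) ≋-refl
      (Tr-* _ (Tr-* _ (Tr-H s n (e ℕ.+ proj₁ u) w))))

  -- Only the constant term of the geometric series in `x (s + n)` survives, so the convolution
  -- collapses to a coefficient of `Q`.
  H-zero : ∀ s n e x → x (s ℕ.+ n) ≋ 0# → H s n e x ≋ Q s n x e
  H-zero s n e x z = ≋-trans (⊛-cong {g' = const 1#} (λ _ → ≋-refl) geom-0 e)
    (≋-trans (⊛-comm (Q s n x) (const 1#) e) (≋-trans (const-⊛ 1# _ e) (*-identityˡ _)))
    where
    geom-0 : ∀ m → geom (x (s ℕ.+ n)) m ≋ const 1# m
    geom-0 zero = ≋-refl
    geom-0 (suc m) = ≋-trans (*-congʳ z) (zeroˡ _)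

  P-cong : ∀ n k {x y} → (∀ i → i < n → x i ≋ y i) → P n k x ≋ P n k y
  P-cong n k e = ∑-cong n (λ i i<n → ^-cong k (e i i<n))

  cser-cong : ∀ {a b} → a ≋ b → ∀ m → cser a m ≋ cser b m
  cser-cong e zero = ≋-refl
  cser-cong e (suc m) = *-congˡ (^-cong (suc m) e)

  Q-cong : ∀ s n {x y} → (∀ i → i < s ℕ.+ n → x i ≋ y i) → ∀ m → Q s n x m ≋ Q s n y m
  Q-cong s zero e m = ≋-refl
  Q-cong s (suc n) e = ⊛-cong (Q-cong s n (λ i i<n → e i (ℕₚ.<-trans i<n q))) (cser-cong (e (s ℕ.+ n) q))
    where
    q : s ℕ.+ n < s ℕ.+ suc n
    q = ℕₚ.≤-reflexive (sym (ℕₚ.+-suc s n))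

-- From A to A[[z]]: x₀,…,x_{N-1} stay, and x_N = z.
module Extend (A : Alg) where
  open Points A
  open Series (base A) using (const; var; const-regular; var-regular; const-var-regular)
  A⟦z⟧ : Alg
  A⟦z⟧ = PSAlg A
  private
    module A' = Points A⟦z⟧
    module Pl = Plethysm A
    module Pl' = Plethysm A⟦z⟧
    module S' = Series (base A⟦z⟧)
    module S = Series (base A)

  ext : Pt → ℕ → A'.Pt
  ext x zero _ = var
  ext x (suc N) zero = const (x 0)
  ext x (suc N) (suc i) = ext (λ j → x (suc j)) N i

  ext-< : ∀ x N i → i < N → ext x N i ≡ const (x i)
  ext-< x (suc N) zero _ = refl
  ext-< x (suc N) (suc i) (s≤s p) = ext-< (λ j → x (suc j)) N i p

  ext-N : ∀ x N → ext x N N ≡ var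
  ext-N x zero = refl
  ext-N x (suc N) = ext-N (λ j → x (suc j)) N

  private
    data Pos (N : ℕ) : ℕ → Set where
      below : ∀ {i} → i < N → Pos N i
      top : Pos N N

    pos : ∀ {N i} → i < suc N → Pos N i
    pos {N} {i} (s≤s p) with ℕₚ.m≤n⇒m<n∨m≡n p
    ... | inj₁ q = below q
    ... | inj₂ refl = top

    const-diff : ∀ a b → A'._≋_ (const (a - b)) (λ m → const a m - const b m)
    const-diff a b zero = ≋-refl
    const-diff a b (suc m) = ≋-sym (-‿inverseʳ _)

  ext-Reg : ∀ {N x} → Reg N x → A'.Reg (suc N) (ext x N)
  ext-Reg {N} {x} reg = record { var-reg = vr ; diff-reg = dr }
    where
    vr : ∀ i → i < suc N → A'.Regular (ext x N i)
    vr i p with pos p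
    ... | below q = subst A'.Regular (sym (ext-< x N i q)) (const-regular (var-reg reg i q))
    ... | top = subst A'.Regular (sym (ext-N x N)) var-regular
    dr : ∀ i j → i < suc N → j < suc N → i ≢ j → A'.Regular (A'._-_ (ext x N i) (ext x N j))
    dr i j p q i≢j with pos p | pos q
    ... | top | top = ⊥-elim (i≢j refl)
    ... | below p' | top = subst₂ (λ f g → A'.Regular (A'._-_ f g)) (sym (ext-< x N i p')) (sym (ext-N x N))
      (const-var-regular (var-reg reg i p'))
    ... | top | below q' = subst₂ (λ f g → A'.Regular (A'._-_ f g)) (sym (ext-N x N)) (sym (ext-< x N j q'))
      (A'.Regular-neg {const (x j)} {var} (const-var-regular (var-reg reg j q')))
    ... | below p' | below q' = subst₂ (λ f g → A'.Regular (A'._-_ f g)) (sym (ext-< x N i p')) (sym (ext-< x N j q'))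
      (A'.Regular-resp {const (x i - x j)} (const-diff (x i) (x j)) (const-regular (diff-reg reg i j p' q' i≢j)))

  -- Taking the constant coefficient is setting z = 0. It respects sums and products by computation,
  -- which keeps the following transfer lemmas short.
  at0 : A'.Pt → Pt
  at0 y i = y i 0

  ext-at0-< : ∀ x N i → i < N → at0 (ext x N) i ≋ x i
  ext-at0-< x N i p = ≋-reflexive (cong (λ f → f 0) (ext-< x N i p))

  ext-at0-N : ∀ x N → at0 (ext x N) N ≋ 0#
  ext-at0-N x N = ≋-reflexive (cong (λ f → f 0) (ext-N x N))

  at0-^ : ∀ f n → (A'._^_ f n) 0 ≋ f 0 ^ n
  at0-^ f zero = ≋-refl
  at0-^ f (suc n) = *-congˡ (at0-^ f n)

  at0-∑ : ∀ n f → A'.∑ n f 0 ≋ ∑ n (λ i → f i 0)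
  at0-∑ zero f = ≋-refl
  at0-∑ (suc n) f = +-congˡ (at0-∑ n (λ i → f (suc i)))

  at0-∑L : {X : Set} (L : List X) (f : X → A'.Carrier) → A'.∑L L f 0 ≋ ∑L L (λ u → f u 0)
  at0-∑L [] f = ≋-refl
  at0-∑L (u ∷ L) f = +-congˡ (at0-∑L L f)

  at0-prodL : ∀ h ks → A'.prodL h ks 0 ≋ prodL (λ k → h k 0) ks
  at0-prodL h [] = ≋-refl
  at0-prodL h (k ∷ ks) = *-congˡ (at0-prodL h ks)

  at0-vmono : ∀ {n} y (η : Vec ℕ n) → A'.vmono y η 0 ≋ vmono (at0 y) η
  at0-vmono y V.[] = ≋-refl
  at0-vmono y (a V.∷ η) = *-cong (at0-^ (y 0) a) (at0-vmono (λ i → y (suc i)) η)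

  at0-P : ∀ n k y → A'.P n k y 0 ≋ P n k (at0 y)
  at0-P n k y = ≋-trans (at0-∑ n _) (∑-cong n (λ i _ → at0-^ (y i) k))

  at0-⊛ : ∀ f g e → (f S'.⊛ g) e 0 ≋ ((λ j → f j 0) S.⊛ (λ j → g j 0)) e
  at0-⊛ f g zero = ≋-refl
  at0-⊛ f g (suc e) = +-congˡ (at0-⊛ (λ i → f (suc i)) g e)

  at0-cser : ∀ y m → Pl'.cser y m 0 ≋ Pl.cser (y 0) m
  at0-cser y zero = ≋-refl
  at0-cser y (suc m) = *-congˡ (at0-^ y (suc m))

  at0-Q : ∀ s n y m → Pl'.Q s n y m 0 ≋ Pl.Q s n (at0 y) m
  at0-Q s zero y zero = ≋-refl
  at0-Q s zero y (suc m) = ≋-refl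
  at0-Q s (suc n) y m = ≋-trans (at0-⊛ (Pl'.Q s n y) (Pl'.cser (y (s ℕ.+ n))) m)
    (S.⊛-cong (at0-Q s n y) (at0-cser (y (s ℕ.+ n))) m)

  at0-H : ∀ s n e y → Pl'.H s n e y 0 ≋ Pl.H s n e (at0 y)
  at0-H s n e y = ≋-trans (at0-⊛ (Pl'.Q s n y) (Pl'.geom (y (s ℕ.+ n))) e)
    (S.⊛-cong (at0-Q s n y) (at0-^ (y (s ℕ.+ n))) e)

  at0-psum : ∀ s N k x → s ≤ N → A'.psum s (suc N) (suc k) (ext x N) 0 ≋ psum s N (suc k) x
  at0-psum s N k x s≤N = +-cong
    (≋-trans (at0-P (suc N) (suc k) (ext x N)) (≋-trans (∑-last N _)
      (≋-trans (+-cong (TermSums.P-cong A N (suc k) (λ i i<N → ext-at0-< x N i i<N))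
          (≋-trans (*-congʳ (ext-at0-N x N)) (zeroˡ _))) (+-identityʳ _))))
    (-‿cong (≋-trans (at0-P s (suc k) (ext x N))
      (TermSums.P-cong A s (suc k) (λ i i<s → ext-at0-< x N i (ℕₚ.<-≤-trans i<s s≤N)))))

  at0-neg1^ : ∀ m → (A'._^_ (A'.-_ A'.1#) m) 0 ≋ (- 1#) ^ m
  at0-neg1^ m = at0-^ (A'.-_ A'.1#) m

  -- A chain of N - s operators moves the geometric series from index s to index N, the place of z.
  -- At z = 0 it disappears by `H-zero`, and the power sums lose their last summand.
  hterm-end : ∀ s N ks e x → s ≤ N →
    TermSums.hterm A⟦z⟧ s (suc N) (N ℕ.∸ s) ks e (ext x N) 0 ≋ TermSums.dterm A s N ks e x
  hterm-end s N ks e x s≤N = ≋-trans (at0-∑L (splits ks) _) (∑L-cong (splits ks) (λ { (w , m , rest) →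
    *-cong (at0-neg1^ m) (*-cong
      (≋-trans (at0-prodL _ rest) (prodL-cong (λ k → at0-psum s N k x s≤N) rest))
      (≋-trans (at0-H s (N ℕ.∸ s) (e ℕ.+ w) (ext x N))
        (≋-trans (TermSums.H-zero A s (N ℕ.∸ s) (e ℕ.+ w) (at0 (ext x N))
            (≋-trans (≋-reflexive (cong (at0 (ext x N)) (ℕₚ.m+[n∸m]≡n s≤N))) (ext-at0-N x N)))
          (TermSums.Q-cong A s (N ℕ.∸ s) (λ i i<N → ext-at0-< x N i
            (ℕₚ.<-≤-trans i<N (ℕₚ.≤-reflexive (ℕₚ.m+[n∸m]≡n s≤N)))) (e ℕ.+ w))))) }))

-- Values of the operators on symmetric functions and of d₋.

tailμ : ℕ → PIdx → Fun
tailμ s ks A N x = Points.pmono A s N x ks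

EvL : ℕ → LExp → Fun → Set₁
EvL s = Ev (tailμ s)

Ev-upTo : {X : Set} {μ : X → Fun} {φ : ℕ → List (K × X)} {G : ℕ → Fun} → (∀ i → Ev μ (φ i) (G i)) →
  ∀ m → Ev μ (concatMap φ (upTo m)) (∑F m G)
Ev-upTo h m = Ev-resp (λ A N x → Points.∑L-applyUpTo A m (λ i → i) _) (Ev-concatMap h (upTo m))

EvL-scale : ∀ {s f F c r} → VAL c r → EvL s f F → EvL s (scaleL c f) (r ·F F)
EvL-scale v (nil z) = nil (λ A N x → let open Points A in ≋-trans (*-congˡ (z A N x)) (zeroʳ _))
EvL-scale {s} {c = c} {r} v (cons {c = c'} {r'} {u} {F = F} {G} v' h z) =
  cons (VAL-* {c} {c'} v v') (EvL-scale {s} v h) (scale-step {r} {r'} {tailμ s u} {F} {G} z)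

private
  mul-step : ∀ {s r r' u u'} {F H : Fun} → H ≐ (r' ·F tailμ s u') +F F →
    (r ·F tailμ s u) *F H ≐ ((r R.* r') ·F tailμ s (u ++ u')) +F ((r ·F tailμ s u) *F F)
  mul-step {s} {r} {r'} {u} {u'} z A N x = ≋-trans (*-congˡ (z A N x)) (≋-trans (distribˡ _ _ _) (+-congʳ
    (≋-trans (solve 4 (λ a b c d → (a :* b) :* (c :* d) := (a :* c) :* (b :* d)) ≋-refl (ι r) _ (ι r') _)
      (*-cong (≋-sym (ι-* r r')) (≋-sym (prodL-++ _ u u'))))))
    where open Points A

  distribʳF : ∀ (F G H : Fun) → (F *F H) +F (G *F H) ≐ (F +F G) *F H
  distribʳF F G H A N x = ≋-sym (distribʳ _ _ _)
    where open Points A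

EvL-mul-single : ∀ {s c r u g G} → VAL c r → EvL s g G → EvL s (mulL ((c , u) ∷ []) g) ((r ·F tailμ s u) *F G)
EvL-mul-single v (nil z) = nil (λ A N x → let open Points A in ≋-trans (*-congˡ (z A N x)) (zeroʳ _))
EvL-mul-single {s} {c} {r} {u} v (cons {c = c'} {r'} {u'} {F = F} {G} v' h z) =
  cons (VAL-* {c} {c'} v v') (EvL-mul-single {s} v h) (mul-step {s} {r} {r'} {u} {u'} {F} {G} z)

EvL-mul : ∀ {s f F g G} → EvL s f F → EvL s g G → EvL s (mulL f g) (F *F G)
EvL-mul (nil z) h = nil (λ A N x → let open Points A in ≋-trans (*-congʳ (z A N x)) (zeroˡ _))
EvL-mul {s} {(c , u) ∷ f} {g = g} {G} (cons {r = r} {F = F} v hf z) h = Ev-resp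
  (λ A N x → let open Points A in ≋-trans (distribʳF (r ·F tailμ s u) F G A N x) (*-congʳ (≋-sym (z A N x))))
  (subst (λ l → EvL s (l ++ mulL f g) _) (Lₚ.++-identityʳ _)
    (Ev-++ (EvL-mul-single {s} v h) (EvL-mul {s} hf h)))

AserF : ℕ → ℕ → Fun
AserF s k A N x = Plethysm.Aser A s N x k

EvL-Acoeff : ∀ s k → EvL s (Acoeff k) (AserF s k)
EvL-Acoeff s zero = nil (λ A N x → Points.≋-refl A)
EvL-Acoeff s (suc k) = Ev-single (VAL-* {1K +K (-K (tK ^K suc k))} {inv-suc k}
  (VAL-+ {1K} { -K (tK ^K suc k)} VAL-1 (VAL-neg {tK ^K suc k} (VAL-^ {tK} (suc k) VAL-t))) (VAL-inv-suc k))

powF : ℕ → ℕ → ℕ → Fun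
powF s i m A N x = Plethysm.powS A (Plethysm.Aser A s N x) i m

EvL-Apow : ∀ s i m → EvL s (Apow i m) (powF s i m)
EvL-Apow s zero zero = Ev-resp (λ A N x → let open Points A in ≋-trans (*-identityʳ _) ι-1) (Ev-single VAL-1)
EvL-Apow s zero (suc m) = nil (λ A N x → Points.≋-refl A)
EvL-Apow s (suc i) m = Ev-resp (λ A N x → Points.≋-sym A (Series.⊛-∑ (base A) (Plethysm.Aser A s N x) (λ j → powF s i j A N x) m))
  (Ev-upTo {G = λ j → AserF s j *F powF s i (m ℕ.∸ j)} (λ j → EvL-mul {s} (EvL-Acoeff s j) (EvL-Apow s i (m ℕ.∸ j))) (suc m))

expF : ℕ → ℕ → Fun
expF s m A N x = Plethysm.expS A (Plethysm.Aser A s N x) m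

EvL-Ω : ∀ s m → EvL s (Ωcoeff m) (expF s m)
EvL-Ω s m = Ev-upTo {G = λ i → 1/!S i ·F powF s i m} (λ i → EvL-scale {s} (VAL-inv-fact i) (EvL-Apow s i m)) (suc m)

neg1 : R.Carrier
neg1 = R.- R.1#

𝓑-termF : ℕ → ℕ → ℕ × ℕ × PIdx → Fun
𝓑-termF s n u = (neg1 R.^ proj₁ (proj₂ u)) ·F (((R.1# ·F tailμ s (proj₂ (proj₂ u))) *F expF s (n ℕ.+ proj₁ u)))

EvL-𝓑 : ∀ s n ks → EvL s (𝓑 n ks) (∑LF (splits ks) (𝓑-termF s n))
EvL-𝓑 s n ks = Ev-concatMap {G = 𝓑-termF s n} (λ { (w , m , rest) →
  EvL-scale {s} (VAL-^ { -K 1K} m (VAL-neg {1K} VAL-1)) (EvL-mul {s} (Ev-single VAL-1) (EvL-Ω s (n ℕ.+ w))) }) (splits ks)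

vmonoF : ∀ {s} → Vec ℕ s → Fun
vmonoF η A N x = Points.vmono A x η

private
  attach-step : ∀ {s r r'} {η : Vec ℕ s} {u} {F G : Fun} → G ≐ (r' ·F tailμ s u) +F F →
    r ·F (vmonoF η *F G) ≐ ((r R.* r') ·F polyμ (η , u)) +F (r ·F (vmonoF η *F F))
  attach-step {s} {r} {r'} {η} {u} {F} {G} z A N x = ≋-trans (*-congˡ (*-congˡ (z A N x)))
    (≋-trans (solve 5 (λ r e r' p q → r :* (e :* (r' :* p :+ q)) := (r :* r') :* (e :* p) :+ r :* (e :* q)) ≋-refl
      (ι r) (vmono x η) (ι r') (pmono s N x u) (F A N x)) (+-congʳ (*-congʳ (≋-sym (ι-* r r')))))
    where open Points A

-- The map inside `d₋` is an anonymous pattern-matching function, so `φ` stands for it and the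
-- equation supplies its values.
EvP-attach : ∀ {s c r f F} {η : Vec ℕ s} (φ : K × PIdx → K × Vec ℕ s × PIdx) →
  (∀ c' u → φ (c' , u) ≡ (c *K c' , η , u)) → VAL c r → EvL s f F → EvP (map φ f) (r ·F (vmonoF η *F F))
EvP-attach φ e v (nil z) = nil (λ A N x → let open Points A in
  ≋-trans (*-congˡ (≋-trans (*-congˡ (z A N x)) (zeroʳ _))) (zeroʳ _))
EvP-attach {s} {c} {r} {η = η} φ e v (cons {c = c'} {r'} {u} {f} {F} {G} v' h z) =
  subst (λ w → EvP (w ∷ map φ f) _) (sym (e c' u))
    (cons (VAL-* {c} {c'} v v') (EvP-attach {s} φ e v h) (attach-step {s} {r} {r'} {η} {u} {F} {G} z))

-- g = T_{s+len-1} ⋯ T_s f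
record Chain (A : Alg) (N s len : ℕ) (f g : Points.Pt A → Alg.Carrier A) : Set where
  open Points A
  field
    stage : ℕ → Pt → Carrier
    first : ∀ x → stage 0 x ≋ f x
    step : ∀ n → n < len → IsT N (s ℕ.+ n) (stage n) (stage (suc n))
    last : ∀ x → stage len x ≋ g x

-- The finite-variable description of d₋: lift the point to A[[z]], follow a chain from x_s up to
-- the fresh variable, then set z = 0. The end of the chain is given existentially because T is
-- available only as a relation.
IsD : ℕ → Fun → Fun → Set₁
IsD s F G = ∀ A N x → s ≤ N → Σ (Points.Pt (PSAlg A) → Alg.Carrier (PSAlg A)) λ g →
  Chain (PSAlg A) (suc N) s (N ℕ.∸ s) (F (PSAlg A) (suc N)) g ×
  (let open Points A in G A N x ≋ g (Extend.ext A x N) 0)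

Chain-+ : ∀ {A N s len f f' g g'} → let open Points A in Chain A N s len f g → Chain A N s len f' g' →
  Chain A N s len (λ x → f x + f' x) (λ x → g x + g' x)
Chain-+ {A} c d = record
  { stage = λ n x → C.stage n x + D.stage n x
  ; first = λ x → +-cong (C.first x) (D.first x)
  ; step = λ n p x x' reg w → Tr-+ (C.step n p x x' reg w) (D.step n p x x' reg w)
  ; last = λ x → +-cong (C.last x) (D.last x) }
  where
  open Points A
  module C = Chain c
  module D = Chain d

Chain-resp : ∀ {A N s len f f' g} → let open Points A in (∀ x → f x ≋ f' x) → Chain A N s len f g → Chain A N s len f' g
Chain-resp {A} e c = record { stage = C.stage ; first = λ x → ≋-trans (C.first x) (e x) ; step = C.step ; last = C.last }
  where
  open Points A
  module C = Chain c

Chain-0 : ∀ {A N s len} → Chain A N s len (λ _ → Points.0# A) (λ _ → Points.0# A)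
Chain-0 {A} = record { stage = λ _ _ → 0# ; first = λ _ → ≋-refl ; step = λ _ _ _ _ _ _ → Tr-0 ; last = λ _ → ≋-refl }
  where open Points A

module _ {A : Alg} where
  open Points A

  -- One step at x also consults the exchanged point, so the induction ranges over all regular
  -- points at once; `Reg-Sw` keeps it among them, and regularity of the difference determines each
  -- stage.
  Chain-unique : ∀ {N s len f f' g g'} → s ℕ.+ len < N → (∀ x → Reg N x → f x ≋ f' x) →
    Chain A N s len f g → Chain A N s len f' g' → ∀ x → Reg N x → g x ≋ g' x
  Chain-unique {N} {s} {len} {f} {f'} p e c d x reg =
    ≋-trans (≋-sym (C.last x)) (≋-trans (go len ℕₚ.≤-refl x reg) (D.last x))
    where
    module C = Chain c
    module D = Chain d
    go : ∀ n → n ≤ len → ∀ x → Reg N x → C.stage n x ≋ D.stage n x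
    go zero _ x reg = ≋-trans (C.first x) (≋-trans (e x reg) (≋-sym (D.first x)))
    go (suc n) q x reg = Tr-uniq (Reg-k k<N reg) (C.step n q x x' reg w)
      (Tr-resp (≋-sym (go n q' x reg)) (≋-sym (go n q' x' (Reg-Sw k<N w reg))) ≋-refl (D.step n q x x' reg w))
      where
      k = s ℕ.+ n
      k<N : suc k < N
      k<N = ℕₚ.≤-<-trans (ℕₚ.≤-trans (ℕₚ.≤-reflexive (sym (ℕₚ.+-suc s n))) (ℕₚ.+-monoʳ-≤ s q)) p
      q' : n ≤ len
      q' = ℕₚ.<⇒≤ q
      x' : Pt
      x' i = x (σ k i)
      w : Sw k x x'
      w = sw λ i → ≋-refl

d₋-termF : ∀ {s} → R.Carrier → Vec ℕ s → ℕ → PIdx → Fun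
d₋-termF {s} r η e ks = r ·F (vmonoF η *F ∑LF (splits ks) (𝓑-termF s e))

module D₋Term {s : ℕ} (r : R.Carrier) (η : Vec ℕ s) (e : ℕ) (ks : PIdx) where

  d₋-termF-≋ : ∀ A N x → s ≤ N → let open Points A in
    d₋-termF r η e ks A N x ≋ ι r * (vmono x η * TermSums.dterm A s N ks e x)
  d₋-termF-≋ A N x s≤N = *-congˡ (*-congˡ (∑L-cong (splits ks) (λ { (w , m , rest) →
      *-cong (≋-trans (ι-^ neg1 m) (^-cong m (≋-trans (ι-neg R.1#) (-‿cong ι-1))))
        (*-cong (≋-trans (*-congʳ ι-1) (*-identityˡ _))
          (subst (λ z → expF s (e ℕ.+ w) A z x ≋ Q s (N ℕ.∸ s) x (e ℕ.+ w)) (ℕₚ.m+[n∸m]≡n s≤N)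
            (expS-Q s (N ℕ.∸ s) x (e ℕ.+ w)))) })))
    where
    open Points A
    open Plethysm A

  module _ (A : Alg) (N : ℕ) where
    open Points A
    open TermSums A

    term-chain : ∀ len → s ℕ.+ len < N → Chain A N s len
      (λ x → ι r * mono N x (η V.∷ʳ e) ks)
      (λ x → ι r * (vmono x η * hterm s N len ks e x))
    term-chain len p = record
      { stage = λ n x → ι r * (vmono x η * hterm s N n ks e x)
      ; first = λ x → *-congˡ (≋-trans (*-congˡ (hterm-start s N ks e x))
          (≋-trans (≋-sym (*-assoc _ _ _)) (*-congʳ (≋-sym (vmono-∷ʳ x η e)))))
      ; step = λ n n<len x x' reg w → Tr-* (ι r) (Tr-resp ≋-refl
          (*-congʳ (vmono-cong η (λ i i<s → ≋-sym (Sw-other w i (ℕₚ.<⇒≢ (ℕₚ.<-≤-trans i<s (ℕₚ.m≤m+n s n)))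
            (ℕₚ.<⇒≢ (ℕₚ.m≤n⇒m≤1+n (ℕₚ.<-≤-trans i<s (ℕₚ.m≤m+n s n)))))))) ≋-refl
          (Tr-* (vmono x η) (hterm-step s N n ks e x x'
            (ℕₚ.≤-<-trans (ℕₚ.≤-trans (ℕₚ.≤-reflexive (sym (ℕₚ.+-suc s n))) (ℕₚ.+-monoʳ-≤ s n<len)) p) w)))
      ; last = λ x → ≋-refl }

  term-IsD : IsD s (r ·F polyμ (η V.∷ʳ e , ks)) (d₋-termF r η e ks)
  term-IsD A N x s≤N = _ , term-chain A⟦z⟧ (suc N) (N ℕ.∸ s) (s≤s (ℕₚ.≤-reflexive (ℕₚ.m+[n∸m]≡n s≤N))) ,
    ≋-trans (d₋-termF-≋ A N x s≤N) (*-congˡ (≋-sym (*-cong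
      (≋-trans (at0-vmono (ext x N) η) (vmono-cong η (λ i i<s → ext-at0-< x N i (ℕₚ.<-≤-trans i<s s≤N))))
      (hterm-end s N ks e x s≤N))))
    where
    open Points A
    open Extend A

IsD-+ : ∀ {s} {F F' G G'} → IsD s F G → IsD s F' G' → IsD s (F +F F') (G +F G')
IsD-+ d d' A N x s≤N =
  let g , c , e = d A N x s≤N
      g' , c' , e' = d' A N x s≤N
  in _ , Chain-+ c c' , Points.+-cong A e e'

EvP-d₋ : ∀ {s} {f : Poly (suc s)} {F} → EvP f F → Σ Fun λ G → EvP (d₋ f) G × IsD s F G
EvP-d₋ (nil z) = 0F , nil (λ A N x → Points.≋-refl A) , λ A N x s≤N →
  _ , Chain-resp (λ y → Points.≋-sym (PSAlg A) (z (PSAlg A) (suc N) y)) Chain-0 , Points.≋-refl A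
EvP-d₋ {s} (cons {c = c} {r} {η , ks} {F = F} v h z) =
  let G , hG , dG = EvP-d₋ h
      Gₜ = d₋-termF r (V.init η) (V.last η) ks
      -- `d₋` reads η through `init` and `last`, whereas `term-IsD` expects the last exponent
      -- appended; `initLast` reconciles the two.
      dGₜ = subst (λ ζ → IsD s (r ·F polyμ (ζ , ks)) Gₜ) (sym (proj₂ (proj₂ (V.initLast η))))
              (D₋Term.term-IsD r (V.init η) (V.last η) ks)
  in Gₜ +F G , Ev-++ (EvP-attach {s} _ (λ c' u → refl) v (EvL-𝓑 s (V.last η) ks)) hG ,
  λ A N x s≤N → let g , ch , eq = IsD-+ {F = r ·F polyμ (η , ks)} {F} {Gₜ} {G} dGₜ dG A N x s≤N in
    g , Chain-resp (λ y → Points.≋-sym (PSAlg A) (z (PSAlg A) (suc N) y)) ch , eq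

-- Queues of colours and the exchange of neighbouring colours.

infixl 5 _▷_
_▷_ : {X : Set} → List X → X → List X
cs ▷ v = cs ++ v ∷ []

-- How k and k + 1 occur in a queue: not at all (Free); exactly one of them, k in the
-- first queue and k + 1 in the second (Single); both, k before k + 1 in the first
-- queue and k + 1 before k in the second (Double).
data Free (k : ℕ) : List ℕ → Set where
  [] : Free k []
  _∷_ : ∀ {c cs} → c ≢ k × c ≢ suc k → Free k cs → Free k (c ∷ cs)

data Single (k : ℕ) : List ℕ → List ℕ → Set where
  here : ∀ {cs} → Free k cs → Single k (k ∷ cs) (suc k ∷ cs)
  there : ∀ {c cs cs'} → c ≢ k × c ≢ suc k → Single k cs cs' → Single k (c ∷ cs) (c ∷ cs')

data Double (k : ℕ) : List ℕ → List ℕ → Set where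
  here : ∀ {cs cs'} → Single k cs' cs → Double k (k ∷ cs) (suc k ∷ cs')
  there : ∀ {c cs cs'} → c ≢ k × c ≢ suc k → Double k cs cs' → Double k (c ∷ cs) (c ∷ cs')

Free-▷ : ∀ {k c cs} → Free k cs → c ≢ k × c ≢ suc k → Free k (cs ▷ c)
Free-▷ [] p = p ∷ []
Free-▷ (q ∷ f) p = q ∷ Free-▷ f p

Free-Single : ∀ {k cs} → Free k cs → Single k (cs ▷ k) (cs ▷ suc k)
Free-Single [] = here []
Free-Single (q ∷ f) = there q (Free-Single f)

Single-▷ : ∀ {k c cs cs'} → Single k cs cs' → c ≢ k × c ≢ suc k → Single k (cs ▷ c) (cs' ▷ c)
Single-▷ (here f) p = here (Free-▷ f p)
Single-▷ (there q s) p = there q (Single-▷ s p)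

Single-Double : ∀ {k cs cs'} → Single k cs cs' → Double k (cs ▷ suc k) (cs' ▷ k)
Single-Double (here f) = here (Free-Single f)
Single-Double (there q s) = there q (Single-Double s)

Double-▷ : ∀ {k c cs cs'} → Double k cs cs' → c ≢ k × c ≢ suc k → Double k (cs ▷ c) (cs' ▷ c)
Double-▷ (here s) p = here (Single-▷ s p)
Double-▷ (there q d) p = there q (Double-▷ d p)

-- Overwriting the places k and k + 1 by zero isolates these two colours in a sum: they are treated
-- as a pair, and the remaining colours term by term.
skip : {X : Set} → X → ℕ → (ℕ → X) → ℕ → X
skip z zero f zero = z
skip z zero f (suc zero) = z
skip z zero f (suc (suc v)) = f (suc (suc v))
skip z (suc k) f zero = f zero
skip z (suc k) f (suc v) = skip z k (λ i → f (suc i)) v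

data View (k : ℕ) : ℕ → Set where
  at-k : View k k
  at-suc : View k (suc k)
  other : ∀ {v} → v ≢ k × v ≢ suc k → View k v

view : ∀ k v → View k v
view k v with v ℕ.≟ k | v ℕ.≟ suc k
... | yes refl | _ = at-k
... | no _ | yes refl = at-suc
... | no p | no q = other (p , q)

skip-k : ∀ {X : Set} (z : X) k f → skip z k f k ≡ z
skip-k z zero f = refl
skip-k z (suc k) f = skip-k z k _

skip-suc : ∀ {X : Set} (z : X) k f → skip z k f (suc k) ≡ z
skip-suc z zero f = refl
skip-suc z (suc k) f = skip-suc z k _

skip-other : ∀ {X : Set} (z : X) k f v → v ≢ k × v ≢ suc k → skip z k f v ≡ f v
skip-other z zero f zero (p , q) = ⊥-elim (p refl)
skip-other z zero f (suc zero) (p , q) = ⊥-elim (q refl)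
skip-other z zero f (suc (suc v)) _ = refl
skip-other z (suc k) f zero _ = refl
skip-other z (suc k) f (suc v) (p , q) = skip-other z k _ v ((λ e → p (cong suc e)) , (λ e → q (cong suc e)))

module Queue (A : Alg) where
  open Points A

  tif : {P : Set} → Dec P → Carrier
  tif (yes _) = t
  tif (no _) = 1#

  tif-yes : {P : Set} (d : Dec P) → P → tif d ≡ t
  tif-yes (yes _) _ = refl
  tif-yes (no ¬p) p = ⊥-elim (¬p p)

  tif-no : {P : Set} (d : Dec P) → ¬ P → tif d ≡ 1#
  tif-no (yes p) ¬p = ⊥-elim (¬p p)
  tif-no (no _) _ = refl

  tif-⇔ : {P P' : Set} (d : Dec P) (d' : Dec P') → (P → P') → (P' → P) → tif d ≡ tif d'
  tif-⇔ (yes p) d' f g = sym (tif-yes d' (f p))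
  tif-⇔ (no ¬p) d' f g = sym (tif-no d' (λ p' → ¬p (g p')))

  -- t^#{c ∈ cs : v < c} and t^#{c ∈ cs : v = c}
  gtw eqw pushW : List ℕ → ℕ → Carrier
  gtw cs v = prodL (λ c → tif (v ℕ.<? c)) cs
  eqw cs v = prodL (λ c → tif (v ℕ.≟ c)) cs
  -- The letters v and v̄ pushed on cs contribute t^#{c ≥ v} and −t · t^#{c > v}.
  pushW cs v = gtw cs v * (eqw cs v - t)

  private
    suc<-⇔ : ∀ {k c} → c ≢ suc k → (k < c → suc k < c)
    suc<-⇔ q p = ℕₚ.≤∧≢⇒< p (λ e → q (sym e))

  eqw-Free-k : ∀ {k cs} → Free k cs → eqw cs k ≋ 1#
  eqw-Free-k [] = ≋-refl
  eqw-Free-k {k} (_∷_ {c} (p , q) f) = ≋-trans (*-cong (≋-reflexive (tif-no (k ℕ.≟ c) (λ e → p (sym e)))) (eqw-Free-k f)) (*-identityˡ _)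

  eqw-Free-suc : ∀ {k cs} → Free k cs → eqw cs (suc k) ≋ 1#
  eqw-Free-suc [] = ≋-refl
  eqw-Free-suc {k} (_∷_ {c} (p , q) f) = ≋-trans (*-cong (≋-reflexive (tif-no (suc k ℕ.≟ c) (λ e → q (sym e)))) (eqw-Free-suc f)) (*-identityˡ _)

  gtw-Free : ∀ {k cs} → Free k cs → gtw cs k ≋ gtw cs (suc k)
  gtw-Free [] = ≋-refl
  gtw-Free {k} (_∷_ {c} (p , q) f) = *-cong (≋-reflexive (tif-⇔ (k ℕ.<? c) (suc k ℕ.<? c) (suc<-⇔ q) ℕₚ.<⇒≤)) (gtw-Free f)

  pushW-Free : ∀ {k cs} → Free k cs → pushW cs k ≋ pushW cs (suc k)
  pushW-Free f = *-cong (gtw-Free f) (+-congʳ (≋-trans (eqw-Free-k f) (≋-sym (eqw-Free-suc f))))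

  private
    tif-k-suc : ∀ {k v} → v ≢ k × v ≢ suc k → tif (v ℕ.<? k) ≡ tif (v ℕ.<? suc k)
    tif-k-suc {k} {v} (p , q) = tif-⇔ (v ℕ.<? k) (v ℕ.<? suc k) ℕₚ.m≤n⇒m≤1+n (λ { (s≤s r) → ℕₚ.≤∧≢⇒< r p })

    tif-eq-k-suc : ∀ {k v} → v ≢ k × v ≢ suc k → tif (v ℕ.≟ k) ≡ tif (v ℕ.≟ suc k)
    tif-eq-k-suc {k} {v} (p , q) = tif-⇔ (v ℕ.≟ k) (v ℕ.≟ suc k) (λ e → ⊥-elim (p e)) (λ e → ⊥-elim (q e))

  gtw-Single : ∀ {k v cs cs'} → v ≢ k × v ≢ suc k → Single k cs cs' → gtw cs v ≋ gtw cs' v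
  gtw-Single o (here f) = *-congʳ (≋-reflexive (tif-k-suc o))
  gtw-Single o (there q s) = *-congˡ (gtw-Single o s)

  eqw-Single : ∀ {k v cs cs'} → v ≢ k × v ≢ suc k → Single k cs cs' → eqw cs v ≋ eqw cs' v
  eqw-Single o (here f) = *-congʳ (≋-reflexive (tif-eq-k-suc o))
  eqw-Single o (there q s) = *-congˡ (eqw-Single o s)

  gtw-Double : ∀ {k v cs cs'} → v ≢ k × v ≢ suc k → Double k cs cs' → gtw cs v ≋ gtw cs' v
  gtw-Double o (here s) = *-cong (≋-reflexive (tif-k-suc o)) (≋-sym (gtw-Single o s))
  gtw-Double o (there q d) = *-congˡ (gtw-Double o d)

  eqw-Double : ∀ {k v cs cs'} → v ≢ k × v ≢ suc k → Double k cs cs' → eqw cs v ≋ eqw cs' v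
  eqw-Double o (here s) = *-cong (≋-reflexive (tif-eq-k-suc o)) (≋-sym (eqw-Single o s))
  eqw-Double o (there q d) = *-congˡ (eqw-Double o d)

  pushW-Single : ∀ {k v cs cs'} → v ≢ k × v ≢ suc k → Single k cs cs' → pushW cs v ≋ pushW cs' v
  pushW-Single o s = *-cong (gtw-Single o s) (+-congʳ (eqw-Single o s))

  pushW-Double : ∀ {k v cs cs'} → v ≢ k × v ≢ suc k → Double k cs cs' → pushW cs v ≋ pushW cs' v
  pushW-Double o s = *-cong (gtw-Double o s) (+-congʳ (eqw-Double o s))

  private
    t*1 : ∀ {a b} → a ≡ t → b ≋ 1# → a * b ≋ t
    t*1 e e' = ≋-trans (*-cong (≋-reflexive e) e') (*-identityʳ _)

    1*x : ∀ {a b c} → a ≡ 1# → b ≋ c → a * b ≋ c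
    1*x e e' = ≋-trans (*-cong (≋-reflexive e) e') (*-identityˡ _)

  eqw-Single-k : ∀ {k cs cs'} → Single k cs cs' → eqw cs k ≋ t
  eqw-Single-k {k} (here f) = t*1 (tif-yes (k ℕ.≟ k) refl) (eqw-Free-k f)
  eqw-Single-k {k} (there {c} (p , q) s) = 1*x (tif-no (k ℕ.≟ c) (λ e → p (sym e))) (eqw-Single-k s)

  eqw-Single-k' : ∀ {k cs cs'} → Single k cs cs' → eqw cs' k ≋ 1#
  eqw-Single-k' {k} (here f) = 1*x (tif-no (k ℕ.≟ suc k) (λ e → ℕₚ.1+n≢n (sym e))) (eqw-Free-k f)
  eqw-Single-k' {k} (there {c} (p , q) s) = 1*x (tif-no (k ℕ.≟ c) (λ e → p (sym e))) (eqw-Single-k' s)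

  eqw-Single-suc : ∀ {k cs cs'} → Single k cs cs' → eqw cs (suc k) ≋ 1#
  eqw-Single-suc {k} (here f) = 1*x (tif-no (suc k ℕ.≟ k) ℕₚ.1+n≢n) (eqw-Free-suc f)
  eqw-Single-suc {k} (there {c} (p , q) s) = 1*x (tif-no (suc k ℕ.≟ c) (λ e → q (sym e))) (eqw-Single-suc s)

  eqw-Single-suc' : ∀ {k cs cs'} → Single k cs cs' → eqw cs' (suc k) ≋ t
  eqw-Single-suc' {k} (here f) = t*1 (tif-yes (suc k ℕ.≟ suc k) refl) (eqw-Free-suc f)
  eqw-Single-suc' {k} (there {c} (p , q) s) = 1*x (tif-no (suc k ℕ.≟ c) (λ e → q (sym e))) (eqw-Single-suc' s)

  -- The extra t comes from the entry k + 1 of the second queue, which exceeds the pushed colour k.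
  -- It becomes the t in T x_{k+1} T = t x_k.
  gtw-Single-push : ∀ {k cs cs'} → Single k cs cs' → gtw cs' k ≋ t * gtw cs (suc k)
  gtw-Single-push {k} (here f) = *-cong (≋-reflexive (tif-yes (k ℕ.<? suc k) ℕₚ.≤-refl))
    (≋-trans (gtw-Free f) (≋-sym (1*x (tif-no (suc k ℕ.<? k) (λ p → ℕₚ.1+n≰n (ℕₚ.<⇒≤ p))) ≋-refl)))
  gtw-Single-push {k} (there {c} (p , q) s) = ≋-trans
    (*-cong (≋-reflexive (tif-⇔ (k ℕ.<? c) (suc k ℕ.<? c) (suc<-⇔ q) ℕₚ.<⇒≤)) (gtw-Single-push s))
    (solve 3 (λ a t b → a :* (t :* b) := t :* (a :* b)) ≋-refl _ _ _)

  eqw-Double-k : ∀ {k cs cs'} → Double k cs cs' → eqw cs k ≋ t × eqw cs' k ≋ t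
  eqw-Double-k {k} (here s) = t*1 (tif-yes (k ℕ.≟ k) refl) (eqw-Single-k' s) ,
    1*x (tif-no (k ℕ.≟ suc k) (λ e → ℕₚ.1+n≢n (sym e))) (eqw-Single-k s)
  eqw-Double-k {k} (there {c} (p , q) d) = let a , b = eqw-Double-k d; n = tif-no (k ℕ.≟ c) (λ e → p (sym e)) in 1*x n a , 1*x n b

  eqw-Double-suc : ∀ {k cs cs'} → Double k cs cs' → eqw cs (suc k) ≋ t × eqw cs' (suc k) ≋ t
  eqw-Double-suc {k} (here s) = 1*x (tif-no (suc k ℕ.≟ k) ℕₚ.1+n≢n) (eqw-Single-suc' s) ,
    t*1 (tif-yes (suc k ℕ.≟ suc k) refl) (eqw-Single-suc s)
  eqw-Double-suc {k} (there {c} (p , q) d) = let a , b = eqw-Double-suc d; n = tif-no (suc k ℕ.≟ c) (λ e → q (sym e)) in 1*x n a , 1*x n b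

  pushW-0 : ∀ {cs v} → eqw cs v ≋ t → pushW cs v ≋ 0#
  pushW-0 e = ≋-trans (*-congˡ (x-y≋0 e)) (zeroʳ _)

  ∑-pick : ∀ k n f → suc k < n → ∑ n f ≋ (f k + f (suc k)) + ∑ n (skip 0# k f)
  ∑-pick zero (suc (suc n)) f _ = solve 3 (λ a b c → a :+ (b :+ c) := (a :+ b) :+ (con (0 , 0) :+ (con (0 , 0) :+ c))) ≋-refl _ _ _
  ∑-pick zero (suc zero) f (s≤s ())
  ∑-pick (suc k) (suc n) f (s≤s p) = ≋-trans (+-congˡ (∑-pick k n (λ i → f (suc i)) p))
    (solve 4 (λ a b c d → a :+ ((b :+ c) :+ d) := (b :+ c) :+ (a :+ d)) ≋-refl _ _ _ _)

  Tr-∑-pick : ∀ {X Y} k n {f f' g} → suc k < n →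
    Tr X Y (f k + f (suc k)) (f' k + f' (suc k)) (g k + g (suc k)) →
    (∀ v → v ≢ k × v ≢ suc k → Tr X Y (f v) (f' v) (g v)) → Tr X Y (∑ n f) (∑ n f') (∑ n g)
  Tr-∑-pick {X} {Y} k n {f} {f'} {g} p h o = Tr-resp (≋-sym (∑-pick k n f p)) (≋-sym (∑-pick k n f' p)) (≋-sym (∑-pick k n g p))
    (Tr-+ h (Tr-∑ n (λ v _ → lem v (view k v))))
    where
    lem : ∀ v → View k v → Tr X Y (skip 0# k f v) (skip 0# k f' v) (skip 0# k g v)
    lem v at-k rewrite skip-k 0# k f | skip-k 0# k f' | skip-k 0# k g = Tr-0
    lem v at-suc rewrite skip-suc 0# k f | skip-suc 0# k f' | skip-suc 0# k g = Tr-0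
    lem v (other q) rewrite skip-other 0# k f v q | skip-other 0# k f' v q | skip-other 0# k g v q = o v q

  -- For every f the combination x_k f + x_{k+1} T f is symmetric in the two variables; `c` and `c'`
  -- are the values of T f at a point and at its exchange. This makes the joint push of k and k + 1
  -- on a free queue invariant.
  Tr-push₁ : ∀ {x y a a' c c'} → Regular (x - y) → Tr x y a a' c → Tr y x a' a c' → x * a + y * c ≋ y * a' + x * c'
  Tr-push₁ {x} {y} {a} {a'} {c} {c'} r (tr h) (tr h') = Regular-cancel r (begin
    (x - y) * (x * a + y * c)                 ≈⟨ solve 4 (λ x y a c → (x :- y) :* (x :* a :+ y :* c) := (x :- y) :* (x :* a) :+ y :* ((x :- y) :* c)) ≋-refl x y a c ⟩
    (x - y) * (x * a) + y * ((x - y) * c)     ≈⟨ +-congˡ (*-congˡ h) ⟩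
    (x - y) * (x * a) + y * ((t * x - y) * a' + (1# - t) * x * a)
      ≈⟨ solve 5 (λ x y t a a' → (x :- y) :* (x :* a) :+ y :* ((t :* x :- y) :* a' :+ (:1 :- t) :* x :* a)
           := (x :- y) :* (y :* a') :- x :* ((t :* y :- x) :* a :+ (:1 :- t) :* y :* a')) ≋-refl x y t a a' ⟩
    (x - y) * (y * a') - x * ((t * y - x) * a + (1# - t) * y * a')
      ≈⟨ +-congˡ (-‿cong (*-congˡ h')) ⟨
    (x - y) * (y * a') - x * ((y - x) * c')   ≈⟨ solve 4 (λ x y a' c' → (x :- y) :* (y :* a') :- x :* ((y :- x) :* c') := (x :- y) :* (y :* a' :+ x :* c')) ≋-refl x y a' c' ⟩
    (x - y) * (y * a' + x * c') ∎)
    where open ≋-R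

  -- T x_{k+1} T = t x_k
  Tr-push₂ : ∀ {x y b b' g g'} → Regular (x - y) → Tr x y b b' g → Tr y x b' b g' → Tr x y (y * g) (x * g') (t * (x * b))
  Tr-push₂ {x} {y} {b} {b'} {g} {g'} r (tr h) (tr h') = tr (Regular-cancel r (≋-sym (begin
    (x - y) * ((t * x - y) * (x * g') + (1# - t) * x * (y * g))
      ≈⟨ solve 5 (λ x y t g g' → (x :- y) :* ((t :* x :- y) :* (x :* g') :+ (:1 :- t) :* x :* (y :* g))
           := (:1 :- t) :* x :* y :* ((x :- y) :* g) :- (t :* x :- y) :* x :* ((y :- x) :* g')) ≋-refl x y t g g' ⟩
    (1# - t) * x * y * ((x - y) * g) - (t * x - y) * x * ((y - x) * g')
      ≈⟨ +-cong (*-congˡ h) (-‿cong (*-congˡ h')) ⟩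
    (1# - t) * x * y * ((t * x - y) * b' + (1# - t) * x * b) - (t * x - y) * x * ((t * y - x) * b + (1# - t) * y * b')
      ≈⟨ solve 5 (λ x y t b b' → (:1 :- t) :* x :* y :* ((t :* x :- y) :* b' :+ (:1 :- t) :* x :* b) :- (t :* x :- y) :* x :* ((t :* y :- x) :* b :+ (:1 :- t) :* y :* b')
           := (x :- y) :* ((x :- y) :* (t :* (x :* b)))) ≋-refl x y t b b' ⟩
    (x - y) * ((x - y) * (t * (x * b))) ∎)))
    where open ≋-R

  -- T x_k = (1 − t) x_k + x_{k+1} T
  Tr-push₃ : ∀ {x y a a' c} → Tr x y a a' c → Tr x y (x * a) (y * a') ((1# - t) * (x * a) + y * c)
  Tr-push₃ {x} {y} {a} {a'} {c} (tr h) = tr (begin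
    (x - y) * ((1# - t) * (x * a) + y * c)
      ≈⟨ solve 5 (λ x y t a c → (x :- y) :* ((:1 :- t) :* (x :* a) :+ y :* c) := (x :- y) :* ((:1 :- t) :* (x :* a)) :+ y :* ((x :- y) :* c)) ≋-refl x y t a c ⟩
    (x - y) * ((1# - t) * (x * a)) + y * ((x - y) * c)   ≈⟨ +-congˡ (*-congˡ h) ⟩
    (x - y) * ((1# - t) * (x * a)) + y * ((t * x - y) * a' + (1# - t) * x * a)
      ≈⟨ solve 5 (λ x y t a a' → (x :- y) :* ((:1 :- t) :* (x :* a)) :+ y :* ((t :* x :- y) :* a' :+ (:1 :- t) :* x :* a)
           := (t :* x :- y) :* (y :* a') :+ (:1 :- t) :* x :* (x :* a)) ≋-refl x y t a a' ⟩
    (t * x - y) * (y * a') + (1# - t) * x * (x * a) ∎)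
    where open ≋-R

  module Steps (N : ℕ) where

    QF : Set
    QF = Pt → List ℕ → Carrier

    stepN stepE stepC : QF → QF
    stepN φ x cs = ∑ N (λ v → x v * (pushW cs v * φ x (cs ▷ v)))
    -- A default value: valid sequences of moves pop only nonempty queues.
    stepE φ x [] = φ x []
    stepE φ x (c ∷ cs) = φ x cs
    stepC φ x cs = ι 1/t-1 * (stepN (stepE φ) x cs - stepE (stepN φ) x cs)

    -- Pushing k + 1 on a queue with k leads to `Double`, and popping leads back to `Single` and
    -- `Free`, so only the three statements together are preserved. In `double`, T goes from the
    -- queue with k + 1 in front to the one with k in front, because popping the front entries must
    -- leave an instance of `single`.
    record Inv (φ : QF) : Set where
      field
        free : ∀ {k cs x x'} → suc k < N → Reg N x → Sw k x x' → Free k cs → φ x cs ≋ φ x' cs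
        single : ∀ {k cs cs' x x'} → suc k < N → Reg N x → Sw k x x' → Single k cs cs' →
          Tr (x k) (x (suc k)) (φ x cs) (φ x' cs) (φ x cs')
        double : ∀ {k cs cs' x x'} → suc k < N → Reg N x → Sw k x x' → Double k cs cs' →
          Tr (x k) (x (suc k)) (φ x cs') (φ x' cs') (φ x cs)
    open Inv

    Inv-base : Inv (λ _ _ → 1#)
    Inv-base = record { free = λ _ _ _ _ → ≋-refl ; single = λ _ _ _ _ → Tr-sym ≋-refl ; double = λ _ _ _ _ → Tr-sym ≋-refl }

    Inv-E : ∀ {φ} → Inv φ → Inv (stepE φ)
    Inv-E {φ} i = record
      { free = λ { p r w [] → free i p r w [] ; p r w (_ ∷ f) → free i p r w f }
      -- Once the distinguished entry is popped, both queues are the same free queue, whose value is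
      -- symmetric and hence fixed by T.
      ; single = λ { p r w (here f) → Tr-sym (free i p r w f) ; p r w (there _ s) → single i p r w s }
      ; double = λ { p r w (here s) → single i p r w s ; p r w (there _ d) → double i p r w d } }

    Inv-lin : ∀ {φ ψ} c → Inv φ → Inv ψ → Inv (λ x cs → c * (φ x cs - ψ x cs))
    Inv-lin c i j = record
      { free = λ p r w f → *-congˡ (+-cong (free i p r w f) (-‿cong (free j p r w f)))
      ; single = λ p r w s → Tr-* c (Tr-- (single i p r w s) (single j p r w s))
      ; double = λ p r w s → Tr-* c (Tr-- (double i p r w s) (double j p r w s)) }
      where
      neg : ∀ a → (- 1#) * a ≋ - a
      neg = solve 1 (λ a → (:- :1) :* a := :- a) ≋-refl
      Tr-- : ∀ {x y a a' c b b' d} → Tr x y a a' c → Tr x y b b' d → Tr x y (a - b) (a' - b') (c - d)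
      Tr-- h h' = Tr-resp (+-congˡ (neg _)) (+-congˡ (neg _)) (+-congˡ (neg _)) (Tr-+ h (Tr-* (- 1#) h'))

    Inv-N : ∀ {φ} → Inv φ → Inv (stepN φ)
    Inv-N {φ} i = record { free = free' ; single = single' ; double = double' }
      where
      term : Pt → List ℕ → ℕ → Carrier
      term x cs v = x v * (pushW cs v * φ x (cs ▷ v))

      zero-term : ∀ {x cs v} → eqw cs v ≋ t → term x cs v ≋ 0#
      zero-term {cs = cs} {v} e = ≋-trans (*-congˡ (≋-trans (*-congʳ (pushW-0 {cs} {v} e)) (zeroˡ _))) (zeroʳ _)

      free' : ∀ {k cs x x'} → suc k < N → Reg N x → Sw k x x' → Free k cs → stepN φ x cs ≋ stepN φ x' cs
      free' {k} {cs} {x} {x'} p r w f = begin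
        ∑ N (term x cs)                                                        ≈⟨ ∑-pick k N _ p ⟩
        (term x cs k + term x cs (suc k)) + ∑ N (skip 0# k (term x cs))        ≈⟨ +-cong pair (∑-cong N (λ v _ → lem v (view k v))) ⟩
        (term x' cs k + term x' cs (suc k)) + ∑ N (skip 0# k (term x' cs))     ≈⟨ ∑-pick k N _ p ⟨
        ∑ N (term x' cs) ∎
        where
        open ≋-R
        W = pushW cs k
        pair : term x cs k + term x cs (suc k) ≋ term x' cs k + term x' cs (suc k)
        pair = begin
          x k * (W * φ x (cs ▷ k)) + x (suc k) * (pushW cs (suc k) * φ x (cs ▷ suc k))
            ≈⟨ +-congˡ (*-congˡ (*-congʳ (pushW-Free f))) ⟨
          x k * (W * φ x (cs ▷ k)) + x (suc k) * (W * φ x (cs ▷ suc k))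
            ≈⟨ solve 5 (λ a b w c d → a :* (w :* b) :+ c :* (w :* d) := w :* (a :* b :+ c :* d)) ≋-refl _ _ W _ _ ⟩
          W * (x k * φ x (cs ▷ k) + x (suc k) * φ x (cs ▷ suc k))
            ≈⟨ *-congˡ (Tr-push₁ (Reg-k p r) (single i p r w (Free-Single f))
                 (Tr-respˣ (Sw-k w) (Sw-suc w) (single i p (Reg-Sw p w r) (Sw-sym w) (Free-Single f)))) ⟩
          W * (x (suc k) * φ x' (cs ▷ k) + x k * φ x' (cs ▷ suc k))
            ≈⟨ solve 5 (λ a b w c d → w :* (a :* b :+ c :* d) := a :* (w :* b) :+ c :* (w :* d)) ≋-refl _ _ W _ _ ⟩
          x (suc k) * (W * φ x' (cs ▷ k)) + x k * (W * φ x' (cs ▷ suc k))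
            ≈⟨ +-cong (*-congʳ (≋-sym (Sw-k w))) (*-cong (≋-sym (Sw-suc w)) (*-congʳ (pushW-Free f))) ⟩
          x' k * (W * φ x' (cs ▷ k)) + x' (suc k) * (pushW cs (suc k) * φ x' (cs ▷ suc k)) ∎
        lem : ∀ v → View k v → skip 0# k (term x cs) v ≋ skip 0# k (term x' cs) v
        lem v at-k rewrite skip-k 0# k (term x cs) | skip-k 0# k (term x' cs) = ≋-refl
        lem v at-suc rewrite skip-suc 0# k (term x cs) | skip-suc 0# k (term x' cs) = ≋-refl
        lem v (other q) rewrite skip-other 0# k (term x cs) v q | skip-other 0# k (term x' cs) v q =
          *-cong (≋-sym (Sw-other w v (proj₁ q) (proj₂ q))) (*-congˡ (free i p r w (Free-▷ f q)))

      Tr-other : ∀ {k x x' cs cs' v} → Sw k x x' → v ≢ k × v ≢ suc k → pushW cs v ≋ pushW cs' v →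
        Tr (x k) (x (suc k)) (φ x (cs ▷ v)) (φ x' (cs ▷ v)) (φ x (cs' ▷ v)) →
        Tr (x k) (x (suc k)) (term x cs v) (term x' cs v) (term x cs' v)
      Tr-other {v = v} w q e h = Tr-resp ≋-refl (*-congʳ (≋-sym (Sw-other w v (proj₁ q) (proj₂ q)))) (*-congˡ (*-congʳ e))
        (Tr-* _ (Tr-* _ h))

      single' : ∀ {k cs cs' x x'} → suc k < N → Reg N x → Sw k x x' → Single k cs cs' →
        Tr (x k) (x (suc k)) (stepN φ x cs) (stepN φ x' cs) (stepN φ x cs')
      single' {k} {cs} {cs'} {x} {x'} p r w s = Tr-∑-pick k N p
        -- A colour already present once has weight 0, so one of the two colours survives on each
        -- side: k + 1 pushed on `cs` and k pushed on `cs'`. The resulting queues form a `Double`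
        -- pair, to which `Tr-push₂` applies.
        (Tr-resp (pair x (suc-term {x})) (≋-trans (*-congˡ (*-congʳ (≋-sym (Sw-suc w)))) (pair x' (suc-term {x'}))) pair'
          (Tr-* W (Tr-push₂ (Reg-k p r) (double i p r w (Single-Double s))
            (Tr-respˣ (Sw-k w) (Sw-suc w) (double i p (Reg-Sw p w r) (Sw-sym w) (Single-Double s))))))
        (λ v q → Tr-other w q (pushW-Single q s) (single i p r w (Single-▷ s q)))
        where
        open ≋-R
        W = gtw cs (suc k) * (1# - t)
        suc-term : ∀ {x} → term x cs (suc k) ≋ W * (x (suc k) * φ x (cs ▷ suc k))
        suc-term {x} = ≋-trans (*-congˡ (*-congʳ (*-congˡ (+-congʳ (eqw-Single-suc s)))))
          (solve 3 (λ a w b → a :* (w :* b) := w :* (a :* b)) ≋-refl (x (suc k)) W (φ x (cs ▷ suc k)))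
        pair : ∀ x {z} → term x cs (suc k) ≋ z → z ≋ term x cs k + term x cs (suc k)
        pair x e = ≋-sym (≋-trans (+-cong (zero-term (eqw-Single-k s)) e) (+-identityˡ _))
        pair' : W * (t * (x k * φ x (cs' ▷ k))) ≋ term x cs' k + term x cs' (suc k)
        pair' = ≋-sym (≋-trans (+-cong
            (≋-trans (*-congˡ (*-congʳ (*-cong (gtw-Single-push s) (+-congʳ (eqw-Single-k' s)))))
              (solve 4 (λ a t g b → a :* (((t :* g) :* (:1 :- t)) :* b) := (g :* (:1 :- t)) :* (t :* (a :* b))) ≋-refl (x k) t (gtw cs (suc k)) (φ x (cs' ▷ k))))
            (zero-term (eqw-Single-suc' s))) (+-identityʳ _))

      double' : ∀ {k cs cs' x x'} → suc k < N → Reg N x → Sw k x x' → Double k cs cs' →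
        Tr (x k) (x (suc k)) (stepN φ x cs') (stepN φ x' cs') (stepN φ x cs)
      double' {k} {cs} {cs'} {x} {x'} p r w d = Tr-∑-pick k N p
        -- Both colours already occur once in either queue, so neither can be pushed.
        (Tr-resp (≋-sym (z x cs' c'k c's)) (≋-sym (z x' cs' c'k c's)) (≋-sym (z x cs ck cs₁)) Tr-0)
        (λ v q → Tr-other w q (≋-sym (pushW-Double q d)) (double i p r w (Double-▷ d q)))
        where
        ck = proj₁ (eqw-Double-k d)
        c'k = proj₂ (eqw-Double-k d)
        cs₁ = proj₁ (eqw-Double-suc d)
        c's = proj₂ (eqw-Double-suc d)
        z : ∀ x cs → eqw cs k ≋ t → eqw cs (suc k) ≋ t → term x cs k + term x cs (suc k) ≋ 0#
        z x cs e e' = ≋-trans (+-cong (zero-term e) (zero-term e')) (+-identityˡ _)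

    Inv-C : ∀ {φ} → Inv φ → Inv (stepC φ)
    Inv-C i = Inv-lin (ι 1/t-1) (Inv-N (Inv-E i)) (Inv-E (Inv-N i))

-- The operators d₊ and d₋ on queue sums.

range : ℕ → ℕ → List ℕ
range a zero = []
range a (suc n) = a ∷ range (suc a) n

range-▷ : ∀ a n → range a (suc n) ≡ range a n ▷ (a ℕ.+ n)
range-▷ a zero = cong (_∷ []) (sym (ℕₚ.+-identityʳ a))
range-▷ a (suc n) = cong (a ∷_) (trans (range-▷ (suc a) n) (cong (range (suc a) n ▷_) (sym (ℕₚ.+-suc a n))))

Free-range< : ∀ k a n → a ℕ.+ n ≤ k → Free k (range a n)
Free-range< k a zero p = []
Free-range< k a (suc n) p = (ℕₚ.<⇒≢ q , ℕₚ.<⇒≢ (ℕₚ.m≤n⇒m≤1+n q)) ∷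
  Free-range< k (suc a) n (ℕₚ.≤-trans (ℕₚ.≤-reflexive (sym (ℕₚ.+-suc a n))) p)
  where
  q : a < k
  q = ℕₚ.<-≤-trans (ℕₚ.m<m+n a (s≤s z≤n)) p

Free-range> : ∀ k a n → suc k < a → Free k (range a n)
Free-range> k a zero p = []
Free-range> k a (suc n) p = ((λ e → ℕₚ.<⇒≢ (ℕₚ.<-trans (ℕₚ.n<1+n k) p) (sym e)) , (λ e → ℕₚ.<⇒≢ p (sym e))) ∷
  Free-range> k (suc a) n (ℕₚ.m≤n⇒m≤1+n p)

Free-++-Single : ∀ {k cs ds es} → Free k cs → Single k ds es → Single k (cs ++ ds) (cs ++ es)
Free-++-Single [] s = s
Free-++-Single (q ∷ f) s = there q (Free-++-Single f s)

-- The colours 0, ..., k + n with k left out. Each operator of the d₊ chain lowers the gap by one,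
-- and at gap 0 the queue is what remains of 0, ..., s after its front entry is popped.
gap : ℕ → ℕ → List ℕ
gap k n = range 0 k ++ range (suc k) n

gap-Single : ∀ k n → Single k (gap (suc k) n) (gap k (suc n))
gap-Single k n = subst (λ z → Single k z (gap k (suc n)))
  (trans (sym (Lₚ.++-assoc (range 0 k) (k ∷ []) (range (suc (suc k)) n)))
    (cong (_++ range (suc (suc k)) n) (sym (range-▷ 0 k))))
  (Free-++-Single (Free-range< k 0 k ℕₚ.≤-refl) (here (Free-range> k (suc (suc k)) n ℕₚ.≤-refl)))

QFun : Set₁
QFun = (A : Alg) → ℕ → Points.Pt A → List ℕ → Alg.Carrier A

stepQ : Move → QFun → QFun
stepQ mE φ A N = Queue.Steps.stepE A N (φ A N)
stepQ mN φ A N = Queue.Steps.stepN A N (φ A N)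
stepQ mC φ A N = Queue.Steps.stepC A N (φ A N)

queueSum : List Move → QFun
queueSum = foldr stepQ (λ A _ _ _ → Points.1# A)

InvQ : QFun → Set₁
InvQ φ = ∀ A N → Queue.Steps.Inv A N (φ A N)

InvQ-queueSum : ∀ ms → InvQ (queueSum ms)
InvQ-queueSum [] A N = Queue.Steps.Inv-base A N
InvQ-queueSum (mE ∷ ms) A N = Queue.Steps.Inv-E A N (InvQ-queueSum ms A N)
InvQ-queueSum (mN ∷ ms) A N = Queue.Steps.Inv-N A N (InvQ-queueSum ms A N)
InvQ-queueSum (mC ∷ ms) A N = Queue.Steps.Inv-C A N (InvQ-queueSum ms A N)

-- Setting the last variable to 0 lowers the number of variables by one.
Stable : QFun → Set₁
Stable φ = ∀ A N x cs → let open Points A in φ (PSAlg A) (suc N) (Extend.ext A x N) cs 0 ≋ φ A N x cs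

module StableSteps (A : Alg) (N : ℕ) where
  open Points A
  open Extend A
  private
    module A' = Points A⟦z⟧
    module Qu = Queue A
    module Qu' = Queue A⟦z⟧

  at0-tif : {P : Set} (d : Dec P) → Qu'.tif d 0 ≋ Qu.tif d
  at0-tif (yes _) = ≋-refl
  at0-tif (no _) = ≋-refl

  at0-pushW : ∀ cs v → Qu'.pushW cs v 0 ≋ Qu.pushW cs v
  at0-pushW cs v = *-cong (≋-trans (at0-prodL _ cs) (prodL-cong (λ c → at0-tif (v ℕ.<? c)) cs))
    (+-congʳ (≋-trans (at0-prodL _ cs) (prodL-cong (λ c → at0-tif (v ℕ.≟ c)) cs)))

  StableAt : QFun → Pt → Set
  StableAt φ x = ∀ cs → φ A⟦z⟧ (suc N) (ext x N) cs 0 ≋ φ A N x cs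

  stable-E : ∀ φ x → StableAt φ x → StableAt (stepQ mE φ) x
  stable-E φ x h [] = h []
  stable-E φ x h (c ∷ cs) = h cs

  stable-N : ∀ φ x → StableAt φ x → StableAt (stepQ mN φ) x
  stable-N φ x h cs = ≋-trans (at0-∑ (suc N) term) (≋-trans (∑-last N (λ v → term v 0)) (≋-trans
    (+-cong (∑-cong N (λ v v<N → *-cong (ext-at0-< x N v v<N) (*-cong (at0-pushW cs v) (h (cs ▷ v)))))
      (≋-trans (*-congʳ (ext-at0-N x N)) (zeroˡ _))) (+-identityʳ _)))
    where
    term : ℕ → A'.Carrier
    term v = ext x N v A'.* (Qu'.pushW cs v A'.* φ A⟦z⟧ (suc N) (ext x N) (cs ▷ v))

  stable-C : ∀ φ x → StableAt φ x → StableAt (stepQ mC φ) x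
  stable-C φ x h cs = *-congˡ (+-cong (stable-N (stepQ mE φ) x (stable-E φ x h) cs)
    (-‿cong (stable-E (stepQ mN φ) x (stable-N φ x h) cs)))

Stable-queueSum : ∀ ms → Stable (queueSum ms)
Stable-queueSum [] A N x cs = Points.≋-refl A
Stable-queueSum (mE ∷ ms) A N x = StableSteps.stable-E A N (queueSum ms) x (Stable-queueSum ms A N x)
Stable-queueSum (mN ∷ ms) A N x = StableSteps.stable-N A N (queueSum ms) x (Stable-queueSum ms A N x)
Stable-queueSum (mC ∷ ms) A N x = StableSteps.stable-C A N (queueSum ms) x (Stable-queueSum ms A N x)

module Products (A : Alg) where
  open Points A

  prodX : ℕ → Pt → Carrier
  prodX zero x = 1#
  prodX (suc s) x = x 0 * prodX s (λ i → x (suc i))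

  prodX-last : ∀ s x → prodX (suc s) x ≋ prodX s x * x s
  prodX-last zero x = *-comm _ _
  prodX-last (suc s) x = ≋-trans (*-congˡ (prodX-last s (λ i → x (suc i)))) (≋-sym (*-assoc _ _ _))

  prodX-cong : ∀ s {x y} → (∀ i → i < s → x i ≋ y i) → prodX s x ≋ prodX s y
  prodX-cong zero e = ≋-refl
  prodX-cong (suc s) e = *-cong (e 0 (s≤s z≤n)) (prodX-cong s (λ i i<s → e (suc i) (s≤s i<s)))

  prodX-σ : ∀ k s x → suc k < s → prodX s (λ i → x (σ k i)) ≋ prodX s x
  prodX-σ zero (suc (suc s)) x _ = solve 3 (λ a b c → b :* (a :* c) := a :* (b :* c)) ≋-refl _ _ _
  prodX-σ zero (suc zero) x (s≤s ())
  prodX-σ (suc k) (suc s) x (s≤s p) = *-congˡ (prodX-σ k s (λ i → x (suc i)) p)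

  prodX-Sw : ∀ {k x x'} s → suc k < s → Sw k x x' → prodX s x ≋ prodX s x'
  prodX-Sw {k} {x} s p (sw w) = ≋-sym (≋-trans (prodX-cong s (λ i _ → w i)) (prodX-σ k s x p))

  prodX-Sw≥ : ∀ {k x x'} s → s ≤ k → Sw k x x' → prodX s x ≋ prodX s x'
  prodX-Sw≥ s p w = prodX-cong s (λ i i<s → let q = ℕₚ.<-≤-trans i<s p in
    ≋-sym (Sw-other w i (ℕₚ.<⇒≢ q) (ℕₚ.<⇒≢ (ℕₚ.m≤n⇒m≤1+n q))))

-- The product of the first S variables is the weight of the letters already in the queue, which
-- were pushed before the remaining moves begin.
weighted : ℕ → QFun → List ℕ → Fun
weighted S φ cs A N x = let open Points A in Products.prodX A S x * φ A N x cs

infix 4 _≐[_]_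
-- Equality at regular points only, since the relation for T determines its result only there.
_≐[_]_ : Fun → ℕ → Fun → Set₁
F ≐[ S ] G = ∀ A N x → S ≤ N → Points.Reg A N x → let open Points A in F A N x ≋ G A N x

module _ (φ : QFun) (inv : InvQ φ) where

  -- The product of the first S variables is symmetric under the exchange because k + 1 < S, so it
  -- passes through T; the queue values satisfy the same relation by `single`, and regularity
  -- identifies the results.
  gap-unique : ∀ S k n {F G : Fun} → suc k < S → F ≐[ S ] weighted S φ (gap (suc k) n) →
    (∀ A N → S ≤ N → Points.IsT A N k (F A N) (G A N)) → G ≐[ S ] weighted S φ (gap k (suc n))
  gap-unique S k n {F} {G} k<S e h A N x S≤N reg = Tr-uniq (Reg-k k<N reg) (h A N S≤N x x' reg w)
    (Tr-resp (≋-sym (e A N x S≤N reg)) (≋-trans (*-congʳ (prodX-Sw S k<S w)) (≋-sym (e A N x' S≤N (Reg-Sw k<N w reg)))) ≋-refl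
      (Tr-* (prodX S x) (Queue.Steps.Inv.single (inv A N) k<N reg w (gap-Single k n))))
    where
    open Points A
    open Products A
    k<N : suc k < N
    k<N = ℕₚ.<-≤-trans k<S S≤N
    x' : Pt
    x' i = x (σ k i)
    w : Sw k x x'
    w = sw λ i → ≋-refl

  EvP-Tchain : ∀ {S} k n {g : Poly S} {F} → k < S → EvP g F → F ≐[ S ] weighted S φ (gap k n) →
    Σ Fun λ G → EvP (Tchain k g) G × G ≐[ S ] weighted S φ (gap 0 (k ℕ.+ n))
  EvP-Tchain zero n p h e = _ , h , e
  EvP-Tchain {S} (suc k) n {g} {F} p h e =
    let G , hG , tG = EvP-T k p h
        G' , hG' , eG' = EvP-Tchain k (suc n) (ℕₚ.<-trans (ℕₚ.n<1+n k) p) hG (gap-unique S k n {F} {G} p e tG)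
    in G' , hG' , subst (λ z → G' ≐[ S ] weighted S φ (gap 0 z)) (ℕₚ.+-suc k n) eG'

  EvP-md₊ : ∀ {s} {f : Poly s} {F} → EvP f F → F ≐[ s ] weighted s φ (range 0 s) →
    Σ Fun λ G → EvP (md₊ f) G × G ≐[ suc s ] weighted (suc s) (stepQ mE φ) (range 0 (suc s))
  EvP-md₊ {s} {f} {F} h e =
    let G , hG , eG = EvP-Tchain s 0 ℕₚ.≤-refl (EvP-mulx h) start
    -- The sign inside `d₊` and the one added by `md₊` cancel.
    in _ , EvP-neg (EvP-neg hG) , λ A N x p reg → let open Points A in
      ≋-trans (-‿involutive _) (≋-trans (eG A N x p reg) (*-congˡ (≋-reflexive (cong (λ z → φ A N x (range 1 z)) (ℕₚ.+-identityʳ s)))))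
    where
    start : (λ A N x → let open Points A in x s * F A N x) ≐[ suc s ] weighted (suc s) φ (gap s 0)
    start A N x p reg = ≋-trans (*-congˡ (e A N x (ℕₚ.<⇒≤ p) reg))
      (≋-trans (≋-sym (*-assoc _ _ _)) (*-cong (≋-trans (*-comm _ _) (≋-sym (prodX-last s x)))
        (≋-reflexive (cong (φ A N x) (sym (Lₚ.++-identityʳ _))))))
      where
      open Points A
      open Products A

module PushChain (A : Alg) (N s : ℕ) (φ : Points.Pt A → List ℕ → Alg.Carrier A) where
  open Points A
  open Products A
  open Queue A
  open Steps N

  pushed : ℕ → Pt → Carrier
  pushed n x = x (s ℕ.+ n) * φ x (range 0 s ▷ (s ℕ.+ n))

  -- Repeated use of T x_k = (1 - t) x_k + x_{k+1} T: each operator leaves (1 - t) `pushed n` behind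
  -- and hands a single term on to the next colour. Setting the last variable to 0 removes that
  -- travelling term.
  partial : ℕ → Pt → Carrier
  partial n x = prodX s x * ((1# - t) * ∑ n (λ i → pushed i x) + pushed n x)

  push-chain : Inv φ → ∀ len → s ℕ.+ len < N → Chain A N s len (λ x → prodX (suc s) x * φ x (range 0 (suc s))) (partial len)
  push-chain inv len p = record
    { stage = partial
    ; first = λ x → ≋-trans (*-congˡ (≋-trans (≋-trans (+-congʳ (zeroʳ _)) (+-identityˡ _))
          (*-cong (≋-reflexive (cong x (ℕₚ.+-identityʳ s)))
            (≋-reflexive (cong (φ x) (trans (cong (range 0 s ▷_) (ℕₚ.+-identityʳ s)) (sym (range-▷ 0 s))))))))
        (≋-trans (≋-sym (*-assoc _ _ _)) (*-congʳ (≋-sym (prodX-last s x))))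
    ; step = stp
    ; last = λ x → ≋-refl }
    where
    stp : ∀ n → n < len → IsT N (s ℕ.+ n) (partial n) (partial (suc n))
    stp n n<len x x' reg w = Tr-resp ≋-refl (*-congʳ (prodX-Sw≥ s (ℕₚ.m≤m+n s n) w)) ≋-refl
      (Tr-* (prodX s x) (Tr-resp ≋-refl ≋-refl regroup
        -- The summands left behind involve neither colour k nor k + 1 in their queues, hence are
        -- symmetric and fixed by the later operators.
        (Tr-+ (Tr-sym (*-congˡ (∑-cong n sym-term)))
          (Tr-resp ≋-refl (*-congʳ (≋-sym (Sw-k w))) ≋-refl
            (Tr-push₃ (Inv.single inv k<N reg w (Free-Single (Free-range< k 0 s (ℕₚ.m≤m+n s n)))))))))
      where
      k = s ℕ.+ n
      k<N : suc k < N
      k<N = ℕₚ.≤-<-trans (ℕₚ.≤-trans (ℕₚ.≤-reflexive (sym (ℕₚ.+-suc s n))) (ℕₚ.+-monoʳ-≤ s n<len)) p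
      sym-term : ∀ i → i < n → pushed i x ≋ pushed i x'
      sym-term i i<n = *-cong (≋-sym (Sw-other w (s ℕ.+ i) (ℕₚ.<⇒≢ q) (ℕₚ.<⇒≢ (ℕₚ.m≤n⇒m≤1+n q))))
        (Inv.free inv k<N reg w (Free-▷ (Free-range< k 0 s (ℕₚ.m≤m+n s n)) (ℕₚ.<⇒≢ q , ℕₚ.<⇒≢ (ℕₚ.m≤n⇒m≤1+n q))))
        where
        q : s ℕ.+ i < k
        q = ℕₚ.+-monoʳ-< s i<n
      regroup : (1# - t) * ∑ n (λ i → pushed i x) + ((1# - t) * pushed n x + x (suc k) * φ x (range 0 s ▷ suc k))
        ≋ (1# - t) * ∑ (suc n) (λ i → pushed i x) + pushed (suc n) x
      regroup = ≋-trans (≋-sym (+-assoc _ _ _)) (+-cong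
        (≋-trans (≋-sym (distribˡ _ _ _)) (*-congˡ (≋-sym (∑-last n (λ i → pushed i x)))))
        (≋-reflexive (cong (λ z → x z * φ x (range 0 s ▷ z)) (sym (ℕₚ.+-suc s n)))))

  eqw-range< : ∀ a n v → a ≤ v → v < a ℕ.+ n → eqw (range a n) v ≋ t
  eqw-range> : ∀ a n v → v < a → eqw (range a n) v ≋ 1#
  eqw-range≥ : ∀ a n v → a ℕ.+ n ≤ v → eqw (range a n) v ≋ 1#
  eqw-range< a zero v p q = ⊥-elim (ℕₚ.<⇒≱ q (ℕₚ.≤-trans (ℕₚ.≤-reflexive (ℕₚ.+-identityʳ a)) p))
  eqw-range< a (suc n) v p q with v ℕ.≟ a
  ... | yes refl = ≋-trans (*-congˡ (eqw-range> (suc a) n v ℕₚ.≤-refl)) (*-identityʳ _)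
  ... | no v≢a = ≋-trans (*-identityˡ _) (eqw-range< (suc a) n v (ℕₚ.≤∧≢⇒< p (λ e → v≢a (sym e)))
      (ℕₚ.<-≤-trans q (ℕₚ.≤-reflexive (ℕₚ.+-suc a n))))
  eqw-range> a zero v p = ≋-refl
  eqw-range> a (suc n) v p = ≋-trans (*-cong (≋-reflexive (tif-no (v ℕ.≟ a) (ℕₚ.<⇒≢ p))) (eqw-range> (suc a) n v (ℕₚ.m≤n⇒m≤1+n p))) (*-identityˡ _)
  eqw-range≥ a zero v p = ≋-refl
  eqw-range≥ a (suc n) v p = ≋-trans (*-cong (≋-reflexive (tif-no (v ℕ.≟ a) (λ e → ℕₚ.<⇒≢ (ℕₚ.<-≤-trans (ℕₚ.m<m+n a (s≤s z≤n)) p) (sym e))))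
    (eqw-range≥ (suc a) n v (ℕₚ.≤-trans (ℕₚ.≤-reflexive (sym (ℕₚ.+-suc a n))) p))) (*-identityˡ _)

  gtw-range≥ : ∀ a n v → a ℕ.+ n ≤ suc v → gtw (range a n) v ≋ 1#
  gtw-range≥ a zero v p = ≋-refl
  gtw-range≥ a (suc n) v p = ≋-trans (*-cong (≋-reflexive (tif-no (v ℕ.<? a)
      (λ q → ℕₚ.<⇒≱ (ℕₚ.<-≤-trans (ℕₚ.m<m+n a (s≤s z≤n)) p) q)))
    (gtw-range≥ (suc a) n v (ℕₚ.≤-trans (ℕₚ.≤-reflexive (sym (ℕₚ.+-suc a n))) p))) (*-identityˡ _)

  ∑-split : ∀ a n f → ∑ (a ℕ.+ n) f ≋ ∑ a f + ∑ n (λ i → f (a ℕ.+ i))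
  ∑-split zero n f = ≋-sym (+-identityˡ _)
  ∑-split (suc a) n f = ≋-trans (+-congˡ (∑-split a n (λ i → f (suc i)))) (≋-sym (+-assoc _ _ _))

  -- Colours below s occur once and have weight 0. The others exceed every entry, so both exponents
  -- of t vanish and the weight is 1 - t.
  stepN-range : ∀ x n → N ≡ s ℕ.+ n → stepN φ x (range 0 s) ≋ (1# - t) * ∑ n (λ i → pushed i x)
  stepN-range x n refl = begin
    stepN φ x (range 0 s)
      ≈⟨ ∑-split s n _ ⟩
    ∑ s term + ∑ n (λ i → term (s ℕ.+ i))
      ≈⟨ +-cong (∑-0 s (λ v v<s → ≋-trans (*-congˡ (≋-trans (*-congʳ (pushW-0 {range 0 s} {v} (eqw-range< 0 s v z≤n v<s))) (zeroˡ _))) (zeroʳ _)))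
          (∑-cong n (λ i _ → ≋-trans (*-congˡ (*-congʳ (≋-trans (*-cong (gtw-range≥ 0 s (s ℕ.+ i) (ℕₚ.m≤n⇒m≤1+n (ℕₚ.m≤m+n s i)))
              (+-congʳ (eqw-range≥ 0 s (s ℕ.+ i) (ℕₚ.m≤m+n s i)))) (*-identityˡ _))))
            (solve 3 (λ a b c → a :* (b :* c) := b :* (a :* c)) ≋-refl _ _ _))) ⟩
    0# + ∑ n (λ i → (1# - t) * pushed i x)
      ≈⟨ ≋-trans (+-identityˡ _) (∑-*ˡ n _ _) ⟩
    (1# - t) * ∑ n (λ i → pushed i x) ∎
    where
    open ≋-R
    term : ℕ → Carrier
    term v = x v * (pushW (range 0 s) v * φ x (range 0 s ▷ v))

module _ (φ : QFun) (inv : InvQ φ) (stable : Stable φ) where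

  private
    module At (A : Alg) (N s : ℕ) (s≤N : s ≤ N) (x : Points.Pt A) where
      open Points A
      open Products A
      open Extend A
      private
        module A' = Points A⟦z⟧
        module C = PushChain A⟦z⟧ (suc N) s (φ A⟦z⟧ (suc N))
        module D = PushChain A N s (φ A N)
      n = N ℕ.∸ s
      s+n≡N : s ℕ.+ n ≡ N
      s+n≡N = ℕₚ.m+[n∸m]≡n s≤N

      at0-prodX : ∀ s y → Products.prodX A⟦z⟧ s y 0 ≋ prodX s (at0 y)
      at0-prodX zero y = ≋-refl
      at0-prodX (suc s) y = *-congˡ (at0-prodX s (λ i → y (suc i)))

      partial-at0 : C.partial n (ext x N) 0 ≋ prodX s x * Queue.Steps.stepN A N (φ A N) x (range 0 s)
      partial-at0 = *-cong
        (≋-trans (at0-prodX s (ext x N)) (prodX-cong s (λ i i<s → ext-at0-< x N i (ℕₚ.<-≤-trans i<s s≤N))))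
        (≋-trans (+-cong (*-congˡ (≋-trans (at0-∑ n _) (∑-cong n (λ i i<n → *-cong
              (ext-at0-< x N (s ℕ.+ i) (ℕₚ.<-≤-trans (ℕₚ.+-monoʳ-< s i<n) (ℕₚ.≤-reflexive s+n≡N)))
              (stable A N x (range 0 s ▷ (s ℕ.+ i)))))))
            (≋-trans (*-congʳ (≋-trans (≋-reflexive (cong (at0 (ext x N)) s+n≡N)) (ext-at0-N x N))) (zeroˡ _)))
          (≋-trans (+-identityʳ _) (≋-sym (D.stepN-range x n (sym s+n≡N)))))

      -- Over A[[z]] the chain computing d₋ and the chain of `partial` start from the same function
      -- at regular points. Uniqueness identifies their ends at the lifted point, and the constant
      -- coefficient in z returns to A.
      d₋-at : ∀ {F G} → F ≐[ suc s ] weighted (suc s) φ (range 0 (suc s)) → IsD s F G → Reg N x →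
        G A N x ≋ weighted s (stepQ mN φ) (range 0 s) A N x
      d₋-at {F} e d reg =
        let g , ch , eq = d A N x s≤N
        in ≋-trans eq (≋-trans
          (Chain-unique p (λ y r → e A⟦z⟧ (suc N) y (s≤s s≤N) r) ch (C.push-chain (inv A⟦z⟧ (suc N)) n p) (ext x N) (ext-Reg reg) 0)
          partial-at0)
        where
        p : s ℕ.+ n < suc N
        p = s≤s (ℕₚ.≤-reflexive s+n≡N)

  EvP-d₋-step : ∀ {s} {f : Poly (suc s)} {F} → EvP f F → F ≐[ suc s ] weighted (suc s) φ (range 0 (suc s)) →
    Σ Fun λ G → EvP (d₋ f) G × G ≐[ s ] weighted s (stepQ mN φ) (range 0 s)
  EvP-d₋-step {s} {f} {F} h e =
    let G , hG , dG = EvP-d₋ h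
    in G , hG , λ A N x s≤N reg → At.d₋-at A N s s≤N x {F} {G} e dG reg

data Valid : List Move → ℕ → Set where
  [] : Valid [] 0
  mE : ∀ {ms s} → Valid ms s → Valid (mE ∷ ms) (suc s)
  mN : ∀ {ms s} → Valid ms (suc s) → Valid (mN ∷ ms) s
  mC : ∀ {ms s} → Valid ms (suc s) → Valid (mC ∷ ms) (suc s)

HasValue : List Move → ℕ → State → Set₁
HasValue ms s st = Σ (proj₁ st ≡ s) λ _ → Σ Fun λ F →
  EvP (proj₂ st) F × F ≐[ proj₁ st ] weighted (proj₁ st) (queueSum ms) (range 0 (proj₁ st))

foldr-value : ∀ {ms s} → Valid ms s → HasValue ms s (foldr applyMove (0 , (1K , V.[] , []) ∷ []) ms)
foldr-value [] = refl , _ , Ev-single VAL-1 , λ A N x _ _ → let open Points A in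
  ≋-trans (*-cong ι-1 (*-identityˡ _)) (≋-refl)
foldr-value (mE {ms} v) with foldr applyMove (0 , (1K , V.[] , []) ∷ []) ms | foldr-value v
... | (s , f) | refl , F , hF , eF = refl , EvP-md₊ (queueSum ms) (InvQ-queueSum ms) hF eF
foldr-value (mN {ms} v) with foldr applyMove (0 , (1K , V.[] , []) ∷ []) ms | foldr-value v
... | (suc s , f) | refl , F , hF , eF = refl , EvP-d₋-step (queueSum ms) (InvQ-queueSum ms) (Stable-queueSum ms) hF eF
foldr-value (mC {ms} v) with foldr applyMove (0 , (1K , V.[] , []) ∷ []) ms | foldr-value v
... | (suc s , f) | refl , F , hF , eF =
  let φ = queueSum ms
      inv = InvQ-queueSum ms
      st = Stable-queueSum ms
      G₁ , hG₁ , eG₁ = EvP-md₊ φ inv hF eF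
      G₂ , hG₂ , eG₂ = EvP-d₋-step (stepQ mE φ) (λ A N → Queue.Steps.Inv-E A N (inv A N))
                         (λ A N x → StableSteps.stable-E A N φ x (st A N x)) hG₁ eG₁
      G₃ , hG₃ , eG₃ = EvP-d₋-step φ inv st hF eF
      G₄ , hG₄ , eG₄ = EvP-md₊ (stepQ mN φ) (λ A N → Queue.Steps.Inv-N A N (inv A N)) hG₃ eG₃
  in refl , _ , EvP-scale VAL-inv-t-1 (Ev-++ hG₂ (EvP-neg hG₄)) , λ A N x p reg → let open Points A in
    ≋-trans (*-congˡ (+-cong (eG₂ A N x p reg) (-‿cong (eG₄ A N x p reg))))
      (solve 4 (λ c p a b → c :* (p :* a :- p :* b) := p :* (c :* (a :- b))) ≋-refl
        (ι 1/t-1) (Products.prodX A (suc s) x) (stepQ mN (stepQ mE φ) A N x (range 0 (suc s))) (stepQ mE (stepQ mN φ) A N x (range 0 (suc s))))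

-- Words, their weights and the summation over signs.

⌊⌋-true : {P : Set} (d : Dec P) → P → ⌊ d ⌋ ≡ true
⌊⌋-true (yes _) _ = refl
⌊⌋-true (no ¬p) p = ⊥-elim (¬p p)

⌊⌋-false : {P : Set} (d : Dec P) → ¬ P → ⌊ d ⌋ ≡ false
⌊⌋-false (yes p) ¬p = ⊥-elim (¬p p)
⌊⌋-false (no _) _ = refl

rowInc-< : ∀ a b → rank a < rank b → rowInc a b ≡ true
rowInc-< a b p rewrite ⌊⌋-true (rank a ℕ.<? rank b) p = refl

rowInc-> : ∀ a b → rank b < rank a → rowInc a b ≡ false
rowInc-> a b p rewrite ⌊⌋-false (rank a ℕ.<? rank b) (ℕₚ.<-asym p)
  | ⌊⌋-false (rank a ℕ.≟ rank b) (λ e → ℕₚ.<⇒≢ p (sym e)) = refl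

rowInc-same : ∀ v s → rowInc (v , s) (v , s) ≡ not s
rowInc-same v s rewrite ⌊⌋-false (rank (v , s) ℕ.<? rank (v , s)) (ℕₚ.<-irrefl refl)
  | ⌊⌋-true (rank (v , s) ℕ.≟ rank (v , s)) refl = refl

rank-< : ∀ {v c} s s' → v < c → rank (v , s) < rank (c , s')
rank-< {v} {c} s s' p = ℕₚ.≤-<-trans (lem s) (ℕₚ.<-≤-trans (ℕₚ.≤-reflexive (cong suc (sym (ℕₚ.+-suc v (v ℕ.+ 0)))))
    (ℕₚ.≤-trans (ℕₚ.*-monoʳ-≤ 2 p) (lem' s')))
  where
  lem : ∀ s → rank (v , s) ≤ suc (2 ℕ.* v)
  lem false = ℕₚ.n≤1+n _
  lem true = ℕₚ.≤-refl
  lem' : ∀ s → 2 ℕ.* c ≤ rank (c , s)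
  lem' false = ℕₚ.≤-refl
  lem' true = ℕₚ.n≤1+n _

-- For equal absolute values the comparison is decided by the sign of the first letter alone,
-- whatever the sign of the second. This is why the queue may forget the signs of its letters.
rowInc-pos : ∀ v c s → rowInc (v , false) (c , s) ≡ ⌊ v ℕ.≤? c ⌋
rowInc-pos v c s with ℕₚ.<-cmp v c
... | tri< p _ _ = trans (rowInc-< (v , false) (c , s) (rank-< false s p)) (sym (⌊⌋-true (v ℕ.≤? c) (ℕₚ.<⇒≤ p)))
... | tri> _ _ p = trans (rowInc-> (v , false) (c , s) (rank-< s false p)) (sym (⌊⌋-false (v ℕ.≤? c) (ℕₚ.<⇒≱ p)))
... | tri≈ _ refl _ = trans (lem s) (sym (⌊⌋-true (v ℕ.≤? v) ℕₚ.≤-refl))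
  where
  lem : ∀ s → rowInc (v , false) (v , s) ≡ true
  lem false = rowInc-same v false
  lem true = rowInc-< (v , false) (v , true) ℕₚ.≤-refl

rowInc-neg : ∀ v c s → rowInc (v , true) (c , s) ≡ ⌊ v ℕ.<? c ⌋
rowInc-neg v c s with ℕₚ.<-cmp v c
... | tri< p _ _ = trans (rowInc-< (v , true) (c , s) (rank-< true s p)) (sym (⌊⌋-true (v ℕ.<? c) p))
... | tri> _ _ p = trans (rowInc-> (v , true) (c , s) (rank-< s true p)) (sym (⌊⌋-false (v ℕ.<? c) (ℕₚ.<-asym p)))
... | tri≈ _ refl _ = trans (lem s) (sym (⌊⌋-false (v ℕ.<? v) (ℕₚ.<-irrefl refl)))
  where
  lem : ∀ s → rowInc (v , true) (v , s) ≡ false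
  lem true = rowInc-same v true
  lem false = rowInc-> (v , true) (v , false) ℕₚ.≤-refl

flag : Letter → ℕ → Bool
flag b j = ⌊ rank b ℕ.≤? rank (j , false) ⌋

flag-pos : ∀ v j → flag (v , false) j ≡ ⌊ v ℕ.≤? j ⌋
flag-pos v j with ℕₚ.<-cmp v j
... | tri< p _ _ = trans (⌊⌋-true (2 ℕ.* v ℕ.≤? 2 ℕ.* j) (ℕₚ.<⇒≤ (rank-< false false p))) (sym (⌊⌋-true (v ℕ.≤? j) (ℕₚ.<⇒≤ p)))
... | tri≈ _ refl _ = trans (⌊⌋-true (2 ℕ.* v ℕ.≤? 2 ℕ.* v) ℕₚ.≤-refl) (sym (⌊⌋-true (v ℕ.≤? v) ℕₚ.≤-refl))
... | tri> _ _ p = trans (⌊⌋-false (2 ℕ.* v ℕ.≤? 2 ℕ.* j) (ℕₚ.<⇒≱ (rank-< false false p))) (sym (⌊⌋-false (v ℕ.≤? j) (ℕₚ.<⇒≱ p)))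

flag-neg : ∀ v j → flag (v , true) j ≡ ⌊ v ℕ.<? j ⌋
flag-neg v j with ℕₚ.<-cmp v j
... | tri< p _ _ = trans (⌊⌋-true (suc (2 ℕ.* v) ℕ.≤? 2 ℕ.* j) (ℕₚ.<⇒≤ (rank-< true false p))) (sym (⌊⌋-true (v ℕ.<? j) p))
... | tri≈ _ refl _ = trans (⌊⌋-false (suc (2 ℕ.* v) ℕ.≤? 2 ℕ.* v) ℕₚ.1+n≰n) (sym (⌊⌋-false (v ℕ.<? v) (ℕₚ.<-irrefl refl)))
... | tri> _ _ p = trans (⌊⌋-false (suc (2 ℕ.* v) ℕ.≤? 2 ℕ.* j) (ℕₚ.<⇒≱ (rank-< false true p))) (sym (⌊⌋-false (v ℕ.<? j) (ℕₚ.<-asym p)))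

pushes : List Move → ℕ
pushes [] = 0
pushes (mE ∷ ms) = pushes ms
pushes (mN ∷ ms) = suc (pushes ms)
pushes (mC ∷ ms) = suc (pushes ms)

module Words (A : Alg) (N : ℕ) (x : Points.Pt A) where
  open Points A
  open Queue A
  open Products A

  ind : Bool → Carrier
  ind true = 1#
  ind false = 0#

  tifB : Bool → Carrier
  tifB true = t
  tifB false = 1#

  sgn : Bool → Carrier
  sgn false = 1#
  sgn true = - t

  lw : Letter → Carrier
  lw (v , s) = sgn s * x v

  rcw : Letter → List Letter → Carrier
  rcw b [] = 1#
  rcw b (c ∷ cs) = tifB (rowInc b c) * rcw b cs

  -- At a marked corner the popped letter `c` constrains the pushed one, but the corner box lies
  -- above the path and is no inversion, so `rcw` runs over the remaining queue only. Words that are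
  -- too short weigh 0.
  ωM : List Move → List Letter → List Letter → Carrier
  ωM [] cs w = 1#
  ωM (mN ∷ ms) cs (b ∷ w) = lw b * (rcw b cs * ωM ms (cs ▷ b) w)
  ωM (mN ∷ ms) cs [] = 0#
  ωM (mE ∷ ms) [] w = ωM ms [] w
  ωM (mE ∷ ms) (c ∷ cs) w = ωM ms cs w
  ωM (mC ∷ ms) (c ∷ cs) (b ∷ w) = ind (rowInc b c) * (lw b * (rcw b cs * ωM ms (cs ▷ b) w))
  ωM (mC ∷ ms) _ _ = 0#

  -- During the initial north steps nothing is popped, so the length of the queue is the zero-based
  -- position of the letter being read, which is what the flag compares with.
  ωF : ℕ → List Letter → List Move → List Letter → Carrier
  ωF zero cs ms w = ωM ms cs w
  ωF (suc f) cs ms (b ∷ w) = ind (flag b (length cs)) * (lw b * (rcw b cs * ωF f (cs ▷ b) ms w))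
  ωF (suc f) cs ms [] = 0#

  colours : List Letter → List ℕ
  colours = map proj₁

  colours-▷ : ∀ cs b → colours (cs ▷ b) ≡ colours cs ▷ proj₁ b
  colours-▷ cs b = Lₚ.map-++ proj₁ cs (b ∷ [])

  tifB-dec : {P : Set} (d : Dec P) → tifB ⌊ d ⌋ ≡ tif d
  tifB-dec (yes _) = refl
  tifB-dec (no _) = refl

  rcw-neg : ∀ v cs → rcw (v , true) cs ≋ gtw (colours cs) v
  rcw-neg v [] = ≋-refl
  rcw-neg v ((c , s) ∷ cs) = *-cong (≋-reflexive (trans (cong tifB (rowInc-neg v c s)) (tifB-dec (v ℕ.<? c)))) (rcw-neg v cs)

  rcw-pos : ∀ v cs → rcw (v , false) cs ≋ gtw (colours cs) v * eqw (colours cs) v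
  rcw-pos v [] = ≋-sym (*-identityˡ _)
  rcw-pos v ((c , s) ∷ cs) = ≋-trans (*-cong (lem (ℕₚ.<-cmp v c)) (rcw-pos v cs))
    (solve 4 (λ a b c d → (a :* b) :* (c :* d) := (a :* c) :* (b :* d)) ≋-refl _ _ _ _)
    where
    lem : Tri (v < c) (v ≡ c) (c < v) → tifB (rowInc (v , false) (c , s)) ≋ tif (v ℕ.<? c) * tif (v ℕ.≟ c)
    lem tri rewrite rowInc-pos v c s with tri
    ... | tri< p q _ rewrite ⌊⌋-true (v ℕ.≤? c) (ℕₚ.<⇒≤ p) | tif-yes (v ℕ.<? c) p | tif-no (v ℕ.≟ c) q = ≋-sym (*-identityʳ _)
    ... | tri≈ p refl _ rewrite ⌊⌋-true (v ℕ.≤? v) ℕₚ.≤-refl | tif-no (v ℕ.<? v) p | tif-yes (v ℕ.≟ v) refl = ≋-sym (*-identityˡ _)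
    ... | tri> p q r rewrite ⌊⌋-false (v ℕ.≤? c) (ℕₚ.<⇒≱ r) | tif-no (v ℕ.<? c) p | tif-no (v ℕ.≟ c) q = ≋-sym (*-identityˡ _)

  ∑-words : ∀ n (f : List Letter → Carrier) →
    ∑L (words (suc n) N) f ≋ ∑ N (λ v → ∑L (words n N) (λ w → f ((v , false) ∷ w)) + ∑L (words n N) (λ w → f ((v , true) ∷ w)))
  ∑-words n f = begin
    ∑L (words (suc n) N) f
      ≈⟨ ∑L-concatMap _ f (lettersUpTo N) ⟩
    ∑L (lettersUpTo N) (λ a → ∑L (map (a ∷_) (words n N)) f)
      ≈⟨ ∑L-cong (lettersUpTo N) (λ a → ∑L-map (a ∷_) f (words n N)) ⟩
    ∑L (lettersUpTo N) g
      ≈⟨ ∑L-concatMap _ g (upTo N) ⟩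
    ∑L (upTo N) (λ v → g (v , false) + (g (v , true) + 0#))
      ≈⟨ ∑L-applyUpTo N (λ i → i) _ ⟩
    ∑ N (λ v → g (v , false) + (g (v , true) + 0#))
      ≈⟨ ∑-cong N (λ v _ → +-congˡ (+-identityʳ _)) ⟩
    ∑ N (λ v → g (v , false) + g (v , true)) ∎
    where
    open ≋-R
    g : Letter → Carrier
    g a = ∑L (words n N) (λ w → f (a ∷ w))

  ∑L-factor : {X : Set} (L : List X) (a b : Carrier) {f : X → Carrier} {z : Carrier} → ∑L L f ≋ z → ∑L L (λ w → a * (b * f w)) ≋ a * (b * z)
  ∑L-factor L a b {f} h = ≋-trans (∑L-*ˡ L a _) (*-congˡ (≋-trans (∑L-*ˡ L b f) (*-congˡ h)))

  -- Pushing before or after the pop changes the weight by a factor t or 1 according to β; dividing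
  -- the difference by t - 1 leaves the condition imposed by the mark.
  ind-split : ∀ β → ι 1/t-1 * (tifB β - 1#) ≋ ind β
  ind-split true = ι-1/t-1
  ind-split false = ≋-trans (*-congˡ (-‿inverseʳ _)) (zeroʳ _)

  sum-ωM : ∀ ms cs → Valid ms (length cs) → ∑L (words (pushes ms) N) (ωM ms cs) ≋ queueSum ms A N x (colours cs)
  sum-ωM [] cs v = +-identityʳ _
  sum-ωM (mE ∷ ms) (c ∷ cs) (mE v) = sum-ωM ms cs v
  sum-ωM (mN ∷ ms) cs (mN vd) = ≋-trans (∑-words (pushes ms) (ωM (mN ∷ ms) cs)) (∑-cong N (λ v _ → begin
      ∑L (words (pushes ms) N) (λ w → lw (v , false) * (rcw (v , false) cs * ωM ms (cs ▷ (v , false)) w))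
        + ∑L (words (pushes ms) N) (λ w → lw (v , true) * (rcw (v , true) cs * ωM ms (cs ▷ (v , true)) w))
        ≈⟨ +-cong (∑L-factor (words (pushes ms) N) _ _ (ih (v , false))) (∑L-factor (words (pushes ms) N) _ _ (ih (v , true))) ⟩
      (1# * x v) * (rcw (v , false) cs * φ v) + (- t * x v) * (rcw (v , true) cs * φ v)
        ≈⟨ +-cong (*-congˡ (*-congʳ (rcw-pos v cs))) (*-congˡ (*-congʳ (rcw-neg v cs))) ⟩
      (1# * x v) * ((gtw (colours cs) v * eqw (colours cs) v) * φ v) + (- t * x v) * (gtw (colours cs) v * φ v)
        ≈⟨ solve 5 (λ x g e t f → (:1 :* x) :* ((g :* e) :* f) :+ ((:- t) :* x) :* (g :* f) := x :* ((g :* (e :- t)) :* f)) ≋-refl _ _ _ t _ ⟩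
      x v * (pushW (colours cs) v * φ v) ∎))
    where
    open ≋-R
    φ : ℕ → Carrier
    φ v = queueSum ms A N x (colours cs ▷ v)
    ih : ∀ b → ∑L (words (pushes ms) N) (ωM ms (cs ▷ b)) ≋ φ (proj₁ b)
    ih b = ≋-trans (sum-ωM ms (cs ▷ b) (subst (Valid ms) (sym (trans (Lₚ.length-++ cs) (ℕₚ.+-comm _ 1))) vd))
      (≋-reflexive (cong (queueSum ms A N x) (colours-▷ cs b)))
  sum-ωM (mC ∷ ms) (c ∷ cs) (mC vd) = ≋-trans (∑-words (pushes ms) (ωM (mC ∷ ms) (c ∷ cs)))
    (≋-trans (∑-cong N (λ v _ → per-colour v)) (≋-trans (∑-*ˡ N (ι 1/t-1) _) (*-congˡ (≋-trans (∑-+ N _ _) (+-congˡ (neg-∑ N _))))))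
    where
    open ≋-R
    neg-∑ : ∀ n f → ∑ n (λ i → - f i) ≋ - ∑ n f
    neg-∑ n f = ≋-trans (∑-cong n (λ i _ → solve 1 (λ a → :- a := (:- :1) :* a) ≋-refl (f i)))
      (≋-trans (∑-*ˡ n (- 1#) f) (solve 1 (λ a → (:- :1) :* a := :- a) ≋-refl _))
    φ : ℕ → Carrier
    φ v = queueSum ms A N x (colours cs ▷ v)
    ih : ∀ b → ∑L (words (pushes ms) N) (ωM ms (cs ▷ b)) ≋ φ (proj₁ b)
    ih b = ≋-trans (sum-ωM ms (cs ▷ b) (subst (Valid ms) (sym (trans (Lₚ.length-++ cs) (ℕₚ.+-comm _ 1))) vd))
      (≋-reflexive (cong (queueSum ms A N x) (colours-▷ cs b)))
    signed : ∀ v ds → x v * (pushW (colours ds) v * φ v) ≋ x v * ((rcw (v , false) ds - t * rcw (v , true) ds) * φ v)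
    signed v ds = *-congˡ (*-congʳ (≋-trans (solve 3 (λ g e t → g :* (e :- t) := g :* e :- t :* g) ≋-refl _ _ t)
      (+-cong (≋-sym (rcw-pos v ds)) (-‿cong (*-congˡ (≋-sym (rcw-neg v ds)))))))
    per-colour : ∀ v →
      ∑L (words (pushes ms) N) (λ w → ind (rowInc (v , false) c) * (lw (v , false) * (rcw (v , false) cs * ωM ms (cs ▷ (v , false)) w)))
        + ∑L (words (pushes ms) N) (λ w → ind (rowInc (v , true) c) * (lw (v , true) * (rcw (v , true) cs * ωM ms (cs ▷ (v , true)) w)))
      ≋ ι 1/t-1 * (x v * (pushW (colours (c ∷ cs)) v * φ v) - x v * (pushW (colours cs) v * φ v))
    per-colour v = begin
      _ ≈⟨ +-cong (≋-trans (∑L-*ˡ (words (pushes ms) N) _ _) (*-congˡ (∑L-factor (words (pushes ms) N) _ _ (ih (v , false)))))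
                  (≋-trans (∑L-*ˡ (words (pushes ms) N) _ _) (*-congˡ (∑L-factor (words (pushes ms) N) _ _ (ih (v , true))))) ⟩
      ind β₊ * ((1# * x v) * (r₊ * φ v)) + ind β₋ * ((- t * x v) * (r₋ * φ v))
        ≈⟨ +-cong (*-congʳ (ind-split β₊)) (*-congʳ (ind-split β₋)) ⟨
      (ι 1/t-1 * (tifB β₊ - 1#)) * ((1# * x v) * (r₊ * φ v)) + (ι 1/t-1 * (tifB β₋ - 1#)) * ((- t * x v) * (r₋ * φ v))
        ≈⟨ solve 8 (λ i T₊ T₋ x r₊ r₋ f t → (i :* (T₊ :- :1)) :* ((:1 :* x) :* (r₊ :* f)) :+ (i :* (T₋ :- :1)) :* (((:- t) :* x) :* (r₋ :* f))
             := i :* (x :* ((T₊ :* r₊ :- t :* (T₋ :* r₋)) :* f) :- x :* ((r₊ :- t :* r₋) :* f))) ≋-refl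
             (ι 1/t-1) (tifB β₊) (tifB β₋) (x v) r₊ r₋ (φ v) t ⟩
      ι 1/t-1 * (x v * ((tifB β₊ * r₊ - t * (tifB β₋ * r₋)) * φ v) - x v * ((r₊ - t * r₋) * φ v))
        ≈⟨ *-congˡ (+-cong (signed v (c ∷ cs)) (-‿cong (signed v cs))) ⟨
      ι 1/t-1 * (x v * (pushW (colours (c ∷ cs)) v * φ v) - x v * (pushW (colours cs) v * φ v)) ∎
      where
      β₊ = rowInc (v , false) c
      β₋ = rowInc (v , true) c
      r₊ = rcw (v , false) cs
      r₋ = rcw (v , true) cs

  flagSum : ℕ → List Move → List ℕ → Carrier
  flagSum zero ms cs = queueSum ms A N x cs
  flagSum (suc f) ms cs = ∑ N (λ v → x v * ((ind ⌊ v ℕ.≤? length cs ⌋ * (gtw cs v * eqw cs v) - ind ⌊ v ℕ.<? length cs ⌋ * (t * gtw cs v))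
    * flagSum f ms (cs ▷ v)))

  sum-ωF : ∀ f ms cs → Valid ms (f ℕ.+ length cs) → ∑L (words (f ℕ.+ pushes ms) N) (ωF f cs ms) ≋ flagSum f ms (colours cs)
  sum-ωF zero ms cs v = sum-ωM ms cs v
  sum-ωF (suc f) ms cs vd = ≋-trans (∑-words (f ℕ.+ pushes ms) (ωF (suc f) cs ms)) (∑-cong N (λ v _ → begin
      ∑L W (λ w → ind (flag (v , false) (length cs)) * (lw (v , false) * (rcw (v , false) cs * ωF f (cs ▷ (v , false)) ms w)))
        + ∑L W (λ w → ind (flag (v , true) (length cs)) * (lw (v , true) * (rcw (v , true) cs * ωF f (cs ▷ (v , true)) ms w)))
        ≈⟨ +-cong (≋-trans (∑L-*ˡ W _ _) (*-congˡ (∑L-factor W _ _ (ih (v , false)))))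
                  (≋-trans (∑L-*ˡ W _ _) (*-congˡ (∑L-factor W _ _ (ih (v , true))))) ⟩
      ind (flag (v , false) (length cs)) * ((1# * x v) * (rcw (v , false) cs * φ v)) + ind (flag (v , true) (length cs)) * ((- t * x v) * (rcw (v , true) cs * φ v))
        ≈⟨ +-cong (*-cong (≋-reflexive (cong ind (flag-pos v (length cs)))) (*-congˡ (*-congʳ (rcw-pos v cs))))
                  (*-cong (≋-reflexive (cong ind (flag-neg v (length cs)))) (*-congˡ (*-congʳ (rcw-neg v cs)))) ⟩
      ind ⌊ v ℕ.≤? length cs ⌋ * ((1# * x v) * ((gtw (colours cs) v * eqw (colours cs) v) * φ v)) + ind ⌊ v ℕ.<? length cs ⌋ * ((- t * x v) * (gtw (colours cs) v * φ v))
        ≈⟨ solve 7 (λ i j x g e t f → i :* ((:1 :* x) :* ((g :* e) :* f)) :+ j :* (((:- t) :* x) :* (g :* f)) := x :* ((i :* (g :* e) :- j :* (t :* g)) :* f)) ≋-refl _ _ _ _ _ t _ ⟩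
      x v * ((ind ⌊ v ℕ.≤? length cs ⌋ * (gtw (colours cs) v * eqw (colours cs) v) - ind ⌊ v ℕ.<? length cs ⌋ * (t * gtw (colours cs) v)) * φ v)
        ≡⟨ cong (λ l → x v * ((ind ⌊ v ℕ.≤? l ⌋ * (gtw (colours cs) v * eqw (colours cs) v) - ind ⌊ v ℕ.<? l ⌋ * (t * gtw (colours cs) v)) * φ v)) (sym (Lₚ.length-map proj₁ cs)) ⟩
      x v * ((ind ⌊ v ℕ.≤? length (colours cs) ⌋ * (gtw (colours cs) v * eqw (colours cs) v) - ind ⌊ v ℕ.<? length (colours cs) ⌋ * (t * gtw (colours cs) v)) * φ v) ∎))
    where
    open ≋-R
    W = words (f ℕ.+ pushes ms) N
    φ : ℕ → Carrier
    φ v = flagSum f ms (colours cs ▷ v)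
    ih : ∀ b → ∑L W (ωF f (cs ▷ b) ms) ≋ φ (proj₁ b)
    ih b = ≋-trans (sum-ωF f ms (cs ▷ b) (subst (Valid ms)
        (sym (trans (cong (f ℕ.+_) (trans (Lₚ.length-++ cs) (ℕₚ.+-comm _ 1))) (ℕₚ.+-suc f (length cs)))) vd))
      (≋-reflexive (cong (flagSum f ms) (colours-▷ cs b)))

  length-range : ∀ a n → length (range a n) ≡ n
  length-range a zero = refl
  length-range a (suc n) = cong suc (length-range (suc a) n)

  ∑-delta : ∀ n j f → j < n → (∀ v → v ≢ j → f v ≋ 0#) → ∑ n f ≋ f j
  ∑-delta (suc n) zero f _ h = ≋-trans (+-congˡ (∑-0 n (λ i _ → h (suc i) (λ ())))) (+-identityʳ _)
  ∑-delta (suc n) (suc j) f (s≤s p) h = ≋-trans (+-cong (h 0 (λ ())) (∑-delta n j (λ i → f (suc i)) p (λ v q → h (suc v) (λ e → q (ℕₚ.suc-injective e)))))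
    (+-identityˡ _)

  module _ (f : ℕ) (ms : List Move) (j : ℕ) where
    private
      module PC = PushChain A N j (queueSum [] A N)
      cs = range 0 j
      lj = length-range 0 j

      term : ℕ → Carrier
      term v = x v * ((ind ⌊ v ℕ.≤? length cs ⌋ * (gtw cs v * eqw cs v) - ind ⌊ v ℕ.<? length cs ⌋ * (t * gtw cs v)) * flagSum f ms (cs ▷ v))

      -- A smaller colour is in the queue once and the flag admits both of its signs, whose
      -- contributions cancel; a larger colour is excluded by the flag in both signs.
      term-≢ : ∀ v → v ≢ j → term v ≋ 0#
      term-≢ v v≢j with ℕₚ.<-cmp v j
      ... | tri≈ _ e _ = ⊥-elim (v≢j e)
      ... | tri< p _ _ rewrite lj | ⌊⌋-true (v ℕ.≤? j) (ℕₚ.<⇒≤ p) | ⌊⌋-true (v ℕ.<? j) p =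
        ≋-trans (*-congˡ (≋-trans (*-congʳ (≋-trans (+-congʳ (*-congˡ (*-congˡ (PC.eqw-range< 0 j v z≤n p))))
          (solve 2 (λ g t → :1 :* (g :* t) :- :1 :* (t :* g) := con (0 , 0)) ≋-refl _ t))) (zeroˡ _))) (zeroʳ _)
      ... | tri> _ _ p rewrite lj | ⌊⌋-false (v ℕ.≤? j) (ℕₚ.<⇒≱ p) | ⌊⌋-false (v ℕ.<? j) (ℕₚ.<-asym p) =
        solve 5 (λ x g e t f → x :* ((con (0 , 0) :* (g :* e) :- con (0 , 0) :* (t :* g)) :* f) := con (0 , 0)) ≋-refl _ _ _ t _

      term-j : term j ≋ x j * flagSum f ms (range 0 (suc j))
      term-j rewrite lj | ⌊⌋-true (j ℕ.≤? j) ℕₚ.≤-refl | ⌊⌋-false (j ℕ.<? j) (ℕₚ.<-irrefl refl) =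
        *-congˡ (≋-trans (*-cong (≋-trans (+-cong (*-congˡ (*-cong (PC.gtw-range≥ 0 j j (ℕₚ.n≤1+n j)) (PC.eqw-range≥ 0 j j ℕₚ.≤-refl))) (-‿cong (zeroˡ _)))
            (solve 0 (:1 :* (:1 :* :1) :- con (0 , 0) := :1) ≋-refl)) (≋-reflexive (cong (flagSum f ms) (sym (range-▷ 0 j))))) (*-identityˡ _))

    flagSum-step : j < N → flagSum (suc f) ms (range 0 j) ≋ x j * flagSum f ms (range 0 (suc j))
    flagSum-step j<N = ≋-trans (∑-delta N j term j<N term-≢) term-j

    flagSum-stop : N ≤ j → flagSum (suc f) ms (range 0 j) ≋ 0#
    flagSum-stop N≤j = ∑-0 N (λ v v<N → term-≢ v (ℕₚ.<⇒≢ (ℕₚ.<-≤-trans v<N N≤j)))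

  flagSum-≤ : ∀ f ms j → f ℕ.+ j ≤ N → prodX j x * flagSum f ms (range 0 j) ≋ prodX (f ℕ.+ j) x * queueSum ms A N x (range 0 (f ℕ.+ j))
  flagSum-≤ zero ms j p = ≋-refl
  flagSum-≤ (suc f) ms j p = ≋-trans (*-congˡ (flagSum-step f ms j (ℕₚ.≤-trans (s≤s (ℕₚ.m≤n+m j f)) p)))
    (≋-trans (≋-sym (*-assoc _ _ _)) (≋-trans (*-congʳ (≋-sym (prodX-last j x)))
      (subst (λ z → prodX (suc j) x * flagSum f ms (range 0 (suc j)) ≋ prodX z x * queueSum ms A N x (range 0 z)) (ℕₚ.+-suc f j)
        (flagSum-≤ f ms (suc j) (subst (_≤ N) (sym (ℕₚ.+-suc f j)) p)))))

  -- The forced letters use up the N colours before all flagged positions are filled, and the next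
  -- position then has no contributing letter. This covers exponent lists shorter than r.
  flagSum-> : ∀ f ms j → j ≤ N → N < f ℕ.+ j → flagSum f ms (range 0 j) ≋ 0#
  flagSum-> zero ms j p q = ⊥-elim (ℕₚ.<⇒≱ q p)
  flagSum-> (suc f) ms j p q with j ℕ.<? N
  ... | yes j<N = ≋-trans (flagSum-step f ms j j<N) (≋-trans (*-congˡ (flagSum-> f ms (suc j) j<N (subst (N <_) (sym (ℕₚ.+-suc f j)) q))) (zeroʳ _))
  ... | no j≮N = flagSum-stop f ms j (ℕₚ.≮⇒≥ j≮N)

-- Counting inversions by columns and by pushes.

b2n : Bool → ℕ
b2n true = 1
b2n false = 0

cnt : {X : Set} → (X → Bool) → List X → ℕ
cnt P [] = 0
cnt P (x ∷ xs) = b2n (P x) ℕ.+ cnt P xs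

countB≡cnt : {X : Set} (P : X → Bool) (xs : List X) → countB P xs ≡ cnt P xs
countB≡cnt P [] = refl
countB≡cnt P (x ∷ xs) with P x
... | true = cong suc (countB≡cnt P xs)
... | false = countB≡cnt P xs

cnt-filter : {X : Set} {Q : X → Set} (P : X → Bool) (Q? : ∀ x → Dec (Q x)) (xs : List X) →
  cnt P (filter Q? xs) ≡ cnt (λ x → does (Q? x) ∧ P x) xs
cnt-filter P Q? [] = refl
cnt-filter P Q? (x ∷ xs) with does (Q? x)
... | true = cong (b2n (P x) ℕ.+_) (cnt-filter P Q? xs)
... | false = cnt-filter P Q? xs

cnt-++ : {X : Set} (P : X → Bool) (xs ys : List X) → cnt P (xs ++ ys) ≡ cnt P xs ℕ.+ cnt P ys
cnt-++ P [] ys = refl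
cnt-++ P (x ∷ xs) ys = trans (cong (b2n (P x) ℕ.+_) (cnt-++ P xs ys)) (sym (ℕₚ.+-assoc (b2n (P x)) _ _))

cnt-map : {X Y : Set} (P : Y → Bool) (φ : X → Y) (xs : List X) → cnt P (map φ xs) ≡ cnt (λ x → P (φ x)) xs
cnt-map P φ [] = refl
cnt-map P φ (x ∷ xs) = cong (b2n (P (φ x)) ℕ.+_) (cnt-map P φ xs)

cntN : ℕ → (ℕ → Bool) → ℕ
cntN zero P = 0
cntN (suc n) P = b2n (P 0) ℕ.+ cntN n (λ i → P (suc i))

sumN : ℕ → (ℕ → ℕ) → ℕ
sumN zero f = 0
sumN (suc n) f = f 0 ℕ.+ sumN n (λ i → f (suc i))

cnt-applyUpTo : ∀ n (g : ℕ → ℕ) (P : ℕ → Bool) → cnt P (applyUpTo g n) ≡ cntN n (λ i → P (g i))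
cnt-applyUpTo zero g P = refl
cnt-applyUpTo (suc n) g P = cong (b2n (P (g 0)) ℕ.+_) (cnt-applyUpTo n (λ i → g (suc i)) P)

cnt-concatMap-applyUpTo : {X : Set} (P : X → Bool) (φ : ℕ → List X) → ∀ n (g : ℕ → ℕ) →
  cnt P (concatMap φ (applyUpTo g n)) ≡ sumN n (λ i → cnt P (φ (g i)))
cnt-concatMap-applyUpTo P φ zero g = refl
cnt-concatMap-applyUpTo P φ (suc n) g = trans (cnt-++ P (φ (g 0)) _)
  (cong (cnt P (φ (g 0)) ℕ.+_) (cnt-concatMap-applyUpTo P φ n (λ i → g (suc i))))

cntN-cong : ∀ n {P Q : ℕ → Bool} → (∀ i → i < n → P i ≡ Q i) → cntN n P ≡ cntN n Q
cntN-cong zero e = refl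
cntN-cong (suc n) e = cong₂ (λ a b → b2n a ℕ.+ b) (e 0 (s≤s z≤n)) (cntN-cong n (λ i p → e (suc i) (s≤s p)))

cntN-false : ∀ n → cntN n (λ _ → false) ≡ 0
cntN-false zero = refl
cntN-false (suc n) = cntN-false n

sumN-cong : ∀ n {f g : ℕ → ℕ} → (∀ i → i < n → f i ≡ g i) → sumN n f ≡ sumN n g
sumN-cong zero e = refl
sumN-cong (suc n) e = cong₂ ℕ._+_ (e 0 (s≤s z≤n)) (sumN-cong n (λ i p → e (suc i) (s≤s p)))

areaInv : ℕ → (ℕ → ℕ) → List Letter → ℕ
areaInv d h W = sumN d (λ i → cntN d (λ j → does (i ℕ.<? j) ∧ (does (suc j ℕ.≤? h i) ∧ rowInc (at W (suc j)) (at W (suc i)))))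

inv≡areaInv : ∀ r d π W → inv r d π W ≡ areaInv d (λ i → height r π (suc i)) W
inv≡areaInv r d π W = trans (countB≡cnt _ (areaList r d π)) (trans (cnt-filter _ _ (pairs d))
  (trans (cnt-concatMap-applyUpTo _ _ d (λ i → i)) (sumN-cong d (λ i _ →
    trans (cnt-map _ _ (filter (λ j → i ℕ.<? j) (upTo d))) (trans (cnt-filter _ (λ j → i ℕ.<? j) (upTo d)) (cnt-applyUpTo d (λ j → j) _))))))

-- The path to (d,d) seen from a point r steps above the diagonal and d columns before the end.
data Path : ℕ → ℕ → List Step → Set where
  done : Path 0 0 []
  north : ∀ {r d π} → Path (suc r) d π → Path r d (North ∷ π)
  east : ∀ {r d π} → r ≤ d → Path r d π → Path (suc r) (suc d) (East ∷ π)

Dyck-y≤d : ∀ {D x y π} → DyckFrom D x y π → y ≤ D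
Dyck-y≤d done = ℕₚ.≤-refl
Dyck-y≤d (north p) = ℕₚ.<⇒≤ (Dyck-y≤d p)
Dyck-y≤d (east _ p) = Dyck-y≤d p

Dyck-Path : ∀ {D x y π} r d → DyckFrom D x y π → y ≡ x ℕ.+ r → D ≡ x ℕ.+ d → Path r d π
Dyck-Path {x = x} r d done e e'
  rewrite ℕₚ.+-cancelˡ-≡ x r 0 (trans (sym e) (sym (ℕₚ.+-identityʳ x)))
        | ℕₚ.+-cancelˡ-≡ x d 0 (trans (sym e') (sym (ℕₚ.+-identityʳ x))) = done
Dyck-Path {x = x} r d (north p) e e' = north (Dyck-Path (suc r) d p (trans (cong suc e) (sym (ℕₚ.+-suc x r))) e')
Dyck-Path {x = x} zero d (east q p) e e' = ⊥-elim (ℕₚ.1+n≰n (subst (suc x ≤_) (trans e (ℕₚ.+-identityʳ x)) q))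
Dyck-Path {D} {x} {y} (suc r) zero (east q p) e e' =
  ⊥-elim (ℕₚ.1+n≰n (subst (suc x ≤_) (trans e' (ℕₚ.+-identityʳ x)) (ℕₚ.≤-trans q (Dyck-y≤d p))))
Dyck-Path {D} {x} {y} (suc r) (suc d) (east q p) e e' = east
  (ℕₚ.+-cancelˡ-≤ (suc x) r d (subst₂ _≤_ (trans e (ℕₚ.+-suc x r)) (trans e' (ℕₚ.+-suc x d)) (Dyck-y≤d p)))
  (Dyck-Path r d p (trans e (ℕₚ.+-suc x r)) (trans e' (ℕₚ.+-suc x d)))

norths : List Step → ℕ
norths [] = 0
norths (North ∷ π) = suc (norths π)
norths (East ∷ π) = norths π

Path-norths : ∀ {r d π} → Path r d π → r ℕ.+ norths π ≡ d
Path-norths done = refl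
Path-norths {r} (north p) = trans (ℕₚ.+-suc r _) (Path-norths p)
Path-norths (east _ p) = cong suc (Path-norths p)

-- When the first column is removed together with its letter, all rows are renumbered by one and the
-- remaining heights drop accordingly.
height-suc : ∀ {r d π} y i → Path r d π → i < d → height (suc y) π (suc i) ≡ suc (height y π (suc i))
height-suc y i (north p) q = height-suc (suc y) i p q
height-suc y zero (east _ p) q = refl
height-suc y (suc i) (east _ p) (s≤s q) = height-suc y i p q

rcTake : ℕ → List Letter → Letter → ℕ
rcTake zero W a = 0
rcTake (suc r) [] a = 0
rcTake (suc r) (b ∷ W) a = b2n (rowInc b a) ℕ.+ rcTake r W a

-- Inversions charged to columns: an east step taken r above the diagonal belongs to the first
-- letter of `W`, which is compared with the next r - 1 letters, the rows strictly above the
-- diagonal in that column.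
invE : ℕ → List Step → List Letter → ℕ
invE r [] W = 0
invE r (North ∷ π) W = invE (suc r) π W
invE r (East ∷ π) [] = 0
invE r (East ∷ π) (a ∷ W) = rcTake (ℕ.pred r) W a ℕ.+ invE (ℕ.pred r) π W

cntN-rcTake : ∀ d r W a → length W ≡ d → r ≤ d →
  cntN d (λ j → does (suc j ℕ.≤? r) ∧ rowInc (at W (suc j)) a) ≡ rcTake r W a
cntN-rcTake d zero W a e p = cntN-false d
cntN-rcTake (suc d) (suc r) (b ∷ W) a e (s≤s p) = cong (b2n (rowInc b a) ℕ.+_) (cntN-rcTake d r W a (ℕₚ.suc-injective e) p)

areaInv-invE : ∀ {r d π} W → Path r d π → length W ≡ d → areaInv d (λ i → height r π (suc i)) W ≡ invE r π W
areaInv-invE W done e = refl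
areaInv-invE W (north p) e = areaInv-invE W p e
areaInv-invE {suc r} {suc d} {East ∷ π} (a ∷ W) (east r≤d p) e = cong₂ ℕ._+_
  (cntN-rcTake d r W a (ℕₚ.suc-injective e) r≤d)
  (trans (sumN-cong d (λ i i<d → cntN-cong d (λ j _ →
      cong (λ h → does (i ℕ.<? j) ∧ (does (suc (suc j) ℕ.≤? h) ∧ rowInc (at W (suc j)) (at W (suc i)))) (height-suc r i p i<d))))
    (areaInv-invE W p (ℕₚ.suc-injective e)))

rc : Letter → List Letter → ℕ
rc b [] = 0
rc b (c ∷ cs) = b2n (rowInc b c) ℕ.+ rc b cs

invP : List Step → List Letter → List Letter → ℕ
invP [] cs w = 0
invP (North ∷ π) cs [] = 0
invP (North ∷ π) cs (b ∷ w) = rc b cs ℕ.+ invP π (cs ▷ b) w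
invP (East ∷ π) [] w = invP π [] w
invP (East ∷ π) (c ∷ cs) w = invP π cs w

rcQ : List Letter → Letter → ℕ
rcQ [] a = 0
rcQ (b ∷ cs) a = b2n (rowInc b a) ℕ.+ rcQ cs a

-- The inversions inside the queue. They measure the delay between the two counts: the pushes have
-- charged them, the columns have not yet.
ipairs : List Letter → ℕ
ipairs [] = 0
ipairs (c ∷ cs) = rcQ cs c ℕ.+ ipairs cs

rcTake-++ : ∀ cs w a → rcTake (length cs) (cs ++ w) a ≡ rcQ cs a
rcTake-++ [] w a = refl
rcTake-++ (b ∷ cs) w a = cong (b2n (rowInc b a) ℕ.+_) (rcTake-++ cs w a)

rcQ-▷ : ∀ cs b a → rcQ (cs ▷ b) a ≡ b2n (rowInc b a) ℕ.+ rcQ cs a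
rcQ-▷ [] b a = refl
rcQ-▷ (c ∷ cs) b a = trans (cong (b2n (rowInc c a) ℕ.+_) (rcQ-▷ cs b a)) (swap₃ (b2n (rowInc c a)) (b2n (rowInc b a)) _)
  where
  swap₃ : ∀ i j k → i ℕ.+ (j ℕ.+ k) ≡ j ℕ.+ (i ℕ.+ k)
  swap₃ i j k = trans (sym (ℕₚ.+-assoc i j k)) (trans (cong (ℕ._+ k) (ℕₚ.+-comm i j)) (ℕₚ.+-assoc j i k))

ipairs-▷ : ∀ cs b → ipairs (cs ▷ b) ≡ ipairs cs ℕ.+ rc b cs
ipairs-▷ [] b = refl
ipairs-▷ (c ∷ cs) b = trans (cong₂ ℕ._+_ (rcQ-▷ cs b c) (ipairs-▷ cs b)) (lem (b2n (rowInc b c)) (rcQ cs c) (ipairs cs) (rc b cs))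
  where
  lem : ∀ i j k l → (i ℕ.+ j) ℕ.+ (k ℕ.+ l) ≡ (j ℕ.+ k) ℕ.+ (i ℕ.+ l)
  lem i j k l = trans (cong (ℕ._+ (k ℕ.+ l)) (ℕₚ.+-comm i j)) (trans (ℕₚ.+-assoc j i _)
    (trans (cong (j ℕ.+_) (trans (sym (ℕₚ.+-assoc i k l)) (trans (cong (ℕ._+ l) (ℕₚ.+-comm i k)) (ℕₚ.+-assoc k i l))))
      (sym (ℕₚ.+-assoc j k _))))

length-▷ : {X : Set} (cs : List X) (b : X) → length (cs ▷ b) ≡ suc (length cs)
length-▷ cs b = trans (Lₚ.length-++ cs) (ℕₚ.+-comm _ 1)

-- Inversions counted column by column agree with inversions counted when the upper letter enters the queue.
invE-invP : ∀ {r d π} cs w → Path r d π → length cs ≡ r → length w ≡ norths π →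
  invE r π (cs ++ w) ≡ ipairs cs ℕ.+ invP π cs w
invE-invP [] w done e e' = refl
invE-invP {r} {d} {North ∷ π} cs (b ∷ w) (north p) e e' = trans
  (cong (invE (suc r) π) (sym (Lₚ.++-assoc cs (b ∷ []) w)))
  (trans (invE-invP (cs ▷ b) w p (trans (length-▷ cs b) (cong suc e)) (ℕₚ.suc-injective e'))
    (trans (cong (ℕ._+ invP π (cs ▷ b) w) (ipairs-▷ cs b)) (ℕₚ.+-assoc (ipairs cs) _ _)))
invE-invP {suc r} {suc d} {East ∷ π} (c ∷ cs) w (east _ p) e e' = trans
  (cong₂ ℕ._+_ (trans (cong (λ z → rcTake z (cs ++ w) c) (sym (ℕₚ.suc-injective e))) (rcTake-++ cs w c))
    (invE-invP cs w p (ℕₚ.suc-injective e) e'))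
  (sym (ℕₚ.+-assoc (rcQ cs c) (ipairs cs) _))

extended : ℕ → List Step → List Step
extended zero π = π
extended (suc r) π = North ∷ extended r π

extended-Path : ∀ {r d π} i → Path (r ℕ.+ i) d π → Path i d (extended r π)
extended-Path {zero} i p = p
extended-Path {suc r} {d} {π} i p = north (extended-Path {r} (suc i) (subst (λ z → Path z d π) (sym (ℕₚ.+-suc r i)) p))

norths-extended : ∀ r π → norths (extended r π) ≡ r ℕ.+ norths π
norths-extended zero π = refl
norths-extended (suc r) π = cong suc (norths-extended r π)

invE-extended : ∀ r i π W → invE i (extended r π) W ≡ invE (r ℕ.+ i) π W
invE-extended zero i π W = refl
invE-extended (suc r) i π W = trans (invE-extended r (suc i) π W) (cong (λ z → invE z π W) (ℕₚ.+-suc r i))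

inv≡invP : ∀ {r d π} W → Path r d π → length W ≡ d → inv r d π W ≡ invP (extended r π) [] W
inv≡invP {r} {d} {π} W p e = trans (inv≡areaInv r d π W) (trans (areaInv-invE W p e)
  (trans (trans (cong (λ z → invE z π W) (sym (ℕₚ.+-identityʳ r))) (sym (invE-extended r 0 π W)))
    (invE-invP [] W p' refl (trans e (sym (Path-norths p'))))))
  where
  p' : Path 0 d (extended r π)
  p' = extended-Path {r} 0 (subst (λ z → Path z d π) (sym (ℕₚ.+-identityʳ r)) p)

-- Marked corners and flags along the path.

module _ (Σm : List (ℕ × ℕ)) where

  moves-Valid : ∀ {r d π} c y → Path r d π → Valid (moves Σm c y π) r
  moves-Valid c y done = []
  moves-Valid c y (north p) = mN (moves-Valid c (suc y) p)
  moves-Valid c y (east q done) = mE []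
  moves-Valid c y (east q p@(east _ _)) = mE (moves-Valid (suc c) y p)
  moves-Valid c y (east q (north p)) with memPair (suc c , suc y) Σm
  ... | true = mC (moves-Valid (suc c) (suc y) p)
  ... | false = mE (mN (moves-Valid (suc c) (suc y) p))

  moves-pushes : ∀ {r d π} c y → Path r d π → pushes (moves Σm c y π) ≡ norths π
  moves-pushes c y done = refl
  moves-pushes c y (north p) = cong suc (moves-pushes c (suc y) p)
  moves-pushes c y (east q done) = refl
  moves-pushes c y (east q p@(east _ _)) = moves-pushes (suc c) y p
  moves-pushes c y (east q (north p)) with memPair (suc c , suc y) Σm
  ... | true = cong suc (moves-pushes (suc c) (suc y) p)
  ... | false = cong suc (moves-pushes (suc c) (suc y) p)

  -- The marking condition as it is met along the path. Only membership in `Σm` is consulted, so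
  -- repetitions in the list make no difference.
  markOK : List Letter → ℕ → ℕ → List Step → Bool
  markOK W c y [] = true
  markOK W c y (North ∷ π) = markOK W c (suc y) π
  markOK W c y (East ∷ []) = true
  markOK W c y (East ∷ π@(East ∷ _)) = markOK W (suc c) y π
  markOK W c y (East ∷ π@(North ∷ _)) =
    (if memPair (suc c , suc y) Σm then rowInc (at W (suc y)) (at W (suc c)) else true) ∧ markOK W (suc c) y π

plain : List Step → List Move
plain [] = []
plain (North ∷ π) = mN ∷ plain π
plain (East ∷ π) = mE ∷ plain π

at-++ : ∀ P b w → at (P ++ b ∷ w) (suc (length P)) ≡ b
at-++ [] b w = refl
at-++ (a ∷ []) b w = refl
at-++ (a ∷ a' ∷ P) b w = at-++ (a' ∷ P) b w

∧-trueˡ : ∀ {a b} → a ∧ b ≡ true → a ≡ true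
∧-trueˡ {true} e = refl

∧-trueʳ : ∀ {a b} → a ∧ b ≡ true → b ≡ true
∧-trueʳ {true} e = e

bool-⇔ : ∀ {a b} → (a ≡ true → b ≡ true) → (b ≡ true → a ≡ true) → a ≡ b
bool-⇔ {true} {b} f g = sym (f refl)
bool-⇔ {false} {true} f g = g refl
bool-⇔ {false} {false} f g = refl

eqPair-refl : ∀ p → eqPair p p ≡ true
eqPair-refl (a , b) rewrite ⌊⌋-true (a ℕ.≟ a) refl | ⌊⌋-true (b ℕ.≟ b) refl = refl

eqPair-true : ∀ p q → eqPair p q ≡ true → p ≡ q
eqPair-true (a , b) (c , e) h with a ℕ.≟ c | b ℕ.≟ e
... | yes refl | yes refl = refl
eqPair-true (a , b) (c , e) () | yes _ | no _
eqPair-true (a , b) (c , e) () | no _ | _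

memPair-allB : ∀ (P : ℕ × ℕ → Bool) p L → memPair p L ≡ true → allB P L ≡ true → P p ≡ true
memPair-allB P p (q ∷ L) h h' with eqPair p q in e
... | true = trans (cong P (eqPair-true p q e)) (∧-trueˡ h')
... | false = memPair-allB P p L h (∧-trueʳ {P q} h')

module _ (Σm : List (ℕ × ℕ)) (W : List Letter) where
  private
    marked : ℕ × ℕ → Bool
    marked (i , j) = rowInc (at W j) (at W i)

  allB-markOK : ∀ {r d π} c y → Path r d π → allB marked Σm ≡ true → markOK Σm W c y π ≡ true
  allB-markOK c y done h = refl
  allB-markOK c y (north p) h = allB-markOK c (suc y) p h
  allB-markOK c y (east q done) h = refl
  allB-markOK c y (east q p@(east _ _)) h = allB-markOK (suc c) y p h
  allB-markOK c y (east q p@(north _)) h with memPair (suc c , suc y) Σm in e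
  ... | true rewrite memPair-allB marked (suc c , suc y) Σm e h = allB-markOK (suc c) y p h
  ... | false = allB-markOK (suc c) y p h

  -- The next column being strictly higher forces a north step right after the east step of this
  -- column, the very situation in which `markOK` looks up the box.
  corner-markOK : ∀ {r d π} c y i → Path r d π → suc (height y π (suc i)) ≤ height y π (suc (suc i)) →
    memPair (suc (c ℕ.+ i) , suc (height y π (suc i))) Σm ≡ true → markOK Σm W c y π ≡ true →
    marked (suc (c ℕ.+ i) , suc (height y π (suc i))) ≡ true
  corner-markOK c y i (north p) q e h = corner-markOK c (suc y) i p q e h
  -- Beyond the last column `height` returns its default 0, which cannot exceed the current height.
  corner-markOK c y zero (east _ done) () e h
  corner-markOK c y zero (east _ (east _ _)) q e h = ⊥-elim (ℕₚ.1+n≰n q)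
  corner-markOK c y zero (east _ (north p)) q e h rewrite ℕₚ.+-identityʳ c | e = ∧-trueˡ h
  corner-markOK c y (suc i) (east _ done) () e h
  corner-markOK c y (suc i) (east _ p@(east _ _)) q e h rewrite ℕₚ.+-suc c i = corner-markOK (suc c) y i p q e h
  corner-markOK c y (suc i) (east _ p@(north _)) q e h rewrite ℕₚ.+-suc c i =
    corner-markOK (suc c) y i p q e (∧-trueʳ {if memPair (suc c , suc y) Σm then rowInc (at W (suc y)) (at W (suc c)) else true} h)

  markOK-corner : ∀ {r d π} → Path r d π → ∀ p → IsCorner r d π p → memPair p Σm ≡ true → markOK Σm W 0 r π ≡ true → marked p ≡ true
  markOK-corner {r} {d} {π} P (suc a , b) ((_ , _ , hi) , (b' , refl , (_ , _ , lo)) , (_ , _ , lo')) e h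
    with ℕₚ.≤-antisym lo (ℕₚ.≤-pred hi)
  ... | refl = corner-markOK 0 r a P lo' e h
  markOK-corner P (zero , b) ((() , _) , _) e h

  private
    memPair-there : ∀ p q L → memPair p L ≡ true → memPair p (q ∷ L) ≡ true
    memPair-there p q L h rewrite h = Bₚ.∨-zeroʳ (eqPair p q)

    memPair-here : ∀ p L → memPair p (p ∷ L) ≡ true
    memPair-here p L rewrite eqPair-refl p = refl

  -- The induction consumes `L`, while membership must still be tested in the full list Σm; hence
  -- the inclusion as a hypothesis.
  markOK-allB : ∀ {r d π} → Path r d π → markOK Σm W 0 r π ≡ true → ∀ L → All (IsCorner r d π) L →
    (∀ p → memPair p L ≡ true → memPair p Σm ≡ true) → allB marked L ≡ true
  markOK-allB P h [] [] sub = refl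
  markOK-allB P h (p ∷ L) (ic ∷ ics) sub rewrite markOK-corner P p ic (sub p (memPair-here p L)) h =
    markOK-allB P h L ics (λ q e → sub q (memPair-there q p L e))

  allB≡markOK : ∀ {r d π} → Path r d π → IsMarking r d π Σm → allB marked Σm ≡ markOK Σm W 0 r π
  allB≡markOK {r} P mk = bool-⇔ (allB-markOK 0 r P) (λ h → markOK-allB P h Σm mk (λ p e → e))

flagOK : ℕ → ℕ → List Letter → Bool
flagOK zero j w = true
flagOK (suc f) j [] = true
flagOK (suc f) j (b ∷ w) = flag b j ∧ flagOK f (suc j) w

allB-flagOK : ∀ f (Q : ℕ → Bool) (g : ℕ → ℕ) j w → f ≤ length w →
  (∀ i → Q (g i) ≡ flag (at w (suc i)) (j ℕ.+ i)) → allB Q (applyUpTo g f) ≡ flagOK f j w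
allB-flagOK zero Q g j w p e = refl
allB-flagOK (suc f) Q g j (b ∷ w) (s≤s p) e = cong₂ _∧_
  (trans (e 0) (cong (flag b) (ℕₚ.+-identityʳ j)))
  (allB-flagOK f Q (λ i → g (suc i)) (suc j) w p (λ i → trans (e (suc i)) (cong (flag (at w (suc i))) (ℕₚ.+-suc j i))))

module WordWeight (A : Alg) (N : ℕ) (x : Points.Pt A) where
  open Points A
  open Words A N x

  ind-∧ : ∀ a b → ind (a ∧ b) ≋ ind a * ind b
  ind-∧ true b = ≋-sym (*-identityˡ _)
  ind-∧ false b = ≋-sym (zeroˡ _)

  ωF-flags : ∀ f cs ms w → ωF f cs ms w ≋ ind (flagOK f (length cs) w) * ωM (replicate f mN ++ ms) cs w
  ωF-flags zero cs ms w = ≋-sym (*-identityˡ _)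
  ωF-flags (suc f) cs ms [] = ≋-sym (zeroʳ _)
  ωF-flags (suc f) cs ms (b ∷ w) = begin
    i * (lw b * (rcw b cs * ωF f (cs ▷ b) ms w))
      ≈⟨ *-congˡ (*-congˡ (*-congˡ (ωF-flags f (cs ▷ b) ms w))) ⟩
    i * (lw b * (rcw b cs * (ind (flagOK f (length (cs ▷ b)) w) * z)))
      ≡⟨ cong (λ l → i * (lw b * (rcw b cs * (ind (flagOK f l w) * z)))) (length-▷ cs b) ⟩
    i * (lw b * (rcw b cs * (ind (flagOK f (suc (length cs)) w) * z)))
      ≈⟨ solve 5 (λ i l r j z → i :* (l :* (r :* (j :* z))) := (i :* j) :* (l :* (r :* z))) ≋-refl i (lw b) (rcw b cs) _ z ⟩
    (i * ind (flagOK f (suc (length cs)) w)) * (lw b * (rcw b cs * z))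
      ≈⟨ *-congʳ (ind-∧ (flag b (length cs)) (flagOK f (suc (length cs)) w)) ⟨
    ind (flag b (length cs) ∧ flagOK f (suc (length cs)) w) * (lw b * (rcw b cs * z)) ∎
    where
    open ≋-R
    i = ind (flag b (length cs))
    z = ωM (replicate f mN ++ ms) (cs ▷ b) w

  rcw-t^ : ∀ b cs → rcw b cs ≋ t ^ rc b cs
  rcw-t^ b [] = ≋-refl
  rcw-t^ b (c ∷ cs) with rowInc b c
  ... | true = *-congˡ (rcw-t^ b cs)
  ... | false = ≋-trans (*-identityˡ _) (rcw-t^ b cs)

  lwprod : List Letter → Carrier
  lwprod [] = 1#
  lwprod (b ∷ w) = lw b * lwprod w

  ωM-plain : ∀ {r d π} cs w → Path r d π → length cs ≡ r → length w ≡ norths π →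
    ωM (plain π) cs w ≋ t ^ invP π cs w * lwprod w
  ωM-plain [] [] done e e' = ≋-sym (*-identityˡ _)
  ωM-plain {π = North ∷ π} cs (b ∷ w) (north p) e e' = begin
    lw b * (rcw b cs * ωM (plain π) (cs ▷ b) w)
      ≈⟨ *-congˡ (*-cong (rcw-t^ b cs) (ωM-plain (cs ▷ b) w p (trans (length-▷ cs b) (cong suc e)) (ℕₚ.suc-injective e'))) ⟩
    lw b * (t ^ rc b cs * (t ^ invP π (cs ▷ b) w * lwprod w))
      ≈⟨ solve 4 (λ l a b p → l :* (a :* (b :* p)) := (a :* b) :* (l :* p)) ≋-refl _ _ _ _ ⟩
    (t ^ rc b cs * t ^ invP π (cs ▷ b) w) * (lw b * lwprod w)
      ≈⟨ *-congʳ (^-+ t (rc b cs) _) ⟨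
    t ^ (rc b cs ℕ.+ invP π (cs ▷ b) w) * (lw b * lwprod w) ∎
    where open ≋-R
  ωM-plain (c ∷ cs) w (east _ p) e e' = ωM-plain cs w p (ℕₚ.suc-injective e) e'

  module _ (Σm : List (ℕ × ℕ)) (W : List Letter) where

    -- `P` holds the letters already popped. Then the front of the queue is letter c + 1 of W and
    -- the next letter to be pushed is letter y + 1, matching a corner box (c + 1, y + 1).
    ωM-marks : ∀ {r d π} c y P cs w → Path r d π → length cs ≡ r → length w ≡ norths π →
      length P ≡ c → length P ℕ.+ length cs ≡ y → W ≡ P ++ cs ++ w →
      ωM (moves Σm c y π) cs w ≋ ind (markOK Σm W c y π) * ωM (plain π) cs w

    private
      shift : ∀ (P : List Letter) a cs w → P ++ (a ∷ cs) ++ w ≡ (P ▷ a) ++ cs ++ w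
      shift P a cs w = sym (Lₚ.++-assoc P (a ∷ []) (cs ++ w))

      shift-len : ∀ (P : List Letter) a {l y} → length P ℕ.+ suc l ≡ y → length (P ▷ a) ℕ.+ l ≡ y
      shift-len P a {l} e = trans (cong (ℕ._+ l) (length-▷ P a)) (trans (sym (ℕₚ.+-suc (length P) l)) e)

    ωM-marks c y P [] w done e e' eP ey eW = ≋-sym (*-identityˡ _)
    ωM-marks {π = North ∷ π} c y P cs (b ∷ w) (north p) e e' eP ey eW = begin
      lw b * (rcw b cs * ωM (moves Σm c (suc y) π) (cs ▷ b) w)
        ≈⟨ *-congˡ (*-congˡ (ωM-marks c (suc y) P (cs ▷ b) w p (trans (length-▷ cs b) (cong suc e)) (ℕₚ.suc-injective e') eP
             (trans (cong (length P ℕ.+_) (length-▷ cs b)) (trans (ℕₚ.+-suc (length P) _) (cong suc ey)))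
             (trans eW (cong (P ++_) (sym (Lₚ.++-assoc cs (b ∷ []) w)))))) ⟩
      lw b * (rcw b cs * (ind (markOK Σm W c (suc y) π) * ωM (plain π) (cs ▷ b) w))
        ≈⟨ solve 4 (λ l r i z → l :* (r :* (i :* z)) := i :* (l :* (r :* z))) ≋-refl _ _ _ _ ⟩
      ind (markOK Σm W c (suc y) π) * (lw b * (rcw b cs * ωM (plain π) (cs ▷ b) w)) ∎
      where open ≋-R
    ωM-marks c y P (a ∷ []) w (east q done) e e' eP ey eW = ≋-sym (*-identityˡ _)
    ωM-marks c y P (a ∷ cs) w (east q p@(east _ _)) e e' eP ey eW =
      ωM-marks (suc c) y (P ▷ a) cs w p (ℕₚ.suc-injective e) e' (trans (length-▷ P a) (cong suc eP)) (shift-len P a ey) (trans eW (shift P a cs w))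
    ωM-marks {π = East ∷ North ∷ π} c y P (a ∷ cs) (b ∷ w) (east q p@(north _)) e e' eP ey eW
      with memPair (suc c , suc y) Σm
         | ωM-marks (suc c) y (P ▷ a) cs (b ∷ w) p (ℕₚ.suc-injective e) e' (trans (length-▷ P a) (cong suc eP)) (shift-len P a ey) (trans eW (shift P a cs (b ∷ w)))
    ... | false | ih = ih
    ... | true | ih = ≋-trans (*-congˡ ih) (≋-trans (≋-sym (*-assoc _ _ _)) (*-congʳ (≋-trans
        (*-congʳ (≋-reflexive (cong ind (sym (cong₂ rowInc at-b at-a)))))
        (≋-sym (ind-∧ (rowInc (at W (suc y)) (at W (suc c))) _)))))
      where
      at-a : at W (suc c) ≡ a
      at-a = trans (cong₂ (λ V z → at V (suc z)) eW (sym eP)) (at-++ P a (cs ++ b ∷ w))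
      at-b : at W (suc y) ≡ b
      at-b = trans (cong₂ (λ V z → at V (suc z)) (trans eW (sym (Lₚ.++-assoc P (a ∷ cs) (b ∷ w)))) (trans (sym ey) (sym (Lₚ.length-++ P))))
        (at-++ (P ++ a ∷ cs) b w)

    ωM-marks-prefix : ∀ {d π} f cs w → Path (f ℕ.+ length cs) d π → length w ≡ f ℕ.+ norths π → W ≡ cs ++ w →
      ωM (replicate f mN ++ moves Σm 0 (f ℕ.+ length cs) π) cs w
        ≋ ind (markOK Σm W 0 (f ℕ.+ length cs) π) * ωM (plain (extended f π)) cs w
    ωM-marks-prefix zero cs w p e eW = ωM-marks 0 (length cs) [] cs w p refl e refl refl eW
    ωM-marks-prefix {d} {π} (suc f) cs (b ∷ w) p e eW = ≋-trans
      (*-congˡ (*-congˡ (subst (λ z → ωM (replicate f mN ++ moves Σm 0 z π) (cs ▷ b) w ≋ ind (markOK Σm W 0 z π) * ωM (plain (extended f π)) (cs ▷ b) w)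
        len (ωM-marks-prefix f (cs ▷ b) w (subst (λ z → Path z d π) (sym len) p) (ℕₚ.suc-injective e) (trans eW (sym (Lₚ.++-assoc cs (b ∷ []) w)))))))
      (solve 4 (λ l r i z → l :* (r :* (i :* z)) := i :* (l :* (r :* z))) ≋-refl _ _ _ _)
      where
      len : f ℕ.+ length (cs ▷ b) ≡ suc f ℕ.+ length cs
      len = trans (cong (f ℕ.+_) (length-▷ cs b)) (ℕₚ.+-suc f _)

  xprod : List Letter → Carrier
  xprod [] = 1#
  xprod ((v , _) ∷ w) = x v * xprod w

  lwprod-≋ : ∀ w → lwprod w ≋ (- t) ^ Defs.m w * xprod w
  lwprod-≋ w = ≋-trans (go w) (*-congʳ (≋-reflexive (cong ((- t) ^_) (sym (countB≡cnt isNeg w)))))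
    where
    go : ∀ w → lwprod w ≋ (- t) ^ cnt isNeg w * xprod w
    go [] = ≋-sym (*-identityˡ _)
    go ((v , true) ∷ w) = ≋-trans (*-congˡ (go w)) (solve 4 (λ t x a b → (t :* x) :* (a :* b) := (t :* a) :* (x :* b)) ≋-refl (- t) _ _ _)
    go ((v , false) ∷ w) = ≋-trans (*-congˡ (go w)) (solve 3 (λ x a b → (:1 :* x) :* (a :* b) := a :* (x :* b)) ≋-refl _ _ _)

  word-weight : ∀ {r d π Σm} W → Path r d π → IsMarking r d π Σm → length W ≡ d →
    ωF r [] (moves Σm 0 r π) W ≋ ind (isFlaggedRowSuperWord r Σm W) * (t ^ inv r d π W * ((- t) ^ Defs.m W * xprod W))
  word-weight {r} {d} {π} {Σm} W p mk e = begin
    ωF r [] (moves Σm 0 r π) W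
      ≈⟨ ωF-flags r [] (moves Σm 0 r π) W ⟩
    ind (flagOK r 0 W) * ωM (replicate r mN ++ moves Σm 0 r π) [] W
      ≈⟨ *-congˡ (subst (λ z → ωM (replicate r mN ++ moves Σm 0 z π) [] W ≋ ind (markOK Σm W 0 z π) * ωM (plain (extended r π)) [] W) (ℕₚ.+-identityʳ r)
           (ωM-marks-prefix Σm W r [] W (subst (λ z → Path z d π) (sym (ℕₚ.+-identityʳ r)) p) (trans e (sym (Path-norths p))) refl)) ⟩
    ind (flagOK r 0 W) * (ind (markOK Σm W 0 r π) * ωM (plain (extended r π)) [] W)
      ≈⟨ ≋-trans (≋-sym (*-assoc _ _ _)) (*-congʳ (≋-trans (*-comm _ _) (≋-sym (ind-∧ (markOK Σm W 0 r π) (flagOK r 0 W))))) ⟩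
    ind (markOK Σm W 0 r π ∧ flagOK r 0 W) * ωM (plain (extended r π)) [] W
      ≈⟨ *-cong (≋-reflexive (cong ind (cong₂ _∧_ (sym (allB≡markOK Σm W p mk))
            (sym (allB-flagOK r _ (λ i → i) 0 W (ℕₚ.≤-trans (ℕₚ.m≤m+n r (norths π)) (ℕₚ.≤-reflexive (trans (Path-norths p) (sym e)))) (λ i → refl))))))
          (≋-trans (ωM-plain [] W p' refl (trans e (sym (Path-norths p')))) (*-cong (≋-reflexive (cong (t ^_) (sym (inv≡invP W p e)))) (lwprod-≋ W))) ⟩
    ind (isFlaggedRowSuperWord r Σm W) * (t ^ inv r d π W * ((- t) ^ Defs.m W * xprod W)) ∎
    where
    open ≋-R
    p' : Path 0 d (extended r π)
    p' = extended-Path {r} 0 (subst (λ z → Path z d π) (sym (ℕₚ.+-identityʳ r)) p)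

-- Coefficients at the generic point.

upd : (ℕ → ℕ) → ℕ → ℕ → ℕ → ℕ
upd a v k i = if ⌊ i ℕ.≟ v ⌋ then k else a i

upd-same : ∀ a v k → upd a v k v ≡ k
upd-same a v k rewrite ⌊⌋-true (v ℕ.≟ v) refl = refl

upd-other : ∀ a v k i → i ≢ v → upd a v k i ≡ a i
upd-other a v k i p rewrite ⌊⌋-false (i ℕ.≟ v) p = refl

nth : List ℕ → ℕ → ℕ
nth [] _ = 0
nth (a ∷ _) zero = a
nth (_ ∷ α) (suc i) = nth α i

nth-beyond : ∀ α i → length α ≤ i → nth α i ≡ 0
nth-beyond [] i p = refl
nth-beyond (a ∷ α) (suc i) (s≤s p) = nth-beyond α i p

nth-drop : ∀ r α j → nth (drop r α) j ≡ nth α (r ℕ.+ j)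
nth-drop zero α j = refl
nth-drop (suc r) [] j = refl
nth-drop (suc r) (a ∷ α) j = nth-drop r α j

nth-subAt-same : ∀ γ j k → nth (subAt γ j k) j ≡ nth γ j ℕ.∸ k
nth-subAt-same [] j k = sym (ℕₚ.0∸n≡0 k)
nth-subAt-same (a ∷ γ) zero k = refl
nth-subAt-same (a ∷ γ) (suc j) k = nth-subAt-same γ j k

nth-subAt-other : ∀ γ j k i → i ≢ j → nth (subAt γ j k) i ≡ nth γ i
nth-subAt-other [] j k i p = refl
nth-subAt-other (a ∷ γ) zero k zero p = ⊥-elim (p refl)
nth-subAt-other (a ∷ γ) zero k (suc i) p = refl
nth-subAt-other (a ∷ γ) (suc j) k zero p = refl
nth-subAt-other (a ∷ γ) (suc j) k (suc i) p = nth-subAt-other γ j k i (λ e → p (cong suc e))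

length-subAt : ∀ γ j k → length (subAt γ j k) ≡ length γ
length-subAt [] j k = refl
length-subAt (a ∷ γ) zero k = refl
length-subAt (a ∷ γ) (suc j) k = cong suc (length-subAt γ j k)

-- pcoeff and hasContent look up exponents with local recursive functions that cannot be
-- named here: unification binds D to such a function, and binds the left-hand side of
-- tail-entry (tail-content) from its use in the with-clause.
pcoeff-entry : ∀ k ks → Σ (Mon → ℕ → ℕ) λ D → ∀ γ →
  pcoeff (k ∷ ks) γ ≡ sum (map (λ j → if ⌊ suc k ℕ.≤? D γ j ⌋ then pcoeff ks (subAt γ j (suc k)) else 0) (upTo (length γ)))
pcoeff-entry k ks = _ , λ γ → refl

mutual
  tail-entry : ∀ (k : ℕ) (ks : PIdx) (γ₀ γ : Mon) (j : ℕ) → _ ≡ nth γ j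

  pcoeff-entry-suc : ∀ k ks a γ j → proj₁ (pcoeff-entry k ks) (a ∷ γ) (suc j) ≡ nth γ j
  pcoeff-entry-suc k ks a γ j with a ∷ γ
  ... | γ₀ = tail-entry k ks γ₀ γ j

  tail-entry k ks γ₀ [] j = refl
  tail-entry k ks γ₀ (a ∷ γ) zero = refl
  tail-entry k ks γ₀ (a ∷ γ) (suc j) = tail-entry k ks γ₀ γ j

pcoeff-entry≡nth : ∀ k ks γ j → proj₁ (pcoeff-entry k ks) γ j ≡ nth γ j
pcoeff-entry≡nth k ks [] j = refl
pcoeff-entry≡nth k ks (a ∷ γ) zero = refl
pcoeff-entry≡nth k ks (a ∷ γ) (suc j) = pcoeff-entry-suc k ks a γ j

content-entry : ∀ w → Σ (Mon → ℕ → ℕ) λ D → ∀ α →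
  hasContent w α ≡ (allB (λ v → ⌊ countB (λ a → ⌊ ∣ a ∣ ℕ.≟ suc v ⌋) w ℕ.≟ D α v ⌋) (upTo (length α)) ∧ ⌊ length w ℕ.≟ sum α ⌋)
content-entry w = _ , λ α → refl

mutual
  tail-content : ∀ (w : List Letter) (α₀ α : Mon) (j : ℕ) → _ ≡ nth α j

  content-entry-suc : ∀ w a α j → proj₁ (content-entry w) (a ∷ α) (suc j) ≡ nth α j
  content-entry-suc w a α j with a ∷ α
  ... | α₀ = tail-content w α₀ α j

  tail-content w α₀ [] j = refl
  tail-content w α₀ (a ∷ α) zero = refl
  tail-content w α₀ (a ∷ α) (suc j) = tail-content w α₀ α j

content-entry≡nth : ∀ w α j → proj₁ (content-entry w) α j ≡ nth α j
content-entry≡nth w [] j = refl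
content-entry≡nth w (a ∷ α) zero = refl
content-entry≡nth w (a ∷ α) (suc j) = content-entry-suc w a α j

-- The iterated power series ring A₀[[x₀]]…[[x_{n-1}]] and its coefficients.
module Coefficients (A₀ : Alg) where
  open Points A₀

  S : ℕ → Alg
  S zero = A₀
  S (suc n) = PSAlg (S n)

  pt : ∀ n → Points.Pt (S n)
  pt zero _ = 0#
  pt (suc n) = Extend.ext (S n) (pt n) n

  pt-Reg : ∀ n → Points.Reg (S n) n (pt n)
  pt-Reg zero = record { var-reg = λ _ () ; diff-reg = λ _ _ () }
  pt-Reg (suc n) = Extend.ext-Reg (S n) (pt-Reg n)

  coeff : ∀ n → (ℕ → ℕ) → Alg.Carrier (S n) → Carrier
  coeff zero a f = f
  coeff (suc n) a f = coeff n a (f (a n))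

  coeff-cong : ∀ n a {f g} → Alg._≋_ (S n) f g → coeff n a f ≋ coeff n a g
  coeff-cong zero a e = e
  coeff-cong (suc n) a e = coeff-cong n a (e (a n))

  coeff-+ : ∀ n a f g → coeff n a (Alg._+_ (S n) f g) ≋ coeff n a f + coeff n a g
  coeff-+ zero a f g = ≋-refl
  coeff-+ (suc n) a f g = coeff-+ n a (f (a n)) (g (a n))

  coeff-0 : ∀ n a → coeff n a (Alg.0# (S n)) ≋ 0#
  coeff-0 zero a = ≋-refl
  coeff-0 (suc n) a = coeff-0 n a

  coeff-ι* : ∀ n a r f → coeff n a (Alg._*_ (S n) (Alg.ι (S n) r) f) ≋ ι r * coeff n a f
  coeff-ι* zero a r f = ≋-refl
  coeff-ι* (suc n) a r f = ≋-trans (coeff-cong n a (Series.const-⊛ (base (S n)) (Alg.ι (S n) r) f (a n))) (coeff-ι* n a r (f (a n)))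

  coeff-agree : ∀ n {a a'} f → (∀ i → i < n → a i ≡ a' i) → coeff n a f ≋ coeff n a' f
  coeff-agree zero f e = ≋-refl
  coeff-agree (suc n) {a} {a'} f e = ≋-trans (≋-reflexive (cong (λ z → coeff n a (f z)) (e n ℕₚ.≤-refl)))
    (coeff-agree n (f (a' n)) (λ i p → e i (ℕₚ.m≤n⇒m≤1+n p)))

  coeff-∑L : ∀ n a {X : Set} (L : List X) (f : X → Alg.Carrier (S n)) → coeff n a (Points.∑L (S n) L f) ≋ ∑L L (λ u → coeff n a (f u))
  coeff-∑L n a [] f = coeff-0 n a
  coeff-∑L n a (u ∷ L) f = ≋-trans (coeff-+ n a _ _) (+-congˡ (coeff-∑L n a L f))

  coeff-∑ : ∀ n a m (f : ℕ → Alg.Carrier (S n)) → coeff n a (Alg.∑ (S n) m f) ≋ ∑ m (λ u → coeff n a (f u))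
  coeff-∑ n a zero f = coeff-0 n a
  coeff-∑ n a (suc m) f = ≋-trans (coeff-+ n a _ _) (+-congˡ (coeff-∑ n a m (λ i → f (suc i))))

  private
    below-or-top : ∀ {v n} → v < suc n → v ≢ n → v < n
    below-or-top (s≤s p) q = ℕₚ.≤∧≢⇒< p q

  coeff-var-0 : ∀ n a v f → v < n → a v ≡ 0 → coeff n a (Alg._*_ (S n) (pt n v) f) ≋ 0#
  coeff-var-0 (suc n) a v f p e with v ℕ.≟ n
  ... | yes refl rewrite Extend.ext-N (S n) (pt n) n | e = ≋-trans (coeff-cong n a (Series.var-⊛-0 (base (S n)) f)) (coeff-0 n a)
  ... | no v≢n rewrite Extend.ext-< (S n) (pt n) n v (below-or-top p v≢n) =
    ≋-trans (coeff-cong n a (Series.const-⊛ (base (S n)) (pt n v) f (a n))) (coeff-var-0 n a v (f (a n)) (below-or-top p v≢n) e)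

  coeff-var-suc : ∀ n a v f k → v < n → a v ≡ suc k → coeff n a (Alg._*_ (S n) (pt n v) f) ≋ coeff n (upd a v k) f
  coeff-var-suc (suc n) a v f k p e with v ℕ.≟ n
  ... | yes refl rewrite Extend.ext-N (S n) (pt n) n =
    ≋-trans (≋-reflexive (cong (λ z → coeff n a (Series._⊛_ (base (S n)) (Series.var (base (S n))) f z)) e))
      (≋-trans (coeff-cong n a (Series.var-⊛-suc (base (S n)) f k))
      (≋-trans (coeff-agree n (f k) (λ i i<n → sym (upd-other a v k i (ℕₚ.<⇒≢ i<n))))
        (≋-reflexive (cong (λ z → coeff n (upd a v k) (f z)) (sym (upd-same a v k))))))
  ... | no v≢n rewrite Extend.ext-< (S n) (pt n) n v (below-or-top p v≢n) =
    ≋-trans (coeff-cong n a (Series.const-⊛ (base (S n)) (pt n v) f (a n)))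
      (≋-trans (coeff-var-suc n a v (f (a n)) k (below-or-top p v≢n) e)
        (≋-reflexive (cong (λ z → coeff n (upd a v k) (f z)) (sym (upd-other a v k n (λ e → v≢n (sym e)))))))

  private
    x^* : ∀ n v k f → Alg._≋_ (S n) (Alg._*_ (S n) (Alg._^_ (S n) (pt n v) (suc k)) f)
      (Alg._*_ (S n) (pt n v) (Alg._*_ (S n) (Alg._^_ (S n) (pt n v) k) f))
    x^* n v k f = Alg.*-assoc (S n) _ _ _

  coeff-pow-< : ∀ n a v f k → v < n → a v < k → coeff n a (Alg._*_ (S n) (Alg._^_ (S n) (pt n v) k) f) ≋ 0#
  coeff-pow-< n a v f (suc k) p (s≤s q) with a v in e
  ... | zero = ≋-trans (coeff-cong n a (x^* n v k f)) (coeff-var-0 n a v _ p e)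
  ... | suc m = ≋-trans (coeff-cong n a (x^* n v k f)) (≋-trans (coeff-var-suc n a v _ m p e)
    (coeff-pow-< n (upd a v m) v f k p (subst (_< k) (sym (upd-same a v m)) q)))

  coeff-pow-≥ : ∀ n a a' v f k → v < n → k ≤ a v → a' v ≡ a v ℕ.∸ k → (∀ i → i ≢ v → a' i ≡ a i) →
    coeff n a (Alg._*_ (S n) (Alg._^_ (S n) (pt n v) k) f) ≋ coeff n a' f
  coeff-pow-≥ n a a' v f zero p q e o = ≋-trans (coeff-cong n a (Alg.*-identityˡ (S n) f)) (coeff-agree n f (λ i _ → lem i))
    where
    lem : ∀ i → a i ≡ a' i
    lem i with i ℕ.≟ v
    ... | yes refl = sym e
    ... | no i≢v = sym (o i i≢v)
  coeff-pow-≥ n a a' v f (suc k) p q e o with a v in ev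
  coeff-pow-≥ n a a' v f (suc k) p (s≤s q) e o | suc m =
    ≋-trans (coeff-cong n a (x^* n v k f)) (≋-trans (coeff-var-suc n a v _ m p ev)
      (coeff-pow-≥ n (upd a v m) a' v f k p (subst (k ≤_) (sym (upd-same a v m)) q)
        (trans e (cong (ℕ._∸ k) (sym (upd-same a v m))))
        (λ i i≢v → trans (o i i≢v) (sym (upd-other a v m i i≢v)))))

  coeff-1-zero : ∀ n a → (∀ i → i < n → a i ≡ 0) → coeff n a (Alg.1# (S n)) ≋ 1#
  coeff-1-zero zero a e = ≋-refl
  coeff-1-zero (suc n) a e rewrite e n ℕₚ.≤-refl = coeff-1-zero n a (λ i p → e i (ℕₚ.m≤n⇒m≤1+n p))

  coeff-1-nonzero : ∀ n a i → i < n → a i ≢ 0 → coeff n a (Alg.1# (S n)) ≋ 0#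
  coeff-1-nonzero (suc n) a i p q with a n in e
  ... | suc k = coeff-0 n a
  ... | zero = coeff-1-nonzero n a i (below-or-top p (λ { refl → q e })) q

  module _ (r d : ℕ) where
    private
      M = r ℕ.+ d
      module C = Points (S M)
      x = pt M

      tail-sum : ∀ k (g : C.Carrier) → C._≋_ (C._*_ (C.psum r M k x) g) (C.∑ d (λ j → C._*_ (C._^_ (x (r ℕ.+ j)) k) g))
      tail-sum k g = C.≋-trans (C.*-congʳ (Plethysm.psum-∑ (S M) r d k x))
        (C.≋-trans (C.*-comm _ _) (C.≋-trans (C.≋-sym (C.∑-*ˡ d g _)) (C.∑-cong d (λ j _ → C.*-comm _ _))))

    -- The tail power sums do not involve the first r variables. `mono-coeff` uses this to force the
    -- head exponents of a term to match exactly.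
    pmono-support : ∀ ks a i → i < r → a i ≢ 0 → coeff M a (C.pmono r M x ks) ≋ 0#
    pmono-support [] a i p q = coeff-1-nonzero M a i (ℕₚ.<-≤-trans p (ℕₚ.m≤m+n r d)) q
    pmono-support (k ∷ ks) a i p q = ≋-trans (coeff-cong M a (tail-sum (suc k) _)) (≋-trans (coeff-∑ M a d _)
      (∑-0 d (λ j j<d → per-variable j (ℕₚ.+-monoʳ-< r j<d))))
      where
      per-variable : ∀ j → r ℕ.+ j < M → coeff M a (C._*_ (C._^_ (x (r ℕ.+ j)) (suc k)) (C.pmono r M x ks)) ≋ 0#
      per-variable j j<M with suc k ℕ.≤? a (r ℕ.+ j)
      ... | no s = coeff-pow-< M a (r ℕ.+ j) _ (suc k) j<M (ℕₚ.≰⇒> s)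
      ... | yes s = ≋-trans (coeff-pow-≥ M a (upd a (r ℕ.+ j) _) (r ℕ.+ j) _ (suc k) j<M s (upd-same a (r ℕ.+ j) _) (upd-other a (r ℕ.+ j) _))
        (pmono-support ks _ i p (λ e → q (trans (sym (upd-other a (r ℕ.+ j) _ i (ℕₚ.<⇒≢ (ℕₚ.<-≤-trans p (ℕₚ.m≤m+n r j))))) e)))

    private
      allZero-true : ∀ γ → allZero γ ≡ true → ∀ j → nth γ j ≡ 0
      allZero-true [] e j = refl
      allZero-true (zero ∷ γ) e zero = refl
      allZero-true (zero ∷ γ) e (suc j) = allZero-true γ e j
      allZero-true (suc c ∷ γ) () j

      allZero-false : ∀ γ → allZero γ ≡ false → Σ ℕ λ j → j < length γ × nth γ j ≢ 0
      allZero-false (zero ∷ γ) e = let j , p , q = allZero-false γ e in suc j , s≤s p , q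
      allZero-false (suc c ∷ γ) e = 0 , s≤s z≤n , λ ()

      nat-sum : ∀ m (g : ℕ → ℕ) (h : ℕ → ℕ) → nat (sum (map h (applyUpTo g m))) ≋ ∑ m (λ i → nat (h (g i)))
      nat-sum zero g h = ≋-refl
      nat-sum (suc m) g h = ≋-trans (nat-+ (h (g 0)) _) (+-congˡ (nat-sum m (λ i → g (suc i)) h))

    pmono-coeff : ∀ ks γ a → length γ ≡ d → (∀ i → i < r → a i ≡ 0) → (∀ j → a (r ℕ.+ j) ≡ nth γ j) →
      coeff M a (C.pmono r M x ks) ≋ nat (pcoeff ks γ)
    pmono-coeff [] γ a l z e with allZero γ in az
    ... | true = coeff-1-zero M a all0
      where
      all0 : ∀ i → i < M → a i ≡ 0
      all0 i i<M with i ℕ.<? r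
      ... | yes p = z i p
      ... | no p = trans (cong a (sym (ℕₚ.m+[n∸m]≡n (ℕₚ.≮⇒≥ p)))) (trans (e (i ℕ.∸ r)) (allZero-true γ az (i ℕ.∸ r)))
    ... | false = let j , p , q = allZero-false γ az in
      coeff-1-nonzero M a (r ℕ.+ j) (ℕₚ.+-monoʳ-< r (subst (j <_) l p)) (λ e' → q (trans (sym (e j)) e'))
    pmono-coeff (k ∷ ks) γ a l z e = ≋-trans (coeff-cong M a (tail-sum (suc k) _)) (≋-trans (coeff-∑ M a d _)
      (≋-trans (∑-cong d (λ j j<d → per-variable j (ℕₚ.+-monoʳ-< r j<d) (proj₁ (pcoeff-entry k ks) γ j) (pcoeff-entry≡nth k ks γ j)))
        (≋-trans (≋-reflexive (cong (λ z → ∑ z (λ j → nat (summand j))) (sym l))) (≋-sym (nat-sum (length γ) (λ i → i) summand)))))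
      where
      summand : ℕ → ℕ
      summand j = if ⌊ suc k ℕ.≤? proj₁ (pcoeff-entry k ks) γ j ⌋ then pcoeff ks (subAt γ j (suc k)) else 0
      per-variable : ∀ j → r ℕ.+ j < M → ∀ c → c ≡ nth γ j →
        coeff M a (C._*_ (C._^_ (x (r ℕ.+ j)) (suc k)) (C.pmono r M x ks)) ≋ nat (if ⌊ suc k ℕ.≤? c ⌋ then pcoeff ks (subAt γ j (suc k)) else 0)
      per-variable j j<M c ec with suc k ℕ.≤? c
      ... | no s = coeff-pow-< M a (r ℕ.+ j) _ (suc k) j<M (ℕₚ.≰⇒> (λ s' → s (subst (suc k ≤_) (trans (e j) (sym ec)) s')))
      ... | yes s = ≋-trans (coeff-pow-≥ M a (upd a (r ℕ.+ j) (a (r ℕ.+ j) ℕ.∸ suc k)) (r ℕ.+ j) _ (suc k) j<M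
            (subst (suc k ≤_) (trans ec (sym (e j))) s) (upd-same a (r ℕ.+ j) _) (upd-other a (r ℕ.+ j) _))
          (pmono-coeff ks (subAt γ j (suc k)) _ (trans (length-subAt γ j (suc k)) l)
            (λ i i<r → trans (upd-other a (r ℕ.+ j) _ i (ℕₚ.<⇒≢ (ℕₚ.<-≤-trans i<r (ℕₚ.m≤m+n r j)))) (z i i<r)) shifted)
        where
        shifted : ∀ i → upd a (r ℕ.+ j) (a (r ℕ.+ j) ℕ.∸ suc k) (r ℕ.+ i) ≡ nth (subAt γ j (suc k)) i
        shifted i with i ℕ.≟ j
        ... | yes refl = trans (upd-same a (r ℕ.+ i) _) (trans (cong (ℕ._∸ suc k) (e i)) (sym (nth-subAt-same γ i (suc k))))
        ... | no i≢j = trans (upd-other a (r ℕ.+ j) _ (r ℕ.+ i) (λ q → i≢j (ℕₚ.+-cancelˡ-≡ r i j q)))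
            (trans (e i) (sym (nth-subAt-other γ j (suc k) i i≢j)))

    private
      takeFrom : (o s : ℕ) → (ℕ → ℕ) → Vec ℕ s
      takeFrom o zero a = V.[]
      takeFrom o (suc s) a = a o V.∷ takeFrom (suc o) s a

      takeFrom-cong : ∀ o s {a a'} → (∀ i → o ≤ i → a i ≡ a' i) → takeFrom o s a ≡ takeFrom o s a'
      takeFrom-cong o zero e = refl
      takeFrom-cong o (suc s) e = cong₂ V._∷_ (e o ℕₚ.≤-refl) (takeFrom-cong (suc o) s (λ i p → e i (ℕₚ.<⇒≤ p)))

      clear : ℕ → ℕ → (ℕ → ℕ) → ℕ → ℕ
      clear o zero a = a
      clear o (suc s) a = clear (suc o) s (upd a o 0)

      clear-< : ∀ o s a i → i < o → clear o s a i ≡ a i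
      clear-< o zero a i p = refl
      clear-< o (suc s) a i p = trans (clear-< (suc o) s _ i (ℕₚ.m≤n⇒m≤1+n p)) (upd-other a o 0 i (ℕₚ.<⇒≢ p))

      clear-in : ∀ o s a i → o ≤ i → i < o ℕ.+ s → clear o s a i ≡ 0
      clear-in o zero a i p q = ⊥-elim (ℕₚ.<⇒≱ q (ℕₚ.≤-trans (ℕₚ.≤-reflexive (ℕₚ.+-identityʳ o)) p))
      clear-in o (suc s) a i p q with i ℕ.≟ o
      ... | yes refl = trans (clear-< (suc i) s _ i ℕₚ.≤-refl) (upd-same a i 0)
      ... | no i≢o = clear-in (suc o) s _ i (ℕₚ.≤∧≢⇒< p (λ e → i≢o (sym e))) (ℕₚ.<-≤-trans q (ℕₚ.≤-reflexive (ℕₚ.+-suc o s)))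

      clear-≥ : ∀ o s a i → o ℕ.+ s ≤ i → clear o s a i ≡ a i
      clear-≥ o zero a i p = refl
      clear-≥ o (suc s) a i p = trans (clear-≥ (suc o) s _ i (ℕₚ.≤-trans (ℕₚ.≤-reflexive (sym (ℕₚ.+-suc o s))) p))
        (upd-other a o 0 i (λ e → ℕₚ.<⇒≢ (ℕₚ.<-≤-trans (ℕₚ.m<m+n o (s≤s z≤n)) p) (sym e)))

    -- After division by x_o^e, any exponent left at x_o would have to come from `g`, since the
    -- later factors involve other variables; the support hypothesis excludes that, so the exponents
    -- must agree. The offset `o` serves the recursion.
    vmono-coeff : ∀ {s} o (η : Vec ℕ s) a g → o ℕ.+ s ≤ M → (∀ a' i → o ≤ i → i < o ℕ.+ s → a' i ≢ 0 → coeff M a' g ≋ 0#) →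
      coeff M a (C._*_ (C.vmono (λ i → x (o ℕ.+ i)) η) g) ≋ (if eqVec η (takeFrom o s a) then coeff M (clear o s a) g else 0#)
    vmono-coeff o V.[] a g p supp = coeff-cong M a (C.*-identityˡ g)
    vmono-coeff {suc s} o (e V.∷ η) a g p supp = ≋-trans (coeff-cong M a reassoc) (cases (e ℕ.≤? a o) (e ℕ.≟ a o))
      where
      q : suc o ℕ.+ s ≤ M
      q = ℕₚ.≤-trans (ℕₚ.≤-reflexive (sym (ℕₚ.+-suc o s))) p
      o<M : o < M
      o<M = ℕₚ.<-≤-trans (ℕₚ.m<m+n o (s≤s z≤n)) p
      rest' = C._*_ (C.vmono (λ i → x (suc o ℕ.+ i)) η) g
      reassoc : C._≋_ (C._*_ (C.vmono (λ i → x (o ℕ.+ i)) (e V.∷ η)) g) (C._*_ (C._^_ (x o) e) rest')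
      reassoc = C.≋-trans (C.*-assoc _ _ _) (C.*-cong (C.^-cong e (C.≋-reflexive (cong x (ℕₚ.+-identityʳ o))))
        (C.*-congʳ (vmono-cong' η (λ i → cong x (ℕₚ.+-suc o i)))))
        where
        vmono-cong' : ∀ {s} {y y'} (η : Vec ℕ s) → (∀ i → y i ≡ y' i) → C._≋_ (C.vmono y η) (C.vmono y' η)
        vmono-cong' η e = C.vmono-cong η (λ i _ → C.≋-reflexive (e i))
      supp' : ∀ a' i → suc o ≤ i → i < suc o ℕ.+ s → a' i ≢ 0 → coeff M a' g ≋ 0#
      supp' a' i r s' = supp a' i (ℕₚ.<⇒≤ r) (ℕₚ.<-≤-trans s' (ℕₚ.≤-reflexive (sym (ℕₚ.+-suc o s))))
      if-0 : ∀ (β : Bool) {z} → z ≋ 0# → (if β then z else 0#) ≋ 0#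
      if-0 true h = h
      if-0 false h = ≋-refl
      reduced : ∀ k → k ≡ a o ℕ.∸ e → e ≤ a o → coeff M a (C._*_ (C._^_ (x o) e) rest')
        ≋ (if eqVec η (takeFrom (suc o) s a) then coeff M (clear (suc o) s (upd a o k)) g else 0#)
      reduced k ek le = ≋-trans (coeff-pow-≥ M a (upd a o k) o rest' e o<M le (trans (upd-same a o k) ek) (upd-other a o k))
        (≋-trans (vmono-coeff (suc o) η (upd a o k) g q supp')
          (≋-reflexive (cong (λ z → if eqVec η z then coeff M (clear (suc o) s (upd a o k)) g else 0#)
            (takeFrom-cong (suc o) s (λ i p → upd-other a o k i (λ e → ℕₚ.<⇒≢ p (sym e)))))))
      cases : Dec (e ≤ a o) → (e≟ : Dec (e ≡ a o)) → coeff M a (C._*_ (C._^_ (x o) e) rest')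
        ≋ (if ⌊ e ℕ.≟ a o ⌋ ∧ eqVec η (takeFrom (suc o) s a) then coeff M (clear (suc o) s (upd a o 0)) g else 0#)
      cases (no le) _ rewrite ⌊⌋-false (e ℕ.≟ a o) (λ e' → le (ℕₚ.≤-reflexive e')) = coeff-pow-< M a o rest' e o<M (ℕₚ.≰⇒> le)
      cases (yes le) (yes e') rewrite ⌊⌋-true (e ℕ.≟ a o) e' = reduced 0 (sym (ℕₚ.m≤n⇒m∸n≡0 (ℕₚ.≤-reflexive (sym e')))) le
      cases (yes le) (no ne) rewrite ⌊⌋-false (e ℕ.≟ a o) ne = ≋-trans (reduced (a o ℕ.∸ e) refl le)
        (if-0 (eqVec η (takeFrom (suc o) s a)) (supp _ o ℕₚ.≤-refl (ℕₚ.m<m+n o (s≤s z≤n))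
          (λ z → ℕₚ.m>n⇒m∸n≢0 (ℕₚ.≤∧≢⇒< le ne) (trans (sym (trans (clear-< (suc o) s _ o ℕₚ.≤-refl) (upd-same a o _))) z))))

    private
      takePad≡takeFrom : ∀ s o α (a : ℕ → ℕ) → (∀ i → nth α i ≡ a (o ℕ.+ i)) → takePad s α ≡ takeFrom o s a
      takePad≡takeFrom zero o α a e = refl
      takePad≡takeFrom (suc s) o [] a e = cong₂ V._∷_ (trans (e 0) (cong a (ℕₚ.+-identityʳ o)))
        (takePad≡takeFrom s (suc o) [] a (λ i → trans (e (suc i)) (cong a (ℕₚ.+-suc o i))))
      takePad≡takeFrom (suc s) o (b ∷ α) a e = cong₂ V._∷_ (trans (e 0) (cong a (ℕₚ.+-identityʳ o)))
        (takePad≡takeFrom s (suc o) α a (λ i → trans (e (suc i)) (cong a (ℕₚ.+-suc o i))))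

    mono-coeff : ∀ (η : Vec ℕ r) ks α → length (drop r α) ≡ d →
      coeff M (nth α) (C.mono M x η ks) ≋ (if eqVec η (takePad r α) then nat (pcoeff ks (drop r α)) else 0#)
    mono-coeff η ks α l = ≋-trans (vmono-coeff 0 η (nth α) (C.pmono r M x ks) (ℕₚ.m≤m+n r d)
        (λ a' i _ i<r q → pmono-support ks a' i i<r q))
      (≋-trans (≋-reflexive (cong (λ z → if eqVec η z then coeff M (clear 0 r (nth α)) (C.pmono r M x ks) else 0#)
          (sym (takePad≡takeFrom r 0 α (nth α) (λ i → refl)))))
        (if-cong (eqVec η (takePad r α)) (pmono-coeff ks (drop r α) (clear 0 r (nth α)) l
          (λ i i<r → clear-in 0 r (nth α) i z≤n i<r)
          (λ j → trans (clear-≥ 0 r (nth α) (r ℕ.+ j) (ℕₚ.m≤m+n r j)) (sym (nth-drop r α j))))))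
      where
      if-cong : ∀ (β : Bool) {z z'} → z ≋ z' → (if β then z else 0#) ≋ (if β then z' else 0#)
      if-cong true h = h
      if-cong false h = ≋-refl

-- The content of words.

ct : ℕ → List Letter → ℕ
ct v = cnt (λ a → ⌊ ∣ a ∣ ℕ.≟ suc v ⌋)

ct-same : ∀ u s w → ct u ((u , s) ∷ w) ≡ suc (ct u w)
ct-same u s w rewrite ⌊⌋-true (suc u ℕ.≟ suc u) refl = refl

ct-other : ∀ u s w v → v ≢ u → ct v ((u , s) ∷ w) ≡ ct v w
ct-other u s w v p rewrite ⌊⌋-false (suc u ℕ.≟ suc v) (λ e → p (sym (ℕₚ.suc-injective e))) = refl

LettersBelow : ℕ → List Letter → Set
LettersBelow n = All (λ l → proj₁ l < n)

All-lettersUpTo : ∀ n → All (λ l → proj₁ l < n) (lettersUpTo n)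
All-lettersUpTo n = go n (λ i → i) (λ i p → p)
  where
  go : ∀ m (g : ℕ → ℕ) → (∀ i → i < m → g i < n) → All (λ l → proj₁ l < n) (concatMap (λ v → (v , false) ∷ (v , true) ∷ []) (applyUpTo g m))
  go zero g h = []
  go (suc m) g h = h 0 (s≤s z≤n) ∷ h 0 (s≤s z≤n) ∷ go m (λ i → g (suc i)) (λ i p → h (suc i) (s≤s p))

All-words : ∀ d n → All (λ w → length w ≡ d × LettersBelow n w) (words d n)
All-words zero n = (refl , []) ∷ []
All-words (suc d) n = go (lettersUpTo n) (All-lettersUpTo n)
  where
  prepend : ∀ a → proj₁ a < n → ∀ ws → All (λ w → length w ≡ d × LettersBelow n w) ws →
    All (λ w → length w ≡ suc d × LettersBelow n w) (map (a ∷_) ws)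
  prepend a p [] [] = []
  prepend a p (w ∷ ws) ((e , b) ∷ h) = (cong suc e , p ∷ b) ∷ prepend a p ws h
  go : ∀ ls → All (λ l → proj₁ l < n) ls → All (λ w → length w ≡ suc d × LettersBelow n w) (concatMap (λ a → map (a ∷_) (words d n)) ls)
  go [] [] = []
  go (a ∷ ls) (p ∷ ps) = Allₚ.++⁺ (prepend a p (words d n) (All-words d n)) (go ls ps)

sumN-0 : ∀ n → sumN n (λ _ → 0) ≡ 0
sumN-0 zero = refl
sumN-0 (suc n) = sumN-0 n

sumN-+ : ∀ n f g → sumN n (λ i → f i ℕ.+ g i) ≡ sumN n f ℕ.+ sumN n g
sumN-+ zero f g = refl
sumN-+ (suc n) f g = trans (cong ((f 0 ℕ.+ g 0) ℕ.+_) (sumN-+ n _ _)) (lem (f 0) (g 0) _ _)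
  where
  lem : ∀ a b c e → (a ℕ.+ b) ℕ.+ (c ℕ.+ e) ≡ (a ℕ.+ c) ℕ.+ (b ℕ.+ e)
  lem a b c e = trans (ℕₚ.+-assoc a b _) (trans (cong (a ℕ.+_) (trans (sym (ℕₚ.+-assoc b c e))
    (trans (cong (ℕ._+ e) (ℕₚ.+-comm b c)) (ℕₚ.+-assoc c b e)))) (sym (ℕₚ.+-assoc a c _)))

sumN-indicator : ∀ n u → u < n → sumN n (λ v → b2n ⌊ suc u ℕ.≟ suc v ⌋) ≡ 1
sumN-indicator (suc n) zero p = cong suc (trans (sumN-cong n (λ v _ → cong b2n (⌊⌋-false (1 ℕ.≟ suc (suc v)) λ ()))) (sumN-0 n))
sumN-indicator (suc n) (suc u) (s≤s p) = trans (cong (λ z → b2n z ℕ.+ sumN n (λ v → b2n ⌊ suc (suc u) ℕ.≟ suc (suc v) ⌋)) (⌊⌋-false (suc (suc u) ℕ.≟ 1) λ ()))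
  (trans (sumN-cong n (λ v _ → cong b2n (suc-⌊≟⌋ (suc u) (suc v)))) (sumN-indicator n u p))
  where
  suc-⌊≟⌋ : ∀ a b → ⌊ suc a ℕ.≟ suc b ⌋ ≡ ⌊ a ℕ.≟ b ⌋
  suc-⌊≟⌋ a b with a ℕ.≟ b
  ... | yes e = ⌊⌋-true (suc a ℕ.≟ suc b) (cong suc e)
  ... | no ne = ⌊⌋-false (suc a ℕ.≟ suc b) (λ e → ne (ℕₚ.suc-injective e))

sumN-ct : ∀ n w → LettersBelow n w → sumN n (λ v → ct v w) ≡ length w
sumN-ct n [] [] = sumN-0 n
sumN-ct n ((u , s) ∷ w) (p ∷ h) = trans (sumN-+ n (λ v → b2n ⌊ suc u ℕ.≟ suc v ⌋) (λ v → ct v w))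
  (cong₂ ℕ._+_ (sumN-indicator n u p) (sumN-ct n w h))

sum-nth : ∀ α → sum α ≡ sumN (length α) (nth α)
sum-nth [] = refl
sum-nth (a ∷ α) = cong (a ℕ.+_) (sum-nth α)

allB-applyUpTo⁻ : ∀ m (Q : ℕ → Bool) (g : ℕ → ℕ) → allB Q (applyUpTo g m) ≡ true → ∀ i → i < m → Q (g i) ≡ true
allB-applyUpTo⁻ (suc m) Q g e zero p = ∧-trueˡ e
allB-applyUpTo⁻ (suc m) Q g e (suc i) (s≤s p) = allB-applyUpTo⁻ m Q (λ i → g (suc i)) (∧-trueʳ {Q (g 0)} e) i p

allB-applyUpTo⁺ : ∀ m (Q : ℕ → Bool) (g : ℕ → ℕ) → (∀ i → i < m → Q (g i) ≡ true) → allB Q (applyUpTo g m) ≡ true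
allB-applyUpTo⁺ zero Q g h = refl
allB-applyUpTo⁺ (suc m) Q g h rewrite h 0 (s≤s z≤n) = allB-applyUpTo⁺ m Q (λ i → g (suc i)) (λ i p → h (suc i) (s≤s p))

⌊⌋-true⁻ : {P : Set} (d : Dec P) → ⌊ d ⌋ ≡ true → P
⌊⌋-true⁻ (yes p) _ = p

content-true⁻ : ∀ w α → hasContent w α ≡ true → ∀ v → v < length α → ct v w ≡ nth α v
content-true⁻ w α e v p = trans (sym (countB≡cnt _ w)) (trans
  (⌊⌋-true⁻ (countB (λ a → ⌊ ∣ a ∣ ℕ.≟ suc v ⌋) w ℕ.≟ proj₁ (content-entry w) α v)
    (allB-applyUpTo⁻ (length α) (λ v → ⌊ countB (λ a → ⌊ ∣ a ∣ ℕ.≟ suc v ⌋) w ℕ.≟ proj₁ (content-entry w) α v ⌋) (λ i → i)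
      (∧-trueˡ (trans (sym (proj₂ (content-entry w) α)) e)) v p))
  (content-entry≡nth w α v))

-- All letters lie below `length α`, so the colour counts add up to the length of the word, and the
-- length test follows from the colour tests.
content-true⁺ : ∀ w α → LettersBelow (length α) w → (∀ v → v < length α → ct v w ≡ nth α v) → hasContent w α ≡ true
content-true⁺ w α b h = trans (proj₂ (content-entry w) α) (cong₂ _∧_
  (allB-applyUpTo⁺ (length α) (λ v → ⌊ countB (λ a → ⌊ ∣ a ∣ ℕ.≟ suc v ⌋) w ℕ.≟ proj₁ (content-entry w) α v ⌋) (λ i → i)
    (λ v p → ⌊⌋-true (_ ℕ.≟ _) (trans (countB≡cnt _ w) (trans (h v p) (sym (content-entry≡nth w α v))))))
  (⌊⌋-true (length w ℕ.≟ sum α) (trans (sym (sumN-ct (length α) w b)) (trans (sumN-cong (length α) h) (sym (sum-nth α))))))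

-- Comparison of the two coefficients.

module Extraction (A₀ : Alg) where
  open Points A₀
  open Coefficients A₀

  module _ (n : ℕ) where
    open WordWeight (S n) n (pt n) using (xprod)

    content-coeff⁺ : ∀ w a → LettersBelow n w → (∀ v → v < n → ct v w ≡ a v) → coeff n a (xprod w) ≋ 1#
    content-coeff⁺ [] a b h = coeff-1-zero n a (λ i p → sym (h i p))
    content-coeff⁺ ((u , s) ∷ w) a (p ∷ b) h = ≋-trans
      (coeff-var-suc n a u (xprod w) (ct u w) p (trans (sym (h u p)) (ct-same u s w)))
      (content-coeff⁺ w (upd a u (ct u w)) b (λ v q → lem v q (v ℕ.≟ u)))
      where
      lem : ∀ v → v < n → Dec (v ≡ u) → ct v w ≡ upd a u (ct u w) v
      lem v q (yes refl) = sym (upd-same a v _)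
      lem v q (no ne) = trans (sym (ct-other u s w v ne)) (trans (h v q) (sym (upd-other a u _ v ne)))

    content-coeff⁻ : ∀ w a → LettersBelow n w → ¬ (∀ v → v < n → ct v w ≡ a v) → coeff n a (xprod w) ≋ 0#
    content-coeff⁻ [] a b h = go n (λ e → h (λ v p → sym (e v p)))
      where
      go : ∀ n → ¬ (∀ i → i < n → a i ≡ 0) → coeff n a (Alg.1# (S n)) ≋ 0#
      go zero h = ⊥-elim (h (λ _ ()))
      go (suc n) h with a n in e
      ... | suc k = coeff-0 n a
      ... | zero = go n (λ g → h (λ i p → extend i (ℕₚ.m≤n⇒m<n∨m≡n (ℕₚ.≤-pred p)) g))
        where
        extend : ∀ i → i < n ⊎ i ≡ n → (∀ i → i < n → a i ≡ 0) → a i ≡ 0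
        extend i (inj₁ p) g = g i p
        extend i (inj₂ refl) g = e
    content-coeff⁻ ((u , s) ∷ w) a (p ∷ b) h with a u in e
    ... | zero = coeff-var-0 n a u (xprod w) p e
    ... | suc k = ≋-trans (coeff-var-suc n a u (xprod w) k p e)
      (content-coeff⁻ w (upd a u k) b (λ g → h (λ v q → lem g v q (v ℕ.≟ u))))
      where
      lem : (∀ v → v < n → ct v w ≡ upd a u k v) → ∀ v → v < n → Dec (v ≡ u) → ct v ((u , s) ∷ w) ≡ a v
      lem g v q (yes refl) = trans (ct-same v s w) (trans (cong suc (trans (g v q) (upd-same a v k))) (sym e))
      lem g v q (no ne) = trans (ct-other u s w v ne) (trans (g v q) (upd-other a u k v ne))

  record Value (x : K) (b : Carrier) : Set where
    constructor value
    field
      series : R.Carrier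
      isVAL : VAL x series
      isι : b ≋ ι series

  Value-resp : ∀ {x b b'} → b ≋ b' → Value x b → Value x b'
  Value-resp e (value r v h) = value r v (≋-trans (≋-sym e) h)

  Value-0 : Value 0K 0#
  Value-0 = value R.0# VAL-0 (≋-sym ι-0)

  Value-+ : ∀ {x y b c} → Value x b → Value y c → Value (x +K y) (b + c)
  Value-+ {x} {y} (value r v h) (value r' v' h') = value (r R.+ r') (VAL-+ {x} {y} v v') (≋-trans (+-cong h h') (≋-sym (ι-+ r r')))

  Value-sumK : {X : Set} {Pr : X → Set} (g : X → K) (h : X → Carrier) (L : List X) → All Pr L →
    (∀ u → Pr u → Value (g u) (h u)) → Value (sumK (map g L)) (∑L L h)
  Value-sumK g h [] [] e = Value-0
  Value-sumK g h (u ∷ L) (p ∷ ps) e = Value-+ {g u} {sumK (map g L)} (e u p) (Value-sumK g h L ps e)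

  Value-coeffP : ∀ {r} d α → length (drop r α) ≡ d → ∀ {f : Poly r} {F} → EvP f F →
    Value (coeffP r f α) (coeff (r ℕ.+ d) (nth α) (F (S (r ℕ.+ d)) (r ℕ.+ d) (pt (r ℕ.+ d))))
  Value-coeffP {r} d α l (nil z) = Value-resp (≋-sym (≋-trans (coeff-cong (r ℕ.+ d) (nth α) (z (S (r ℕ.+ d)) (r ℕ.+ d) (pt (r ℕ.+ d)))) (coeff-0 (r ℕ.+ d) (nth α)))) Value-0
  Value-coeffP {r} d α l {(c , η , ks) ∷ f} (cons {r = q} {F = F} v h z) = Value-resp
    (≋-sym (≋-trans (coeff-cong M (nth α) (z (S M) M (pt M))) (≋-trans (coeff-+ M (nth α) _ _)
      (+-congʳ (≋-trans (coeff-ι* M (nth α) q _) (*-congˡ (mono-coeff r d η ks α l)))))))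
    (Value-+ {if eqVec η (takePad r α) then c *K ℕtoK p else 0K} {coeffP r f α} (term (eqVec η (takePad r α))) (Value-coeffP d α l h))
    where
    M = r ℕ.+ d
    p = pcoeff ks (drop r α)
    term : ∀ β → Value (if β then c *K ℕtoK p else 0K) (ι q * (if β then nat p else 0#))
    term true = value (q R.* R.nat p) (VAL-* {c} {ℕtoK p} v (VAL-ℕ p)) (≋-sym (≋-trans (ι-* q (R.nat p)) (*-congˡ (ι-nat p))))
    term false = Value-resp (≋-sym (zeroʳ _)) Value-0

  module _ {r d : ℕ} {π : List Step} {Σm : List (ℕ × ℕ)} (P : Path r d π) (mk : IsMarking r d π Σm) where
    private
      ms = moves Σm 0 r π

    wordSum : ∀ n → Alg.Carrier (S n)
    wordSum n = Points.∑L (S n) (words d n) (Words.ωF (S n) n (pt n) r [] ms)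

    wordSum-flagSum : ∀ n → Alg._≋_ (S n) (wordSum n) (Words.flagSum (S n) n (pt n) r ms [])
    wordSum-flagSum n = subst (λ z → Alg._≋_ (S n) (Points.∑L (S n) (words z n) (Words.ωF (S n) n (pt n) r [] ms)) (Words.flagSum (S n) n (pt n) r ms []))
      (trans (cong (r ℕ.+_) (moves-pushes Σm 0 r P)) (Path-norths P))
      (Words.sum-ωF (S n) n (pt n) r ms [] (subst (Valid ms) (sym (ℕₚ.+-identityʳ r)) (moves-Valid Σm 0 r P)))

    Value-𝒢coeff : ∀ α n → length α ≡ n → Value (𝒢coeff r d π Σm α) (coeff n (nth α) (wordSum n))
    Value-𝒢coeff α n refl = Value-resp (≋-sym (coeff-∑L n (nth α) (words d n) _))
      (Value-sumK _ _ (words d n) (All-words d n) (λ w p → per-word w (proj₁ p) (proj₂ p)))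
      where
      module W = WordWeight (S n) n (pt n)
      module C = Points (S n)
      signed : List Letter → R.Carrier
      signed w = (tS R.^ inv r d π w) R.* ((R.- tS) R.^ Defs.m w)
      weight : ∀ w → length w ≡ d → C._≋_ (Words.ωF (S n) n (pt n) r [] ms w)
        (C._*_ (Words.ind (S n) n (pt n) (isFlaggedRowSuperWord r Σm w)) (C._*_ (C.ι (signed w)) (W.xprod w)))
      weight w e = C.≋-trans (W.word-weight w P mk e) (C.*-congˡ (C.≋-trans (C.≋-sym (C.*-assoc _ _ _))
        (C.*-congʳ (C.≋-sym (C.≋-trans (C.ι-* (tS R.^ inv r d π w) _) (C.*-cong (C.ι-^ tS (inv r d π w))
          (C.≋-trans (C.ι-^ (R.- tS) (Defs.m w)) (C.^-cong (Defs.m w) (C.ι-neg tS)))))))))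
      coeff-weight : ∀ w → length w ≡ d → ∀ β → isFlaggedRowSuperWord r Σm w ≡ β →
        coeff n (nth α) (Words.ωF (S n) n (pt n) r [] ms w) ≋ (if β then ι (signed w) * coeff n (nth α) (W.xprod w) else 0#)
      coeff-weight w e true eβ = ≋-trans (coeff-cong n (nth α) (C.≋-trans (weight w e)
        (C.≋-trans (C.*-congʳ (C.≋-reflexive (cong (Words.ind (S n) n (pt n)) eβ))) (C.*-identityˡ _)))) (coeff-ι* n (nth α) (signed w) _)
      coeff-weight w e false eβ = ≋-trans (coeff-cong n (nth α) (C.≋-trans (weight w e)
        (C.≋-trans (C.*-congʳ (C.≋-reflexive (cong (Words.ind (S n) n (pt n)) eβ))) (C.zeroˡ _)))) (coeff-0 n (nth α))
      per-word : ∀ w → length w ≡ d → LettersBelow n w →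
        Value (if isFlaggedRowSuperWord r Σm w ∧ hasContent w α then (tK ^K inv r d π w) *K ((-K tK) ^K Defs.m w) else 0K)
          (coeff n (nth α) (Words.ωF (S n) n (pt n) r [] ms w))
      per-word w e b = Value-resp (≋-sym (coeff-weight w e _ refl)) (cases (isFlaggedRowSuperWord r Σm w) (hasContent w α) refl)
        where
        cases : ∀ β γ → hasContent w α ≡ γ → Value (if β ∧ γ then (tK ^K inv r d π w) *K ((-K tK) ^K Defs.m w) else 0K)
          (if β then ι (signed w) * coeff n (nth α) (W.xprod w) else 0#)
        cases false γ _ = Value-0
        cases true true eγ = value (signed w)
          (VAL-* {tK ^K inv r d π w} {(-K tK) ^K Defs.m w} (VAL-^ {tK} (inv r d π w) VAL-t) (VAL-^ { -K tK} (Defs.m w) (VAL-neg {tK} VAL-t)))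
          (≋-trans (*-congˡ (content-coeff⁺ n w (nth α) b (content-true⁻ w α eγ))) (*-identityʳ _))
        cases true false eγ = Value-resp (≋-sym (≋-trans (*-congˡ (content-coeff⁻ n w (nth α) b (λ h →
          true≢false (trans (sym (content-true⁺ w α b h)) eγ)))) (zeroʳ _))) Value-0
          where
          true≢false : true ≢ false
          true≢false ()

    wordSum-≤ : ∀ n → r ≤ n → Alg._≋_ (S n) (wordSum n) (weighted r (queueSum ms) (range 0 r) (S n) n (pt n))
    wordSum-≤ n r≤n = C.≋-trans (wordSum-flagSum n) (C.≋-trans (C.≋-sym (C.*-identityˡ _))
      (subst (λ z → C._≋_ (C._*_ C.1# (Words.flagSum (S n) n (pt n) r ms [])) (weighted z (queueSum ms) (range 0 z) (S n) n (pt n)))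
        (ℕₚ.+-identityʳ r) (Words.flagSum-≤ (S n) n (pt n) r ms 0 (subst (_≤ n) (sym (ℕₚ.+-identityʳ r)) r≤n))))
      where module C = Points (S n)

    wordSum-> : ∀ n → n < r → Alg._≋_ (S n) (wordSum n) (Alg.0# (S n))
    wordSum-> n n<r = Alg.≋-trans (S n) (wordSum-flagSum n)
      (Words.flagSum-> (S n) n (pt n) r ms 0 z≤n (subst (n <_) (sym (ℕₚ.+-identityʳ r)) n<r))

    χ-value : Σ Fun λ F → EvP (χ r π Σm) F × F ≐[ r ] weighted r (queueSum ms) (range 0 r)
    χ-value with foldr applyMove (0 , (1K , V.[] , []) ∷ []) ms | foldr-value (moves-Valid Σm 0 r P)
    -- Matching on the size equation turns the test in `χ` into a comparison of s with itself, so
    -- its default branch is impossible.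
    ... | (s , f) | refl , F , hF , eF with s ℕ.≟ s
    ... | yes refl = F , hF , eF
    ... | no ne = ⊥-elim (ne refl)

    private
      prodX-var-0 : ∀ M a v s g → v < s → s ≤ M → a v ≡ 0 →
        coeff M a (Alg._*_ (S M) (Products.prodX (S M) s (pt M)) g) ≋ 0#
      prodX-var-0 M a v (suc s) g p q e with v ℕ.≟ s
      ... | yes refl = ≋-trans (coeff-cong M a (C.≋-trans (C.*-congʳ (C.≋-trans (Products.prodX-last (S M) v (pt M)) (C.*-comm _ _))) (C.*-assoc _ _ _)))
          (coeff-var-0 M a v _ q e)
        where module C = Points (S M)
      ... | no ne = ≋-trans (coeff-cong M a (C.≋-trans (C.*-congʳ (Products.prodX-last (S M) s (pt M))) (C.*-assoc _ _ _)))
          (prodX-var-0 M a v s _ (ℕₚ.≤∧≢⇒< (ℕₚ.≤-pred p) ne) (ℕₚ.<⇒≤ q) e)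
        where module C = Points (S M)

    common-value : ∀ α → Σ Carrier λ b → Value (𝒢coeff r d π Σm α) b × Value (coeffP r (χ r π Σm) α) b
    common-value α with r ℕ.≤? length α | χ-value
    -- The number of variables M equals `length α`, but is kept as r + (length α - r) to separate
    -- head and tail variables.
    ... | yes r≤n | F , hF , eF = _ , Value-𝒢coeff α M (sym (ℕₚ.m+[n∸m]≡n r≤n)) ,
      Value-resp (coeff-cong M (nth α) (Alg.≋-trans (S M) (eF (S M) M (pt M) r≤M (pt-Reg M)) (Alg.≋-sym (S M) (wordSum-≤ M r≤M))))
        (Value-coeffP (length α ℕ.∸ r) α (Lₚ.length-drop r α) hF)
      where
      M = r ℕ.+ (length α ℕ.∸ r)
      r≤M = ℕₚ.m≤m+n r (length α ℕ.∸ r)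
    -- Here the exponent of x_n is 0 for n = `length α` < r. The sum over words vanishes by
    -- `wordSum->`; on the operator side x_n is a factor of the value, so its coefficient vanishes
    -- too.
    ... | no r≰n | F , hF , eF = 0# ,
      Value-resp (≋-trans (coeff-cong n (nth α) (wordSum-> n n<r)) (coeff-0 n (nth α))) (Value-𝒢coeff α n refl) ,
      Value-resp (≋-trans (coeff-cong M (nth α) (eF (S M) M (pt M) r≤M (pt-Reg M)))
          (prodX-var-0 M (nth α) n r _ n<r r≤M (nth-beyond α n ℕₚ.≤-refl)))
        (Value-coeffP 0 α (trans (Lₚ.length-drop r α) (ℕₚ.m≤n⇒m∸n≡0 (ℕₚ.<⇒≤ n<r))) hF)
      where
      n = length α
      M = r ℕ.+ 0
      r≤M = ℕₚ.m≤m+n r 0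
      n<r = ℕₚ.≰⇒> r≰n

theorem5p14 : (r d : ℕ) (π : List Step) → IsDyck r d π →
    (Σm : List (ℕ × ℕ)) → IsMarking r d π Σm →
    (α : Mon) → 𝒢coeff r d π Σm α ≈ coeffP r (χ r π Σm) α
theorem5p14 r d π dyck Σm mk α =
  -- Over ℚ[[t]] itself `ι` is the identity, so the common value b is the power series expansion of
  -- both coefficients.
  let b , V₁ , V₂ = Extraction.common-value R₀Alg (Dyck-Path {x = 0} r d dyck refl refl) mk α
      r₁ = series V₁
      r₂ = series V₂
  in VAL-≈ {r = r₂} (VAL-resp {r = r₁} (R.≋-trans {r₁} {b} {r₂} (R.≋-sym {b} {r₁} (isι V₁)) (isι V₂)) (isVAL V₁)) (isVAL V₂)
  where open Extraction.Value
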